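{- For $n\ge1$ let $P_{n}^{(\mathrm{lpk},\mathrm{ipk})}(s,t)=\sum_{\pi\in\mathfrak{S}_{n}}s^{\mathrm{lpk}(\pi)}t^{\mathrm{ipk}(\pi)+1}$. Then: (a) As formal power series, \[ \frac{1}{(1-s)(1-t)}+\frac{1}{2}\sum_{n=1}^{\infty}\frac{(1+s)^{n}(1+t)^{n+1}}{((1-s)(1-t))^{n+1}}P_{n}^{(\mathrm{lpk},\mathrm{ipk})}\left(\frac{4s}{(1+s)^{2}},\frac{4t}{(1+t)^{2}}\right)x^{n} =\sum_{i,j=0}^{\infty}\left(\frac{1+x}{1-x}\right)^{2ij+j}s^{i}t^{j}. \] (b) For all $n\geq1$, \[ \frac{(1+s)^{n}(1+t)^{n+1}}{((1-s)(1-t))^{n+1}}P_{n}^{(\mathrm{lpk},\mathrm{ipk})}\left(\frac{4s}{(1+s)^{2}},\frac{4t}{(1+t)^{2}}\right) =2\sum_{i,j=0}^{\infty}\sum_{k=0}^{n}\binom{2ij+j}{k}\binom{2ij+j+n-k-1}{n-k}s^{i}t^{j}. \] (c) For all $n\geq1$, \[ \frac{(1+s)^{n}(1+t)^{n+1}}{((1-s)(1-t))^{n+1}}P_{n}^{(\mathrm{lpk},\mathrm{ipk})}\left(\frac{4s}{(1+s)^{2}},\frac{4t}{(1+t)^{2}}\right) =\frac{1}{n!}\sum_{k=0}^n 2^{k+1} d(n,k)\frac{B_{k}(s)A_{k}(t)}{(1-s)^{k+1}(1-t)^{k+1}}. \]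
   Context: $\mathfrak{S}_n$ is the symmetric group on $[n]$. For $\pi\in\mathfrak{S}_n$: $i\in[n-1]$ is a descent if $\pi(i)>\pi(i+1)$, $\mathrm{des}(\pi)$ the number of descents; $i$ with $2\le i\le n-1$ is a peak if $\pi(i-1)<\pi(i)>\pi(i+1)$, $\mathrm{pk}(\pi)$ the number of peaks, $\mathrm{ipk}(\pi)=\mathrm{pk}(\pi^{ -1})$; $i\in[n-1]$ is a left peak if $i$ is a peak or if $i=1$ and $\pi(1)>\pi(2)$, $\mathrm{lpk}(\pi)$ the number of left peaks. $A_n(t)=\sum_{\pi\in\mathfrak{S}_n}t^{\mathrm{des}(\pi)+1}$ for $n\ge1$, $A_0=1$. The type B Eulerian polynomials $B_n(t)$ are defined by $\frac{B_{n}(t)}{(1-t)^{n+1}}=\sum_{k\ge0}(2k+1)^{n}t^{k}$. $d(n,k)$ is the number of permutations in $\mathfrak{S}_n$ with exactly $k$ cycles, all of odd length (with $d(0,0)=1$). -}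

module Defs where

open import Data.Bool using (Bool; true; false; if_then_else_; _∧_)
open import Data.Nat as ℕ using (ℕ; zero; suc; _∸_; _<ᵇ_; _≡ᵇ_; _!)
open import Data.Nat.Properties using (_!≢0)
open import Data.Nat.Combinatorics using (_C_)
open import Data.Integer using (+_)
open import Data.List using (List; []; _∷_; foldr; map; concatMap; length; filterᵇ; upTo)
open import Data.Rational using (ℚ; 0ℚ; 1ℚ; ½; _+_; _*_; -_; _/_)

ℕ→ℚ : ℕ → ℚ
ℕ→ℚ m = + m / 1

inv! : ℕ → ℚ
inv! n = + 1 / (n !)
  where instance _ = n !≢0

sumTo : ℕ → (ℕ → ℚ) → ℚ
sumTo zero    f = f 0
sumTo (suc n) f = sumTo n f + f (suc n)

-- Permutations of [n] in one-line notation: lists of the values 1..n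

insertions : ℕ → List ℕ → List (List ℕ)
insertions x []       = (x ∷ []) ∷ []
insertions x (y ∷ ys) = (x ∷ y ∷ ys) ∷ map (y ∷_) (insertions x ys)

perms : ℕ → List (List ℕ)
perms zero    = [] ∷ []
perms (suc n) = concatMap (insertions (suc n)) (perms n)

-- π(i), 1-based (0 outside the range)
app : List ℕ → ℕ → ℕ
app []       _             = 0
app (x ∷ xs) zero          = 0
app (x ∷ xs) (suc zero)    = x
app (x ∷ xs) (suc (suc i)) = app xs (suc i)

posOf : ℕ → List ℕ → ℕ
posOf v []       = 0
posOf v (x ∷ xs) = if x ≡ᵇ v then 1 else suc (posOf v xs)

inv : List ℕ → List ℕ
inv π = map (λ v → posOf v π) (map suc (upTo (length π)))

count : (ℕ → Bool) → List ℕ → ℕ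
count p xs = length (filterᵇ p xs)

idx : List ℕ → List ℕ
idx π = map suc (upTo (length π))

des : List ℕ → ℕ
des π = count (λ i → (i <ᵇ length π) ∧ (app π (suc i) <ᵇ app π i)) (idx π)

pk : List ℕ → ℕ
pk π = count (λ i → (1 <ᵇ i) ∧ (i <ᵇ length π)
                    ∧ (app π (i ∸ 1) <ᵇ app π i) ∧ (app π (suc i) <ᵇ app π i)) (idx π)

lpk : List ℕ → ℕ
lpk π = pk π ℕ.+ (if (1 <ᵇ length π) ∧ (app π 2 <ᵇ app π 1) then 1 else 0)

ipk : List ℕ → ℕ
ipk π = pk (inv π)

iter : List ℕ → ℕ → ℕ → ℕ
iter π zero    i = i
iter π (suc m) i = app π (iter π m i)

cycLenFrom : List ℕ → ℕ → ℕ → ℕ → ℕ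
cycLenFrom π i m zero       = m
cycLenFrom π i m (suc fuel) = if iter π m i ≡ᵇ i then m else cycLenFrom π i (suc m) fuel

cycLen : List ℕ → ℕ → ℕ
cycLen π i = cycLenFrom π i 1 (length π)

isCycMin : List ℕ → ℕ → Bool
isCycMin π i = foldr (λ m b → b ∧ ((i ≡ᵇ iter π m i) Data.Bool.∨ (i <ᵇ iter π m i))) true (upTo (length π))

cyc : List ℕ → ℕ
cyc π = count (isCycMin π) (idx π)

isOdd : ℕ → Bool
isOdd zero          = false
isOdd (suc zero)    = true
isOdd (suc (suc n)) = isOdd n

allOddCycles : List ℕ → Bool
allOddCycles π = foldr (λ i b → b ∧ isOdd (cycLen π i)) true (idx π)

d : ℕ → ℕ → ℕ
d n k = length (filterᵇ (λ π → allOddCycles π ∧ (cyc π ≡ᵇ k)) (perms n))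

-- Formal power series with rational coefficients (coefficient functions)

PS₁ : Set
PS₁ = ℕ → ℚ            -- f k = [x^k] f

PS₂ : Set
PS₂ = ℕ → ℕ → ℚ        -- F i j = [s^i t^j] F

PS₃ : Set
PS₃ = ℕ → ℕ → ℕ → ℚ    -- G n i j = [x^n s^i t^j] G

_≋₂_ : PS₂ → PS₂ → Set
F ≋₂ G = ∀ i j → F i j Relation.Binary.PropositionalEquality.≡ G i j
  where import Relation.Binary.PropositionalEquality

one₁ : PS₁
one₁ zero    = 1ℚ
one₁ (suc _) = 0ℚ

X₁ : PS₁
X₁ (suc zero) = 1ℚ
X₁ _          = 0ℚ

_+₁_ : PS₁ → PS₁ → PS₁
(f +₁ g) k = f k + g k

_*₁_ : PS₁ → PS₁ → PS₁
(f *₁ g) k = sumTo k (λ a → f a * g (k ∸ a))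

scale₁ : ℚ → PS₁ → PS₁
scale₁ c f k = c * f k

pow₁ : PS₁ → ℕ → PS₁
pow₁ f zero    = one₁
pow₁ f (suc m) = f *₁ pow₁ f m

onePlusX : PS₁
onePlusX = one₁ +₁ X₁

oneMinusX : PS₁
oneMinusX = one₁ +₁ scale₁ (- 1ℚ) X₁

-- 1/(1-x) = Σ_k x^k  (the inverse of 1 - x)
invOneMinusX : PS₁
invOneMinusX _ = 1ℚ

-- 1/(1+x) = Σ_k (-1)^k x^k  (the inverse of 1 + x)
invOnePlusX : PS₁
invOnePlusX zero          = 1ℚ
invOnePlusX (suc zero)    = - 1ℚ
invOnePlusX (suc (suc k)) = invOnePlusX k

zero₂ : PS₂
zero₂ _ _ = 0ℚ

_+₂_ : PS₂ → PS₂ → PS₂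
(F +₂ G) i j = F i j + G i j

_*₂_ : PS₂ → PS₂ → PS₂
(F *₂ G) i j = sumTo i (λ a → sumTo j (λ b → F a b * G (i ∸ a) (j ∸ b)))

scale₂ : ℚ → PS₂ → PS₂
scale₂ c F i j = c * F i j

one₂ : PS₂
one₂ zero zero = 1ℚ
one₂ _    _    = 0ℚ

pow₂ : PS₂ → ℕ → PS₂
pow₂ F zero    = one₂
pow₂ F (suc m) = F *₂ pow₂ F m

inS : PS₁ → PS₂
inS f i zero    = f i
inS f i (suc _) = 0ℚ

inT : PS₁ → PS₂
inT f zero    j = f j
inT f (suc _) j = 0ℚ

sumList₂ : {A : Set} → (A → PS₂) → List A → PS₂
sumList₂ f = foldr (λ a G → f a +₂ G) zero₂

sumTo₂ : ℕ → (ℕ → PS₂) → PS₂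
sumTo₂ zero    F = F 0
sumTo₂ (suc n) F = sumTo₂ n F +₂ F (suc n)

fourYOver : PS₁
fourYOver = scale₁ (ℕ→ℚ 4) (X₁ *₁ (invOnePlusX *₁ invOnePlusX))

Pev : ℕ → PS₂ → PS₂ → PS₂
Pev n U V = sumList₂ (λ π → pow₂ U (lpk π) *₂ pow₂ V (suc (ipk π))) (perms n)

Fser : ℕ → PS₂
Fser n =
  (inS (pow₁ onePlusX n) *₂ inT (pow₁ onePlusX (suc n)))
  *₂ ((inS (pow₁ invOneMinusX (suc n)) *₂ inT (pow₁ invOneMinusX (suc n)))
  *₂ Pev n (inS fourYOver) (inT fourYOver))

Aeul : ℕ → PS₁
Aeul zero    = one₁
Aeul (suc k) m = ℕ→ℚ (length (filterᵇ (λ π → suc (des π) ≡ᵇ m) (perms (suc k))))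

-- type B Eulerian polynomials: B_k(t) = (1-t)^(k+1) Σ_m (2m+1)^k t^m
Beul : ℕ → PS₁
Beul k = pow₁ oneMinusX (suc k) *₁ (λ m → ℕ→ℚ ((suc (2 ℕ.* m)) ℕ.^ k))

seriesX : (ℕ → PS₂) → PS₃
seriesX G n i j = G n i j

seriesST : (ℕ → ℕ → PS₁) → PS₃
seriesST g n i j = g i j n

_+₃_ : PS₃ → PS₃ → PS₃
(F +₃ G) n i j = F n i j + G n i j

LHSa : PS₃
LHSa = seriesX (λ { zero → inS invOneMinusX *₂ inT invOneMinusX ; _ → zero₂ })
    +₃ seriesX (λ { zero → zero₂ ; (suc n) → scale₂ ½ (Fser (suc n)) })

RHSa : PS₃
RHSa = seriesST (λ i j → pow₁ (onePlusX *₁ invOneMinusX) (2 ℕ.* i ℕ.* j ℕ.+ j))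

-- part (b) right side; C(2ij+j+n-k-1, n-k) with the top written (m+(n-k))∸1
RHSb : ℕ → PS₂
RHSb n i j = ℕ→ℚ 2 * sumTo n (λ k →
  ℕ→ℚ ((m C k) ℕ.* ((m ℕ.+ (n ∸ k) ∸ 1) C (n ∸ k))))
  where m = 2 ℕ.* i ℕ.* j ℕ.+ j

RHSc : ℕ → PS₂
RHSc n = scale₂ (inv! n) (sumTo₂ n (λ k →
  scale₂ (ℕ→ℚ (2 ℕ.^ suc k ℕ.* d n k))
    (inS (Beul k *₁ pow₁ invOneMinusX (suc k)) *₂ inT (Aeul k *₁ pow₁ invOneMinusX (suc k)))))

{-# OPTIONS --safe #-}
module Submission where

-- A word w and an alphabet X of signed letters have a number F X w of weakly
-- increasing maps from the positions of w to X under which a positive letter is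
-- taken on an increasing factor of w and a negative letter on a decreasing one.
-- For X = +(-+)^i and X = (-+)^j these are the left enriched and the enriched
-- P-partitions, and a transfer computation along w shows that the generating
-- functions in i and j are the factors of the left side belonging to lpk and pk.
--
-- So everything reduces to Σ_π F X π · F Y π⁻¹.  Splitting off the last letter of Y
-- writes π as a shuffle of a smaller permutation with a monotone word on the largest
-- values; as F X is multiplicative over shuffles, each pair -+ of Y contributes the
-- factor ((1+x)/(1-x))^|X|.  Reading off coefficients gives (a) and (b).
--
-- For (c), the coefficient of x^n in ((1+x)/(1-x))^m times n! satisfies
-- D(n+2) = 2m D(n+1) + (n+1) n D(n), as does the sum of (2m)^cyc over the permutations
-- with odd cycles only: n+2 is a fixed point, or it and one neighbour can be removed
-- from its cycle.  The Eulerian factors are evaluated by Σ_π F (+^j) π = j^k.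

-- The exponents i and j are alphabet sizes, so each identity is checked at one coefficient of s^i
-- t^j and x is the only variable left. All three parts are compared with the same number, 2 [x^n]
-- ((1+x)/(1-x))^((2i+1)j). Its exponent is |X| times the number of pairs of Y.
--
-- Only |X| matters, not the signs in X. On an increasing word a positive letter contributes 1/(1-x)
-- and a negative one 1+x; on a decreasing word the roles are exchanged. A pair -+ of Y produces one
-- word of each kind, so every letter of X meets both.
--
-- The series form a commutative semiring whose equations are normalised mechanically. For this
-- reason quotients enter through subtraction-free relations such as 1/(1-x) = 1 + x/(1-x).

open import Defs
open import Algebra.Bundles using (CommutativeSemiring; CommutativeRing)
open import Algebra.Structures using (IsCommutativeSemiring)
open import Data.Bool using (Bool; true; false; if_then_else_; _∧_; _∨_; not)
import Data.Bool.Properties as Bool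
open import Data.Bool.ListAction using (all; any)
open import Data.Empty using (⊥; ⊥-elim)
import Data.Integer as ℤ
import Data.Integer.Properties as ℤ
open import Data.List using (List; []; _∷_; _++_; _∷ʳ_; length; map; foldr; concatMap; replicate; filter; filterᵇ; upTo; applyUpTo; applyDownFrom; reverse; take; drop)
open import Data.List.Properties
open import Data.List.Membership.Propositional using (_∈_; _∉_; find; lose)
open import Data.List.Membership.Propositional.Properties
open import Data.List.Relation.Binary.Permutation.Propositional using (_↭_; ↭-sym; ↭-trans; ↭-refl; ↭-reflexive; ↭-prep; ↭⇒↭ₛ)
open import Data.List.Relation.Binary.Permutation.Propositional.Properties using (∈-resp-↭; ↭-length; shift; drop-∷; filter-↭; ++-comm; ++⁺ʳ; ↭-reverse; All-resp-↭; ∷↭∷ʳ; ↭-empty-inv; ↭-singleton-inv)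
import Data.List.Relation.Binary.Permutation.Setoid.Properties as Permutation
open import Data.List.Relation.Binary.Subset.Propositional using (_⊆_)
open import Data.List.Relation.Unary.All as All using (All; []; _∷_)
import Data.List.Relation.Unary.All.Properties as All
open import Data.List.Relation.Unary.AllPairs using ([]; _∷_)
open import Data.List.Relation.Unary.Any using (here; there)
open import Data.List.Relation.Unary.Unique.Propositional using (Unique)
open import Data.List.Relation.Unary.Unique.Propositional.Properties as Unique using (Unique[x∷xs]⇒x∉xs)
open import Data.Nat as ℕ using (ℕ; zero; suc; pred; _∸_; _≤_; _<_; _≥_; _≰_; z≤n; s≤s; _<ᵇ_; _≡ᵇ_; _!)
import Data.Nat.Properties as ℕ
open import Data.Nat.Combinatorics using (_C_; nCk+nC[k+1]≡[n+1]C[k+1]; k>n⇒nCk≡0; nCk≡nC[n∸k]; nCn≡1)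
open import Data.Nat.DivMod using (_%_; _/_; m≡m%n+[m/n]*n; m%n<n)
open import Data.Product using (_×_; _,_; proj₁; proj₂; ∃)
open import Data.Rational as ℚ using (ℚ; 0ℚ; 1ℚ; ½)
import Data.Rational.Properties as ℚ
import Data.Rational.Unnormalised as ℚᵘ
import Data.Rational.Unnormalised.Properties as ℚᵘ
open import Data.Sum using (inj₁; inj₂)
open import Function using (_∘_)
open import Level using (0ℓ)
open import Relation.Binary using (IsEquivalence; tri<; tri≈; tri>)
open import Relation.Binary.PropositionalEquality
import Relation.Binary.Reasoning.Setoid as SetoidReasoning
open import Relation.Nullary using (yes; no)
open import Relation.Nullary.Negation using (contradiction)
open import Relation.Unary using (Pred; Decidable; ∁)
open import Relation.Unary.Properties using (∁?)

-- Opaque copies of the rational operations: the originals match on their arguments,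
-- which keeps unification from ever inferring a summand or a factor.
opaque
  infixl 6 _+_
  infixl 7 _*_
  _+_ _*_ : ℚ → ℚ → ℚ
  _+_ = ℚ._+_
  _*_ = ℚ._*_

  +-def : ∀ a b → a ℚ.+ b ≡ a + b
  +-def a b = refl

  *-def : ∀ a b → a ℚ.* b ≡ a * b
  *-def a b = refl

  ℚ-isCommutativeSemiring : IsCommutativeSemiring _≡_ _+_ _*_ 0ℚ 1ℚ
  ℚ-isCommutativeSemiring = CommutativeRing.isCommutativeSemiring ℚ.+-*-commutativeRing

  nat : ℕ → ℚ
  nat = ℕ→ℚ

  nat-def : ∀ n → ℕ→ℚ n ≡ nat n
  nat-def n = refl

  nat-0 : nat 0 ≡ 0ℚ
  nat-0 = refl

  nat-1 : nat 1 ≡ 1ℚ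
  nat-1 = refl

  nat-+ : ∀ m n → nat (m ℕ.+ n) ≡ nat m + nat n
  nat-+ m n = sym (ℚ.toℚᵘ-injective {ℕ→ℚ m ℚ.+ ℕ→ℚ n} {ℕ→ℚ (m ℕ.+ n)}
    (ℚᵘ.≃-trans (ℚ.toℚᵘ-homo-+ (ℕ→ℚ m) (ℕ→ℚ n))
    (ℚᵘ.≃-trans (ℚᵘ.+-cong (ℚ.toℚᵘ-fromℚᵘ (ℚᵘ.mkℚᵘ (ℤ.+ m) 0)) (ℚ.toℚᵘ-fromℚᵘ (ℚᵘ.mkℚᵘ (ℤ.+ n) 0)))
    (ℚᵘ.≃-trans (ℚᵘ.*≡* (cong (ℤ._* (ℤ.+ 1)) (cong₂ ℤ._+_ (ℤ.*-identityʳ (ℤ.+ m)) (ℤ.*-identityʳ (ℤ.+ n)))))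
      (ℚᵘ.≃-sym (ℚ.toℚᵘ-fromℚᵘ (ℚᵘ.mkℚᵘ (ℤ.+ (m ℕ.+ n)) 0)))))))

  nat-* : ∀ m n → nat (m ℕ.* n) ≡ nat m * nat n
  nat-* m n = sym (ℚ.toℚᵘ-injective {ℕ→ℚ m ℚ.* ℕ→ℚ n} {ℕ→ℚ (m ℕ.* n)}
    (ℚᵘ.≃-trans (ℚ.toℚᵘ-homo-* (ℕ→ℚ m) (ℕ→ℚ n))
    (ℚᵘ.≃-trans (ℚᵘ.*-cong (ℚ.toℚᵘ-fromℚᵘ (ℚᵘ.mkℚᵘ (ℤ.+ m) 0)) (ℚ.toℚᵘ-fromℚᵘ (ℚᵘ.mkℚᵘ (ℤ.+ n) 0)))
    (ℚᵘ.≃-trans (ℚᵘ.*≡* (cong (ℤ._* (ℤ.+ 1)) (sym (ℤ.pos-* m n))))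
      (ℚᵘ.≃-sym (ℚ.toℚᵘ-fromℚᵘ (ℚᵘ.mkℚᵘ (ℤ.+ (m ℕ.* n)) 0)))))))

ℚ-semiring : CommutativeSemiring 0ℓ 0ℓ
ℚ-semiring = record { isCommutativeSemiring = ℚ-isCommutativeSemiring }

open CommutativeSemiring ℚ-semiring
  using (+-assoc; +-comm; +-identityˡ; +-identityʳ; *-assoc; *-comm; *-identityˡ; *-identityʳ; zeroˡ; zeroʳ)
  renaming (distribˡ to *-distribˡ-+; distribʳ to *-distribʳ-+)
open import Algebra.Solver.Ring.NaturalCoefficients.Default ℚ-semiring
  using (solve; _:+_; _:*_; _:=_)

nat-suc : ∀ n → nat (suc n) ≡ 1ℚ + nat n
nat-suc n = trans (nat-+ 1 n) (cong (_+ nat n) nat-1)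

-- Finite sums and the semiring of formal power series in one variable

Σ≤ : ℕ → (ℕ → ℚ) → ℚ
Σ≤ zero    f = f 0
Σ≤ (suc n) f = Σ≤ n f + f (suc n)

sumTo-def : ∀ n f → sumTo n f ≡ Σ≤ n f
sumTo-def zero    f = refl
sumTo-def (suc n) f = trans (+-def _ _) (cong (_+ f (suc n)) (sumTo-def n f))

+-interchange : ∀ a b c d → (a + b) + (c + d) ≡ (a + c) + (b + d)
+-interchange = solve 4 (λ a b c d → (a :+ b) :+ (c :+ d) := (a :+ c) :+ (b :+ d)) refl

Σ≤-cong : ∀ n {f g : ℕ → ℚ} → (∀ a → a ≤ n → f a ≡ g a) → Σ≤ n f ≡ Σ≤ n g
Σ≤-cong zero    eq = eq 0 z≤n
Σ≤-cong (suc n) eq = cong₂ _+_ (Σ≤-cong n (λ a a≤n → eq a (ℕ.m≤n⇒m≤1+n a≤n))) (eq (suc n) ℕ.≤-refl)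

Σ≤-suc : ∀ n f → Σ≤ (suc n) f ≡ f 0 + Σ≤ n (f ∘ suc)
Σ≤-suc zero    f = refl
Σ≤-suc (suc n) f = trans (cong (_+ f (suc (suc n))) (Σ≤-suc n f)) (+-assoc (f 0) _ _)

Σ≤-+ : ∀ n f g → Σ≤ n (λ a → f a + g a) ≡ Σ≤ n f + Σ≤ n g
Σ≤-+ zero    f g = refl
Σ≤-+ (suc n) f g = trans (cong₂ _+_ (Σ≤-+ n f g) refl) (+-interchange _ _ _ _)

Σ≤-*ˡ : ∀ n c f → Σ≤ n (λ a → c * f a) ≡ c * Σ≤ n f
Σ≤-*ˡ zero    c f = refl
Σ≤-*ˡ (suc n) c f = trans (cong₂ _+_ (Σ≤-*ˡ n c f) refl) (sym (*-distribˡ-+ c _ _))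

Σ≤-*ʳ : ∀ n c f → Σ≤ n (λ a → f a * c) ≡ Σ≤ n f * c
Σ≤-*ʳ zero    c f = refl
Σ≤-*ʳ (suc n) c f = trans (cong₂ _+_ (Σ≤-*ʳ n c f) refl) (sym (*-distribʳ-+ c _ _))

Σ≤-0 : ∀ n → Σ≤ n (λ _ → 0ℚ) ≡ 0ℚ
Σ≤-0 zero    = refl
Σ≤-0 (suc n) = trans (cong (_+ 0ℚ) (Σ≤-0 n)) (+-identityˡ 0ℚ)

-- A record, so that the two series can be inferred from an equation between them.
infix 4 _≋_
record _≋_ (f g : PS₁) : Set where
  constructor mk≋
  field at : ∀ k → f k ≡ g k
open _≋_

0₁ : PS₁
0₁ _ = 0ℚ

opaque
  infixl 6 _⊕_
  infixl 7 _⊛_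
  _⊕_ _⊛_ : PS₁ → PS₁ → PS₁
  (f ⊕ g) k = f k + g k
  (f ⊛ g) k = Σ≤ k (λ a → f a * g (k ∸ a))

  ⊕-at : ∀ f g k → (f ⊕ g) k ≡ f k + g k
  ⊕-at f g k = refl

  ⊛-at : ∀ f g k → (f ⊛ g) k ≡ Σ≤ k (λ a → f a * g (k ∸ a))
  ⊛-at f g k = refl

scl : ℚ → PS₁ → PS₁
scl c f k = c * f k

*₁-def : ∀ f g k → (f *₁ g) k ≡ (f ⊛ g) k
*₁-def f g k = trans (sumTo-def k _) (trans (Σ≤-cong k (λ a _ → *-def _ _)) (sym (⊛-at f g k)))

⊛-0 : ∀ f g → (f ⊛ g) 0 ≡ f 0 * g 0
⊛-0 f g = ⊛-at f g 0

⊛-sucˡ : ∀ f g k → (f ⊛ g) (suc k) ≡ f 0 * g (suc k) + (f ∘ suc ⊛ g) k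
⊛-sucˡ f g k = trans (⊛-at f g (suc k))
  (trans (Σ≤-suc k _) (cong (λ x → f 0 * g (suc k) + x) (sym (⊛-at (f ∘ suc) g k))))

⊛-sucʳ : ∀ f g k → (f ⊛ g) (suc k) ≡ (f ⊛ g ∘ suc) k + f (suc k) * g 0
⊛-sucʳ f g k = trans (⊛-at f g (suc k)) (cong₂ _+_
  (trans (Σ≤-cong k (λ a a≤k → cong (λ x → f a * g x) (ℕ.+-∸-assoc 1 a≤k))) (sym (⊛-at f (g ∘ suc) k)))
  (cong (λ x → f (suc k) * g x) (ℕ.n∸n≡0 k)))

⊛-cong : ∀ {f f' g g'} → f ≋ f' → g ≋ g' → f ⊛ g ≋ f' ⊛ g'
⊛-cong {f} {f'} {g} {g'} p q .at k = trans (⊛-at f g k)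
  (trans (Σ≤-cong k (λ a _ → cong₂ _*_ (at p a) (at q _))) (sym (⊛-at f' g' k)))

⊕-cong : ∀ {f f' g g'} → f ≋ f' → g ≋ g' → f ⊕ g ≋ f' ⊕ g'
⊕-cong {f} {f'} {g} {g'} p q .at k = trans (⊕-at f g k) (trans (cong₂ _+_ (at p k) (at q k)) (sym (⊕-at f' g' k)))

≋-isEquivalence : IsEquivalence _≋_
≋-isEquivalence = record
  { refl  = mk≋ λ _ → refl
  ; sym   = λ p → mk≋ λ k → sym (at p k)
  ; trans = λ p q → mk≋ λ k → trans (at p k) (at q k) }

-- `⊛-sucˡ` peels the first term off one convolution and `⊛-sucʳ` the last term off the other. These
-- agree, and the rest is the claim for the tail of `f`.
⊛-comm : ∀ f g → f ⊛ g ≋ g ⊛ f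
⊛-comm f g .at = go f g
  where
  go : ∀ f g k → (f ⊛ g) k ≡ (g ⊛ f) k
  go f g zero    = trans (⊛-0 f g) (trans (*-comm (f 0) (g 0)) (sym (⊛-0 g f)))
  go f g (suc k) = trans (⊛-sucˡ f g k) (trans (cong₂ _+_ (*-comm (f 0) _) (go (f ∘ suc) g k))
    (trans (+-comm _ _) (sym (⊛-sucʳ g f k))))

⊛-distribʳ : ∀ h f g → (f ⊕ g) ⊛ h ≋ f ⊛ h ⊕ g ⊛ h
⊛-distribʳ h f g .at k = trans (⊛-at (f ⊕ g) h k)
  (trans (Σ≤-cong k (λ a _ → trans (cong (_* h (k ∸ a)) (⊕-at f g a)) (*-distribʳ-+ (h (k ∸ a)) (f a) (g a))))
  (trans (Σ≤-+ k _ _) (sym (trans (⊕-at _ _ k) (cong₂ _+_ (⊛-at f h k) (⊛-at g h k))))))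

⊛-scale : ∀ c f g k → (scl c f ⊛ g) k ≡ c * (f ⊛ g) k
⊛-scale c f g k = trans (⊛-at _ g k) (trans (Σ≤-cong k (λ a _ → *-assoc c (f a) _))
  (trans (Σ≤-*ˡ k c _) (cong (c *_) (sym (⊛-at f g k)))))

-- Induction on the coefficient for all `f` at once: the tail of `f ⊛ g` is `f 0` times the tail of
-- `g` plus the tail of `f` times `g`, so coefficient k + 1 falls back on coefficient k for
-- `f ∘ suc`.
⊛-assoc : ∀ f g h → (f ⊛ g) ⊛ h ≋ f ⊛ (g ⊛ h)
⊛-assoc f g h .at = go f g h
  where
  go : ∀ f g h k → ((f ⊛ g) ⊛ h) k ≡ (f ⊛ (g ⊛ h)) k
  go f g h zero = trans (⊛-0 _ h) (trans (cong (_* h 0) (⊛-0 f g)) (trans (*-assoc (f 0) (g 0) (h 0))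
    (sym (trans (⊛-0 f _) (cong (f 0 *_) (⊛-0 g h))))))
  go f g h (suc k) = begin
    ((f ⊛ g) ⊛ h) (suc k)
      ≡⟨ ⊛-sucˡ (f ⊛ g) h k ⟩
    (f ⊛ g) 0 * h (suc k) + ((f ⊛ g) ∘ suc ⊛ h) k
      ≡⟨ cong₂ _+_ (cong (_* h (suc k)) (⊛-0 f g))
           (trans (at (⊛-cong (mk≋ λ j → trans (⊛-sucˡ f g j) (sym (⊕-at _ _ j))) (mk≋ λ _ → refl)) k)
           (trans (at (⊛-distribʳ h (scl (f 0) (g ∘ suc)) (f ∘ suc ⊛ g)) k)
           (trans (⊕-at _ _ k) (cong₂ _+_ (⊛-scale (f 0) (g ∘ suc) h k) (go (f ∘ suc) g h k))))) ⟩
    f 0 * g 0 * h (suc k) + (f 0 * (g ∘ suc ⊛ h) k + (f ∘ suc ⊛ (g ⊛ h)) k)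
      ≡⟨ solve 5 (λ a b c d e → a :* b :* c :+ (a :* d :+ e) := a :* (b :* c :+ d) :+ e) refl (f 0) (g 0) (h (suc k)) _ _ ⟩
    f 0 * (g 0 * h (suc k) + (g ∘ suc ⊛ h) k) + (f ∘ suc ⊛ (g ⊛ h)) k
      ≡⟨ cong (λ x → f 0 * x + (f ∘ suc ⊛ (g ⊛ h)) k) (sym (⊛-sucˡ g h k)) ⟩
    f 0 * (g ⊛ h) (suc k) + (f ∘ suc ⊛ (g ⊛ h)) k
      ≡⟨ sym (⊛-sucˡ f (g ⊛ h) k) ⟩
    (f ⊛ (g ⊛ h)) (suc k) ∎
    where open ≡-Reasoning

⊛-zeroˡ : ∀ f → 0₁ ⊛ f ≋ 0₁
⊛-zeroˡ f .at k = trans (⊛-at 0₁ f k) (trans (Σ≤-cong k (λ a _ → zeroˡ (f (k ∸ a)))) (Σ≤-0 k))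

⊛-identityˡ : ∀ f → one₁ ⊛ f ≋ f
⊛-identityˡ f .at zero    = trans (⊛-0 one₁ f) (*-identityˡ (f 0))
⊛-identityˡ f .at (suc k) = trans (⊛-sucˡ one₁ f k)
  (trans (cong₂ _+_ (*-identityˡ (f (suc k))) (at (⊛-zeroˡ f) k)) (+-identityʳ (f (suc k))))

PS-semiring : CommutativeSemiring 0ℓ 0ℓ
PS-semiring = record
  { Carrier = PS₁ ; _≈_ = _≋_ ; _+_ = _⊕_ ; _*_ = _⊛_ ; 0# = 0₁ ; 1# = one₁
  ; isCommutativeSemiring = isCommutativeSemiringˡ (record
      { +-isCommutativeMonoid = isCommutativeMonoidˡ (record
          { isSemigroup = record
              { isMagma = record { isEquivalence = ≋-isEquivalence ; ∙-cong = ⊕-cong }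
              ; assoc = λ f g h → mk≋ λ k → trans (⊕-at _ h k) (trans (cong (_+ h k) (⊕-at f g k))
                  (trans (+-assoc (f k) (g k) (h k)) (sym (trans (⊕-at f _ k) (cong (f k +_) (⊕-at g h k)))))) }
          ; identityˡ = λ f → mk≋ λ k → trans (⊕-at 0₁ f k) (+-identityˡ (f k))
          ; comm = λ f g → mk≋ λ k → trans (⊕-at f g k) (trans (+-comm (f k) (g k)) (sym (⊕-at g f k))) })
      ; *-isCommutativeMonoid = isCommutativeMonoidˡ (record
          { isSemigroup = record
              { isMagma = record { isEquivalence = ≋-isEquivalence ; ∙-cong = ⊛-cong }
              ; assoc = ⊛-assoc }
          ; identityˡ = ⊛-identityˡ
          ; comm = ⊛-comm })
      ; distribʳ = ⊛-distribʳ
      ; zeroˡ = ⊛-zeroˡ }) }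
  where open import Algebra.Structures.Biased _≋_

module PS where
  open CommutativeSemiring PS-semiring public using (refl; sym; trans; setoid; reflexive)
  open import Algebra.Solver.Ring.NaturalCoefficients.Default PS-semiring public using (solve)
open import Algebra.Solver.Ring.NaturalCoefficients.Default PS-semiring
  using () renaming (_:+_ to infixl 6 _⊞_; _:*_ to infixl 7 _⊠_; _:=_ to infix 4 _≐_; con to κ)

module ≋-Reasoning = SetoidReasoning PS.setoid

infixr 8 _^_
_^_ : PS₁ → ℕ → PS₁
f ^ zero  = one₁
f ^ suc m = f ⊛ f ^ m

^-cong : ∀ {f f'} m → f ≋ f' → f ^ m ≋ f' ^ m
^-cong zero    p = PS.refl
^-cong (suc m) p = ⊛-cong p (^-cong m p)

^-+ : ∀ f m n → f ^ (m ℕ.+ n) ≋ f ^ m ⊛ f ^ n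
^-+ f zero    n = PS.sym (⊛-identityˡ (f ^ n))
^-+ f (suc m) n = PS.trans (⊛-cong PS.refl (^-+ f m n)) (PS.sym (⊛-assoc f (f ^ m) (f ^ n)))

^-⊛ : ∀ f g m → (f ⊛ g) ^ m ≋ f ^ m ⊛ g ^ m
^-⊛ f g zero    = PS.sym (⊛-identityˡ one₁)
^-⊛ f g (suc m) = PS.trans (⊛-cong PS.refl (^-⊛ f g m))
  (PS.solve 4 (λ a b c d → (a ⊠ b) ⊠ (c ⊠ d) ≐ (a ⊠ c) ⊠ (b ⊠ d)) PS.refl f g (f ^ m) (g ^ m))

one-^ : ∀ m → one₁ ^ m ≋ one₁
one-^ zero    = PS.refl
one-^ (suc m) = PS.trans (⊛-identityˡ _) (one-^ m)

*₁-cong : ∀ {f f' g g'} → f ≋ f' → g ≋ g' → f *₁ g ≋ f' ⊛ g'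
*₁-cong p q = PS.trans (mk≋ (*₁-def _ _)) (⊛-cong p q)

pow₁-def : ∀ {f f'} m → f ≋ f' → pow₁ f m ≋ f' ^ m
pow₁-def zero    p = PS.refl
pow₁-def (suc m) p = *₁-cong p (pow₁-def m p)

X⊛-0 : ∀ f → (X₁ ⊛ f) 0 ≡ 0ℚ
X⊛-0 f = trans (⊛-0 X₁ f) (zeroˡ (f 0))

X⊛-suc : ∀ f k → (X₁ ⊛ f) (suc k) ≡ f k
X⊛-suc f k = trans (⊛-sucˡ X₁ f k) (trans (cong₂ _+_ (zeroˡ (f (suc k)))
  (trans (at (⊛-cong {f' = one₁} (mk≋ λ { zero → refl ; (suc _) → refl }) PS.refl) k) (at (⊛-identityˡ f) k)))
  (+-identityˡ (f k)))

-- Identities for (1+x)/(1-x) and 4x/(1+x)², and the coefficients of powers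

module SeriesIdentities where
  private
    X e g v : PS₁
    X = X₁
    e = onePlusX
    g = invOneMinusX
    v = invOnePlusX

  -- The series (1 + x)/(1 - x) and 4x/(1 + x)².
  r q : PS₁
  r = onePlusX ⊛ invOneMinusX
  q = (one₁ ⊕ one₁) ⊛ (one₁ ⊕ one₁) ⊛ (X₁ ⊛ (invOnePlusX ⊛ invOnePlusX))

  -- In `q` the constant 4 is a product of sums of `one₁`, which the semiring solver can expand; a
  -- rational scalar would be opaque to it.
  fourYOver≋q : fourYOver ≋ q
  fourYOver≋q .at k = trans (*-def _ _) (trans (cong₂ _*_ (trans (nat-def 4) (nat-* 2 2)) (at (*₁-cong PS.refl (mk≋ (*₁-def v v))) k))
    (sym (trans (at (⊛-assoc _ _ _) k) (trans (at (⊛-cong 1+1 PS.refl) k) (trans (⊛-scale _ one₁ _ k)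
    (trans (cong (nat 2 *_) (trans (at (⊛-identityˡ _) k) (trans (at (⊛-cong 1+1 PS.refl) k) (trans (⊛-scale _ one₁ _ k) (cong (nat 2 *_) (at (⊛-identityˡ _) k))))))
      (sym (*-assoc _ _ _))))))))
    where
    1+1 : one₁ ⊕ one₁ ≋ scl (nat 2) one₁
    1+1 .at zero    = trans (⊕-at one₁ one₁ 0) (trans (cong₂ _+_ (sym nat-1) (sym nat-1)) (trans (sym (nat-+ 1 1)) (sym (*-identityʳ (nat 2)))))
    1+1 .at (suc k) = trans (⊕-at one₁ one₁ (suc k)) (trans (+-identityˡ 0ℚ) (sym (zeroʳ (nat 2))))

  g-unfold : invOneMinusX ≋ one₁ ⊕ X₁ ⊛ invOneMinusX
  g-unfold .at zero    = sym (trans (⊕-at one₁ _ 0) (trans (cong (1ℚ +_) (X⊛-0 g)) (+-identityʳ 1ℚ)))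
  g-unfold .at (suc k) = sym (trans (⊕-at one₁ _ (suc k)) (trans (cong (0ℚ +_) (X⊛-suc g k)) (+-identityˡ 1ℚ)))

  e-unfold : onePlusX ≋ one₁ ⊕ X₁
  e-unfold .at k = trans (+-def (one₁ k) (X₁ k)) (sym (⊕-at one₁ X₁ k))

  v-suc : ∀ k → v (suc k) + v k ≡ 0ℚ
  v-suc zero          = sym (+-def (ℚ.- 1ℚ) 1ℚ)
  v-suc (suc zero)    = sym (+-def 1ℚ (ℚ.- 1ℚ))
  v-suc (suc (suc k)) = v-suc k

  e⊛v : onePlusX ⊛ invOnePlusX ≋ one₁
  e⊛v = PS.trans (⊛-cong e-unfold PS.refl) (PS.trans
    (PS.solve 2 (λ x v → (κ 1 ⊞ x) ⊠ v ≐ v ⊞ x ⊠ v) PS.refl X v) (mk≋ go))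
    where
    go : ∀ k → (v ⊕ X ⊛ v) k ≡ one₁ k
    go zero    = trans (⊕-at v _ 0) (trans (cong (1ℚ +_) (X⊛-0 v)) (+-identityʳ 1ℚ))
    go (suc k) = trans (⊕-at v _ (suc k)) (trans (cong (v (suc k) +_) (X⊛-suc v k)) (v-suc k))

  oneMinusX⊛g : oneMinusX ⊛ invOneMinusX ≋ one₁
  oneMinusX⊛g .at zero    = trans (⊛-0 oneMinusX g) (*-identityʳ 1ℚ)
  oneMinusX⊛g .at (suc k) = trans (⊛-sucˡ oneMinusX g k) (trans
    (cong₂ _+_ (*-identityʳ 1ℚ) (trans (at (⊛-cong tail PS.refl) k)
      (trans (⊛-scale (ℚ.- 1ℚ) one₁ g k) (trans (cong (_ *_) (at (⊛-identityˡ g) k)) (*-identityʳ _)))))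
    (sym (+-def 1ℚ (ℚ.- 1ℚ))))
    where
    tail : oneMinusX ∘ suc ≋ scl (ℚ.- 1ℚ) one₁
    tail .at zero    = sym (*-identityʳ (ℚ.- 1ℚ))
    tail .at (suc k) = sym (zeroʳ (ℚ.- 1ℚ))

  r-unfold : r ≋ one₁ ⊕ X₁ ⊛ (invOneMinusX ⊕ invOneMinusX)
  r-unfold = begin
    e ⊛ g                       ≈⟨ ⊛-cong e-unfold PS.refl ⟩
    (one₁ ⊕ X) ⊛ g              ≈⟨ PS.solve 2 (λ x g → (κ 1 ⊞ x) ⊠ g ≐ g ⊞ x ⊠ g) PS.refl X g ⟩
    g ⊕ X ⊛ g                   ≈⟨ ⊕-cong g-unfold PS.refl ⟩
    (one₁ ⊕ X ⊛ g) ⊕ X ⊛ g      ≈⟨ PS.solve 2 (λ x g → (κ 1 ⊞ x ⊠ g) ⊞ x ⊠ g ≐ κ 1 ⊞ x ⊠ (g ⊞ g)) PS.refl X g ⟩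
    one₁ ⊕ X ⊛ (g ⊕ g)          ∎
    where open ≋-Reasoning

  v⊛r : invOnePlusX ⊛ r ≋ invOneMinusX
  v⊛r = begin
    v ⊛ (e ⊛ g)  ≈⟨ PS.solve 3 (λ v e g → v ⊠ (e ⊠ g) ≐ (e ⊠ v) ⊠ g) PS.refl v e g ⟩
    (e ⊛ v) ⊛ g  ≈⟨ ⊛-cong e⊛v PS.refl ⟩
    one₁ ⊛ g     ≈⟨ ⊛-identityˡ g ⟩
    g            ∎
    where open ≋-Reasoning

  -- The numerator (1+x)² of r² cancels the denominator of `q`, leaving 4x/(1-x)².
  r⊛r⊛q : r ⊛ r ⊛ q ≋ (one₁ ⊕ one₁) ⊛ (one₁ ⊕ one₁) ⊛ (X₁ ⊛ (invOneMinusX ⊛ invOneMinusX))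
  r⊛r⊛q = PS.trans
    (PS.solve 4 (λ t x v r → r ⊠ r ⊠ (t ⊠ t ⊠ (x ⊠ (v ⊠ v))) ≐ t ⊠ t ⊠ (x ⊠ ((v ⊠ r) ⊠ (v ⊠ r))))
      PS.refl (one₁ ⊕ one₁) X v r)
    (⊛-cong PS.refl (⊛-cong PS.refl (⊛-cong v⊛r v⊛r)))

  -- Both sides are 4x/((1-x)(1+x)). This identity is the source of the factor `q` that a peak
  -- contributes.
  g⊕v : (invOneMinusX ⊕ invOnePlusX) ⊛ (one₁ ⊕ one₁) ⊛ X₁ ≋ r ⊛ q
  g⊕v = begin
    (g ⊕ v) ⊛ (one₁ ⊕ one₁) ⊛ X
      ≈⟨ ⊛-cong (⊛-cong (⊕-cong (PS.sym v⊛r) PS.refl) PS.refl) PS.refl ⟩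
    (v ⊛ r ⊕ v) ⊛ (one₁ ⊕ one₁) ⊛ X
      ≈⟨ ⊛-cong (⊛-cong (⊕-cong (⊛-cong PS.refl (⊛-cong e-unfold PS.refl)) PS.refl) PS.refl) PS.refl ⟩
    (v ⊛ ((one₁ ⊕ X) ⊛ g) ⊕ v) ⊛ (one₁ ⊕ one₁) ⊛ X
      ≈⟨ PS.solve 4 (λ v x g t → (v ⊠ ((κ 1 ⊞ x) ⊠ g) ⊞ v) ⊠ t ⊠ x
           ≐ (v ⊠ g ⊞ v ⊠ (κ 1 ⊞ x ⊠ g)) ⊠ t ⊠ x) PS.refl v X g (one₁ ⊕ one₁) ⟩
    (v ⊛ g ⊕ v ⊛ (one₁ ⊕ X ⊛ g)) ⊛ (one₁ ⊕ one₁) ⊛ X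
      ≈⟨ ⊛-cong (⊛-cong (⊕-cong PS.refl (⊛-cong PS.refl (PS.sym g-unfold))) PS.refl) PS.refl ⟩
    (v ⊛ g ⊕ v ⊛ g) ⊛ (one₁ ⊕ one₁) ⊛ X
      ≈⟨ ⊛-cong (⊛-cong (⊕-cong vg vg) PS.refl) PS.refl ⟩
    (v ⊛ (v ⊛ r) ⊕ v ⊛ (v ⊛ r)) ⊛ (one₁ ⊕ one₁) ⊛ X
      ≈⟨ PS.solve 3 (λ v r x → (v ⊠ (v ⊠ r) ⊞ v ⊠ (v ⊠ r)) ⊠ (κ 1 ⊞ κ 1) ⊠ x
           ≐ r ⊠ ((κ 1 ⊞ κ 1) ⊠ (κ 1 ⊞ κ 1) ⊠ (x ⊠ (v ⊠ v)))) PS.refl v r X ⟩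
    r ⊛ q ∎
    where
    open ≋-Reasoning
    vg : v ⊛ g ≋ v ⊛ (v ⊛ r)
    vg = ⊛-cong PS.refl (PS.sym v⊛r)

  g⊛-0 : ∀ f → (invOneMinusX ⊛ f) 0 ≡ f 0
  g⊛-0 f = trans (⊛-0 g f) (*-identityˡ (f 0))

  g⊛-suc : ∀ f k → (invOneMinusX ⊛ f) (suc k) ≡ f (suc k) + (invOneMinusX ⊛ f) k
  g⊛-suc f k = trans (⊛-sucˡ g f k) (cong (_+ (g ⊛ f) k) (*-identityˡ (f (suc k))))

  -- The relation (1-x)h = xf, solved for h. Enlarging an alphabet by one letter or one pair changes
  -- a count by such an increment.
  prefixSums : ∀ f h → h 0 ≡ 0ℚ → (∀ j → h (suc j) ≡ h j + f j) → h ≋ X₁ ⊛ (invOneMinusX ⊛ f)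
  prefixSums f h h0 hs .at zero = trans h0 (sym (X⊛-0 _))
  prefixSums f h h0 hs .at (suc k) = trans (go k) (sym (X⊛-suc _ k))
    where
    go : ∀ k → h (suc k) ≡ (g ⊛ f) k
    go zero    = trans (hs 0) (trans (cong (_+ f 0) h0) (trans (+-identityˡ (f 0)) (sym (g⊛-0 f))))
    go (suc k) = trans (hs (suc k)) (trans (+-comm _ _) (trans (cong (f (suc k) +_) (go k)) (sym (g⊛-suc f k))))

  e⊛-suc : ∀ f k → (onePlusX ⊛ f) (suc k) ≡ f (suc k) + f k
  e⊛-suc f k = trans (at (⊛-cong e-unfold PS.refl) (suc k))
    (trans (at (PS.solve 2 (λ x f → (κ 1 ⊞ x) ⊠ f ≐ f ⊞ x ⊠ f) PS.refl X f) (suc k))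
    (trans (⊕-at f _ (suc k)) (cong (f (suc k) +_) (X⊛-suc f k))))

  nC0≡1 : ∀ n → n C 0 ≡ 1
  nC0≡1 n = trans (nCk≡nC[n∸k] {0} {n} z≤n) (nCn≡1 n)

  onePlusX^ : ∀ m k → (onePlusX ^ m) k ≡ nat (m C k)
  onePlusX^ zero    zero    = sym nat-1
  onePlusX^ zero    (suc k) = sym nat-0
  onePlusX^ (suc m) zero    = trans (⊛-0 e _) (trans (*-identityˡ _) (trans (onePlusX^ m 0) (cong nat (trans (nC0≡1 m) (sym (nC0≡1 (suc m)))))))
  onePlusX^ (suc m) (suc k) = trans (e⊛-suc _ k) (trans (cong₂ _+_ (onePlusX^ m (suc k)) (onePlusX^ m k))
    (trans (sym (nat-+ _ _)) (cong nat (trans (ℕ.+-comm (m C suc k) _) (nCk+nC[k+1]≡[n+1]C[k+1] m k)))))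

  -- Truncated subtraction does no harm: for k = 0 every top gives 1, and for m = 0 and k > 0 the
  -- top k - 1 lies below k, which gives 0.
  invOneMinusX^ : ∀ m k → (invOneMinusX ^ m) k ≡ nat ((m ℕ.+ k ∸ 1) C k)
  invOneMinusX^ zero    zero    = sym nat-1
  invOneMinusX^ zero    (suc k) = trans (sym nat-0) (cong nat (sym (k>n⇒nCk≡0 (ℕ.n<1+n k))))
  invOneMinusX^ (suc m) zero    = trans (g⊛-0 _) (trans (invOneMinusX^ m 0)
    (cong nat (trans (nC0≡1 (m ℕ.+ 0 ∸ 1)) (sym (nC0≡1 (m ℕ.+ 0))))))
  invOneMinusX^ (suc m) (suc k) = trans (g⊛-suc _ k) (trans (cong₂ _+_ (invOneMinusX^ m (suc k)) (invOneMinusX^ (suc m) k))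
    (trans (sym (nat-+ _ _)) (cong nat pascal)))
    where
    pascal : (m ℕ.+ suc k ∸ 1) C suc k ℕ.+ (m ℕ.+ k) C k ≡ (m ℕ.+ suc k) C suc k
    pascal rewrite ℕ.+-suc m k = trans (ℕ.+-comm ((m ℕ.+ k) C suc k) _) (nCk+nC[k+1]≡[n+1]C[k+1] (m ℕ.+ k) k)

  r^-coefficients : ∀ m n → (r ^ m) n ≡ Σ≤ n (λ k → nat ((m C k) ℕ.* ((m ℕ.+ (n ∸ k) ∸ 1) C (n ∸ k))))
  r^-coefficients m n = trans (at (^-⊛ e g m) n) (trans (⊛-at _ _ n)
    (Σ≤-cong n (λ k _ → trans (cong₂ _*_ (onePlusX^ m k) (invOneMinusX^ m (n ∸ k))) (sym (nat-* _ _)))))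

  -- The Euler operator x d/dx.
  θ : PS₁ → PS₁
  θ f k = nat k * f k

  θ-⊛ : ∀ f h → θ (f ⊛ h) ≋ θ f ⊛ h ⊕ f ⊛ θ h
  θ-⊛ f h .at k = begin
    nat k * (f ⊛ h) k
      ≡⟨ cong (nat k *_) (⊛-at f h k) ⟩
    nat k * Σ≤ k (λ a → f a * h (k ∸ a))
      ≡⟨ Σ≤-*ˡ k (nat k) _ ⟨
    Σ≤ k (λ a → nat k * (f a * h (k ∸ a)))
      ≡⟨ Σ≤-cong k (λ a a≤k → trans (cong (λ x → x * (f a * h (k ∸ a))) (trans (cong nat (sym (ℕ.m+[n∸m]≡n a≤k))) (nat-+ a (k ∸ a))))
           (solve 4 (λ x y f h → (x :+ y) :* (f :* h) := (x :* f) :* h :+ f :* (y :* h)) refl (nat a) (nat (k ∸ a)) (f a) (h (k ∸ a)))) ⟩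
    Σ≤ k (λ a → θ f a * h (k ∸ a) + f a * θ h (k ∸ a))
      ≡⟨ Σ≤-+ k _ _ ⟩
    Σ≤ k (λ a → θ f a * h (k ∸ a)) + Σ≤ k (λ a → f a * θ h (k ∸ a))
      ≡⟨ cong₂ _+_ (⊛-at (θ f) h k) (⊛-at f (θ h) k) ⟨
    (θ f ⊛ h) k + (f ⊛ θ h) k
      ≡⟨ ⊕-at _ _ k ⟨
    (θ f ⊛ h ⊕ f ⊛ θ h) k ∎
    where open ≡-Reasoning

  const : ℚ → PS₁
  const c = scl c one₁

  const-⊛ : ∀ c f → const c ⊛ f ≋ scl c f
  const-⊛ c f .at k = trans (⊛-scale c one₁ f k) (cong (c *_) (at (⊛-identityˡ f) k))

  const-+ : ∀ a b → const (a + b) ≋ const a ⊕ const b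
  const-+ a b .at k = trans (*-distribʳ-+ (one₁ k) a b) (sym (⊕-at _ _ k))

  r-suc : ∀ k → r (suc k) ≡ nat 2
  r-suc k = trans (at r-unfold (suc k)) (trans (⊕-at _ _ (suc k)) (trans (+-identityˡ _)
    (trans (X⊛-suc _ k) (trans (⊕-at g g k) (trans (cong₂ _+_ (sym nat-1) (sym nat-1)) (sym (nat-+ 1 1)))))))

  r-0 : r 0 ≡ 1ℚ
  r-0 = trans (⊛-0 e g) (*-identityʳ 1ℚ)

  -- (1 - x²) θ(r^m) = 2m x r^m, without the subtraction.
  θ-r^ : ∀ m → θ (r ^ m) ≋ X₁ ⊛ (X₁ ⊛ θ (r ^ m)) ⊕ const (nat (2 ℕ.* m)) ⊛ (X₁ ⊛ r ^ m)
  θ-r^ zero = PS.trans (mk≋ θ1) (PS.sym (PS.trans (⊕-cong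
      (⊛-cong PS.refl (⊛-cong PS.refl (mk≋ θ1))) (⊛-cong {f' = 0₁} (mk≋ λ k → trans (cong (_* one₁ k) nat-0) (zeroˡ (one₁ k))) PS.refl))
      (PS.solve 2 (λ x y → x ⊠ (x ⊠ κ 0) ⊞ κ 0 ⊠ y ≐ κ 0) PS.refl X (X ⊛ one₁))))
    where
    θ1 : ∀ k → θ one₁ k ≡ 0ℚ
    θ1 zero    = trans (cong (_* 1ℚ) nat-0) (zeroˡ 1ℚ)
    θ1 (suc k) = zeroʳ (nat (suc k))
  θ-r^ (suc m) = begin
    θ (r ⊛ R)
      ≈⟨ θ-⊛ r R ⟩
    θ r ⊛ R ⊕ r ⊛ θ R
      ≈⟨ ⊕-cong (⊛-cong θ-r PS.refl) (⊛-cong PS.refl (θ-r^ m)) ⟩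
    (X ⊛ (X ⊛ θ r) ⊕ c₂ ⊛ (X ⊛ r)) ⊛ R ⊕ r ⊛ (X ⊛ (X ⊛ θ R) ⊕ c ⊛ (X ⊛ R))
      ≈⟨ PS.solve 7 (λ x tr k₂ r R tR k →
           (x ⊠ (x ⊠ tr) ⊞ k₂ ⊠ (x ⊠ r)) ⊠ R ⊞ r ⊠ (x ⊠ (x ⊠ tR) ⊞ k ⊠ (x ⊠ R))
           ≐ x ⊠ (x ⊠ (tr ⊠ R ⊞ r ⊠ tR)) ⊞ (k₂ ⊞ k) ⊠ (x ⊠ (r ⊠ R)))
           PS.refl X (θ r) c₂ r R (θ R) c ⟩
    X ⊛ (X ⊛ (θ r ⊛ R ⊕ r ⊛ θ R)) ⊕ (c₂ ⊕ c) ⊛ (X ⊛ (r ⊛ R))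
      ≈⟨ ⊕-cong (⊛-cong PS.refl (⊛-cong PS.refl (PS.sym (θ-⊛ r R)))) (⊛-cong 2+2m PS.refl) ⟩
    X ⊛ (X ⊛ θ (r ⊛ R)) ⊕ const (nat (2 ℕ.* suc m)) ⊛ (X ⊛ (r ⊛ R)) ∎
    where
    open ≋-Reasoning
    R c c₂ : PS₁
    R  = r ^ m
    c  = const (nat (2 ℕ.* m))
    c₂ = const (nat 2)
    2+2m : c₂ ⊕ c ≋ const (nat (2 ℕ.* suc m))
    2+2m = PS.trans (PS.sym (const-+ _ _)) (PS.reflexive (cong const
      (trans (sym (nat-+ 2 (2 ℕ.* m))) (cong nat (sym (ℕ.*-suc 2 m))))))
    RHS : PS₁
    RHS = X ⊛ (X ⊛ θ r) ⊕ c₂ ⊛ (X ⊛ r)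
    RHS-suc : ∀ k → RHS (suc k) ≡ (X ⊛ θ r) k + nat 2 * r k
    RHS-suc k = trans (⊕-at _ _ (suc k)) (cong₂ _+_ (X⊛-suc _ k)
      (trans (at (const-⊛ (nat 2) _) (suc k)) (cong (nat 2 *_) (X⊛-suc r k))))
    θr : ∀ k → θ r k ≡ nat k * nat 2
    θr zero    = trans (cong (_* r 0) nat-0) (trans (zeroˡ _) (sym (trans (cong (_* nat 2) nat-0) (zeroˡ _))))
    θr (suc k) = cong (nat (suc k) *_) (r-suc k)
    -- The case of `r` itself is checked on coefficients: those of `r` are 1, 2, 2, ..., and 2(k+2)
    -- = 2k + 2·2. The product rule then adds the constants 2 and 2m.
    θ-r : θ r ≋ RHS
    θ-r .at zero = trans (θr 0) (trans (cong (_* nat 2) nat-0) (trans (zeroˡ _) (sym (trans (⊕-at _ _ 0) (trans (cong₂ _+_ (X⊛-0 _)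
      (trans (at (const-⊛ (nat 2) _) 0) (trans (cong (nat 2 *_) (X⊛-0 r)) (zeroʳ _)))) (+-identityˡ 0ℚ))))))
    θ-r .at (suc zero) = trans (trans (cong (_* r 1) nat-1) (*-identityˡ _)) (trans (r-suc 0) (sym (trans (RHS-suc 0)
      (trans (cong₂ _+_ (X⊛-0 _) (trans (cong (nat 2 *_) r-0) (*-identityʳ _))) (+-identityˡ _)))))
    θ-r .at (suc (suc k)) = trans (cong₂ _*_ (nat-+ 2 k) (r-suc (suc k)))
      (sym (trans (RHS-suc (suc k)) (trans (cong₂ _+_ (trans (X⊛-suc _ k) (θr k)) (cong (nat 2 *_) (r-suc k)))
        (solve 2 (λ k t → k :* t :+ t :* t := (t :+ k) :* t) refl (nat k) (nat 2)))))

  -- Coefficient n + 2 of `θ-r^`. Multiplied by (n+1)!, it becomes the recurrence satisfied by the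
  -- permutations with odd cycles only.
  r^-recurrence : ∀ m n → nat (2 ℕ.+ n) * (r ^ m) (2 ℕ.+ n) ≡ nat n * (r ^ m) n + nat (2 ℕ.* m) * (r ^ m) (1 ℕ.+ n)
  r^-recurrence m n = trans (at (θ-r^ m) (2 ℕ.+ n)) (trans (⊕-at _ _ (2 ℕ.+ n)) (cong₂ _+_
    (trans (X⊛-suc _ (suc n)) (X⊛-suc _ n))
    (trans (at (const-⊛ _ _) (2 ℕ.+ n)) (cong (_ *_) (X⊛-suc _ (suc n))))))

  r^-0 : ∀ m → (r ^ m) 0 ≡ 1ℚ
  r^-0 zero    = refl
  r^-0 (suc m) = trans (⊛-0 r _) (trans (cong₂ _*_ r-0 (r^-0 m)) (*-identityˡ 1ℚ))

  r^-1 : ∀ m → (r ^ m) 1 ≡ nat (2 ℕ.* m)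
  r^-1 m = trans (sym (trans (cong (_* (r ^ m) 1) nat-1) (*-identityˡ _))) (trans (at (θ-r^ m) 1) (trans (⊕-at _ _ 1)
    (trans (cong₂ _+_ (trans (X⊛-suc _ 0) (X⊛-0 _)) (trans (at (const-⊛ _ _) 1)
      (trans (cong (nat (2 ℕ.* m) *_) (trans (X⊛-suc _ 0) (r^-0 m))) (*-identityʳ _)))) (+-identityˡ _))))

open SeriesIdentities

-- Counting maps from a word to a signed alphabet

ι : Bool → ℚ
ι true  = 1ℚ
ι false = 0ℚ

ι-∧ : ∀ a b → ι (a ∧ b) ≡ ι a * ι b
ι-∧ true  b = sym (*-identityˡ (ι b))
ι-∧ false b = sym (zeroˡ (ι b))

-- The relation required between neighbours that receive the same letter of sign c.
ok : Bool → ℕ → ℕ → Bool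
ok true  x y = x <ᵇ y
ok false x y = y <ᵇ x

mono : Bool → List ℕ → Bool
mono c []          = true
mono c (x ∷ [])    = true
mono c (x ∷ y ∷ w) = ok c x y ∧ mono c (y ∷ w)

-- The sum over all cuts w = u ++ v, empty pieces included. The prefix accumulates in the summand,
-- so inductions over `w` quantify over `h`.
Σsplit : (List ℕ → List ℕ → ℚ) → List ℕ → ℚ
Σsplit h []      = h [] []
Σsplit h (x ∷ w) = h [] (x ∷ w) + Σsplit (λ u → h (x ∷ u)) w

Σsplit-cong : ∀ {h h'} w → (∀ u v → h u v ≡ h' u v) → Σsplit h w ≡ Σsplit h' w
Σsplit-cong []      eq = eq [] []
Σsplit-cong (x ∷ w) eq = cong₂ _+_ (eq [] (x ∷ w)) (Σsplit-cong w (λ u → eq (x ∷ u)))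

Σsplit-*ˡ : ∀ c h w → Σsplit (λ u v → c * h u v) w ≡ c * Σsplit h w
Σsplit-*ˡ c h []      = refl
Σsplit-*ˡ c h (x ∷ w) = trans (cong₂ _+_ refl (Σsplit-*ˡ c (λ u → h (x ∷ u)) w)) (sym (*-distribˡ-+ c _ _))

-- Positive letters are encoded by true, negative ones by false.
F : List Bool → List ℕ → ℚ
F []      []      = 1ℚ
F []      (_ ∷ _) = 0ℚ
F (c ∷ X) w       = Σsplit (λ u v → ι (mono c u) * F X v) w

-- The contribution to F (c ∷ X) (x ∷ w) of the maps that send x to the letter c.
F₁ : Bool → List Bool → ℕ → List ℕ → ℚ
F₁ c X x w = Σsplit (λ u v → ι (mono c (x ∷ u)) * F X v) w

F-[] : ∀ X → F X [] ≡ 1ℚ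
F-[] []      = refl
F-[] (c ∷ X) = trans (*-identityˡ _) (F-[] X)

-- Maps are weakly increasing, so the smallest letter `c` is taken on a prefix: either on nothing,
-- or at the first position.
F-∷ : ∀ c X x w → F (c ∷ X) (x ∷ w) ≡ F X (x ∷ w) + F₁ c X x w
F-∷ c X x w = cong (_+ F₁ c X x w) (*-identityˡ (F X (x ∷ w)))

F₁-[] : ∀ c X x → F₁ c X x [] ≡ 1ℚ
F₁-[] c X x = trans (*-identityˡ _) (F-[] X)

F₁-∷ : ∀ c X x y w → F₁ c X x (y ∷ w) ≡ F X (y ∷ w) + ι (ok c x y) * F₁ c X y w
F₁-∷ c X x y w = cong₂ _+_ (*-identityˡ _)
  (trans (Σsplit-cong w (λ u v → trans (cong (_* F X v) (ι-∧ (ok c x y) (mono c (y ∷ u)))) (*-assoc _ _ _)))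
         (Σsplit-*ˡ (ι (ok c x y)) _ w))

alt : ℕ → List Bool
alt zero    = []
alt (suc j) = false ∷ true ∷ alt j

alt-snoc : ∀ j → alt (suc j) ≡ (alt j ++ false ∷ []) ++ true ∷ []
alt-snoc zero    = refl
alt-snoc (suc j) = cong (λ X → false ∷ true ∷ X) (alt-snoc j)

startsDesc : List ℕ → Bool
startsDesc (x ∷ y ∷ w) = y <ᵇ x
startsDesc _           = false

bit : Bool → ℕ
bit b = if b then 1 else 0

-- Versions by recursion on the first letter, to match the transfer from a word to its tail.
pkʳ desʳ lpkʳ : List ℕ → ℕ
pkʳ (x ∷ w@(y ∷ z ∷ _)) = bit ((x <ᵇ y) ∧ (z <ᵇ y)) ℕ.+ pkʳ w
pkʳ _                   = 0
desʳ (x ∷ w@(y ∷ _)) = bit (y <ᵇ x) ℕ.+ desʳ w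
desʳ _               = 0
lpkʳ w = pkʳ w ℕ.+ bit (startsDesc w)

pkʳ-∷ : ∀ x y w → pkʳ (x ∷ y ∷ w) ≡ bit ((x <ᵇ y) ∧ startsDesc (y ∷ w)) ℕ.+ pkʳ (y ∷ w)
pkʳ-∷ x y (z ∷ w) = refl
pkʳ-∷ x y [] with x <ᵇ y
... | true  = refl
... | false = refl

<ᵇ-true : ∀ {x y} → x ℕ.< y → (x <ᵇ y) ≡ true
<ᵇ-true {zero}  {suc y} _         = refl
<ᵇ-true {suc x} {suc y} (s≤s x<y) = <ᵇ-true x<y

<ᵇ-false : ∀ {x y} → y ≤ x → (x <ᵇ y) ≡ false
<ᵇ-false {x}     {zero}  _         = refl
<ᵇ-false {suc x} {suc y} (s≤s y≤x) = <ᵇ-false y≤x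

<ᵇ-flip : ∀ {x y} → x ≢ y → (y <ᵇ x) ≡ not (x <ᵇ y)
<ᵇ-flip {x} {y} x≢y with ℕ.<-cmp x y
... | tri< x<y _ _ = trans (<ᵇ-false (ℕ.<⇒≤ x<y)) (cong not (sym (<ᵇ-true x<y)))
... | tri≈ _ x≡y _ = ⊥-elim (x≢y x≡y)
... | tri> _ _ y<x = trans (<ᵇ-true y<x) (cong not (sym (<ᵇ-false (ℕ.<⇒≤ y<x))))

-- Generating functions of one word in the size of an enriched alphabet

module EnrichedSeries where
  private
    X e g v 2# : PS₁
    X = X₁
    e = onePlusX
    g = invOneMinusX
    v = invOnePlusX
    2# = one₁ ⊕ one₁

  -- `H` counts the maps into (-+)^j. `P` and `M` count the maps into +(-+)^j and into -+(-+)^j that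
  -- send the first position to the first letter. `T` is the closed form aimed at: P + M = 2T.
  H P M T : List ℕ → PS₁
  H w j = F (alt j) w
  P []      = 0₁
  P (x ∷ w) j = F₁ true (alt j) x w
  M []      = 0₁
  M (x ∷ w) j = F₁ false (true ∷ alt j) x w
  T w = g ⊛ (r ^ (length w ∸ 1) ⊛ q ^ pkʳ w)

  -- A map into (-+)^(j+1) avoids the first pair or sends the first position to its + or its -.
  -- Summation over j gives x/(1-x).
  H-P-M : ∀ x w → H (x ∷ w) ≋ X ⊛ (g ⊛ (P (x ∷ w) ⊕ M (x ∷ w)))
  H-P-M x w = prefixSums _ _ refl (λ j → trans (F-∷ false (true ∷ alt j) x w)
    (trans (cong₂ _+_ (F-∷ true (alt j) x w) refl) (trans (+-assoc _ _ _) (cong₂ _+_ refl (sym (⊕-at _ _ j))))))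

  P-step : ∀ x y w j → P (x ∷ y ∷ w) j ≡ H (y ∷ w) j + ι (x <ᵇ y) * P (y ∷ w) j
  P-step x y w j = F₁-∷ true (alt j) x y w

  M-step : ∀ x y w j → M (x ∷ y ∷ w) j ≡ (H (y ∷ w) j + P (y ∷ w) j) + ι (y <ᵇ x) * M (y ∷ w) j
  M-step x y w j = trans (F₁-∷ false (true ∷ alt j) x y w) (cong₂ _+_ (F-∷ true (alt j) y w) refl)

  -- The ratio P/T, which is 2x/(1+x) or 1. The sum P + M alone does not determine the next step of
  -- the transfer, so this ratio is carried along in the induction.
  shape : Bool → PS₁
  shape true  = 2# ⊛ (X ⊛ v)
  shape false = one₁

  P-asc : ∀ x y w → (x <ᵇ y) ≡ true → P (x ∷ y ∷ w) ≋ H (y ∷ w) ⊕ P (y ∷ w)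
  P-asc x y w eq .at j = trans (P-step x y w j) (trans (cong (H (y ∷ w) j +_)
    (trans (cong (λ b → ι b * P (y ∷ w) j) eq) (*-identityˡ _))) (sym (⊕-at _ _ j)))

  M-asc : ∀ x y w → (y <ᵇ x) ≡ false → M (x ∷ y ∷ w) ≋ H (y ∷ w) ⊕ P (y ∷ w)
  M-asc x y w eq .at j = trans (M-step x y w j) (trans (cong₂ _+_ refl
    (trans (cong (λ b → ι b * M (y ∷ w) j) eq) (zeroˡ _))) (trans (+-identityʳ _) (sym (⊕-at _ _ j))))

  P-desc : ∀ x y w → (x <ᵇ y) ≡ false → P (x ∷ y ∷ w) ≋ H (y ∷ w)
  P-desc x y w eq .at j = trans (P-step x y w j) (trans (cong (H (y ∷ w) j +_)
    (trans (cong (λ b → ι b * P (y ∷ w) j) eq) (zeroˡ _))) (+-identityʳ _))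

  M-desc : ∀ x y w → (y <ᵇ x) ≡ true → M (x ∷ y ∷ w) ≋ H (y ∷ w) ⊕ (P (y ∷ w) ⊕ M (y ∷ w))
  M-desc x y w eq .at j = trans (M-step x y w j) (trans (cong₂ _+_ refl
    (trans (cong (λ b → ι b * M (y ∷ w) j) eq) (*-identityˡ _)))
    (trans (+-assoc _ _ _) (trans (cong₂ _+_ refl (sym (⊕-at _ _ j))) (sym (⊕-at _ _ j)))))

  -- Without an initial descent the sum is (2x/(1-x) + 1)T = rT. With one it is (2x/(1-x) +
  -- 2x/(1+x))T, which is rqT by `g⊕v`.
  H⊕P : ∀ x w → P (x ∷ w) ⊕ M (x ∷ w) ≋ 2# ⊛ T (x ∷ w) → P (x ∷ w) ≋ shape (startsDesc (x ∷ w)) ⊛ T (x ∷ w) →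
        H (x ∷ w) ⊕ P (x ∷ w) ≋ r ⊛ (q ^ bit (startsDesc (x ∷ w)) ⊛ T (x ∷ w))
  H⊕P x w pm p with startsDesc (x ∷ w)
  ... | false = begin
    H (x ∷ w) ⊕ P (x ∷ w)                   ≈⟨ ⊕-cong (PS.trans (H-P-M x w) (⊛-cong PS.refl (⊛-cong PS.refl pm))) p ⟩
    X ⊛ (g ⊛ (2# ⊛ t)) ⊕ one₁ ⊛ t           ≈⟨ PS.solve 3 (λ x g t → x ⊠ (g ⊠ ((κ 1 ⊞ κ 1) ⊠ t)) ⊞ κ 1 ⊠ t
                                                  ≐ (κ 1 ⊞ x ⊠ (g ⊞ g)) ⊠ t) PS.refl X g t ⟩
    (one₁ ⊕ X ⊛ (g ⊕ g)) ⊛ t                ≈⟨ ⊛-cong (PS.sym r-unfold) (PS.sym (⊛-identityˡ t)) ⟩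
    r ⊛ (one₁ ⊛ t)                          ∎
    where
    open ≋-Reasoning
    t = T (x ∷ w)
  ... | true = begin
    H (x ∷ w) ⊕ P (x ∷ w)                   ≈⟨ ⊕-cong (PS.trans (H-P-M x w) (⊛-cong PS.refl (⊛-cong PS.refl pm))) p ⟩
    X ⊛ (g ⊛ (2# ⊛ t)) ⊕ 2# ⊛ (X ⊛ v) ⊛ t   ≈⟨ PS.solve 5 (λ x g v t k → x ⊠ (g ⊠ (k ⊠ t)) ⊞ k ⊠ (x ⊠ v) ⊠ t
                                                  ≐ (g ⊞ v) ⊠ k ⊠ x ⊠ t) PS.refl X g v t 2# ⟩
    (g ⊕ v) ⊛ 2# ⊛ X ⊛ t                    ≈⟨ ⊛-cong g⊕v PS.refl ⟩
    r ⊛ q ⊛ t                               ≈⟨ PS.solve 3 (λ r q t → r ⊠ q ⊠ t ≐ r ⊠ ((q ⊠ κ 1) ⊠ t)) PS.refl r q t ⟩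
    r ⊛ (q ⊛ one₁ ⊛ t)                      ∎
    where
    open ≋-Reasoning
    t = T (x ∷ w)

  T-∷ : ∀ x y w b → ((x <ᵇ y) ∧ startsDesc (y ∷ w)) ≡ b → T (x ∷ y ∷ w) ≋ r ⊛ (q ^ bit b ⊛ T (y ∷ w))
  T-∷ x y w b eq = PS.trans (⊛-cong PS.refl (⊛-cong PS.refl (PS.trans
      (PS.reflexive (cong (q ^_) (trans (pkʳ-∷ x y w) (cong (λ b → bit b ℕ.+ pkʳ (y ∷ w)) eq))))
      (^-+ q (bit b) (pkʳ (y ∷ w))))))
    (PS.solve 5 (λ g r rl b t → g ⊠ (r ⊠ rl ⊠ (b ⊠ t)) ≐ r ⊠ (b ⊠ (g ⊠ (rl ⊠ t)))) PS.refl g r (r ^ length w) (q ^ bit b) (q ^ pkʳ (y ∷ w)))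

  Shaped : List ℕ → Set
  Shaped w = (P w ⊕ M w ≋ 2# ⊛ T w) × (P w ≋ shape (startsDesc w) ⊛ T w)

  -- For x < y, placing x on a + lets y share it, while placing x on a - forces y past it, to the
  -- following + or beyond. Both leave H + P for the tail, and a peak at y appears exactly when the
  -- tail starts with a descent.
  P⊕M-asc : ∀ x y w → Shaped (y ∷ w) → (x <ᵇ y) ≡ true → (y <ᵇ x) ≡ false → Shaped (x ∷ y ∷ w)
  P⊕M-asc x y w (pm , p) eq eq' =
    PS.trans (⊕-cong P≋ (PS.trans (M-asc x y w eq') H⊕P≋))
      (PS.solve 1 (λ t → t ⊞ t ≐ (κ 1 ⊞ κ 1) ⊠ t) PS.refl (T (x ∷ y ∷ w)))
    , PS.trans P≋ (PS.trans (PS.sym (⊛-identityˡ _)) (⊛-cong (PS.reflexive (cong shape (sym eq'))) PS.refl))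
    where
    H⊕P≋ : H (y ∷ w) ⊕ P (y ∷ w) ≋ T (x ∷ y ∷ w)
    H⊕P≋ = PS.trans (H⊕P y w pm p) (PS.sym (T-∷ x y w _ (cong (_∧ startsDesc (y ∷ w)) eq)))
    P≋ : P (x ∷ y ∷ w) ≋ T (x ∷ y ∷ w)
    P≋ = PS.trans (P-asc x y w eq) H⊕P≋

  -- For x > y, a + under x cannot be shared, so P becomes H; a - under x restricts nothing, so M
  -- becomes H + P + M. The sum is 2H + 2T = 2(1 + 2x/(1-x))T = 2rT, with no new peak.
  P⊕M-desc : ∀ x y w → Shaped (y ∷ w) → (x <ᵇ y) ≡ false → (y <ᵇ x) ≡ true → Shaped (x ∷ y ∷ w)
  P⊕M-desc x y w (pm , p) eq eq' =
    (begin
      P (x ∷ y ∷ w) ⊕ M (x ∷ y ∷ w)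
        ≈⟨ ⊕-cong (PS.trans (P-desc x y w eq) H≋) (PS.trans (M-desc x y w eq') (⊕-cong H≋ pm)) ⟩
      X ⊛ (g ⊛ (2# ⊛ t)) ⊕ (X ⊛ (g ⊛ (2# ⊛ t)) ⊕ 2# ⊛ t)
        ≈⟨ PS.solve 4 (λ x g k t → x ⊠ (g ⊠ (k ⊠ t)) ⊞ (x ⊠ (g ⊠ (k ⊠ t)) ⊞ k ⊠ t) ≐ k ⊠ ((κ 1 ⊞ x ⊠ (g ⊞ g)) ⊠ (κ 1 ⊠ t))) PS.refl X g 2# t ⟩
      2# ⊛ ((one₁ ⊕ X ⊛ (g ⊕ g)) ⊛ (one₁ ⊛ t))
        ≈⟨ ⊛-cong PS.refl (PS.trans (⊛-cong (PS.sym r-unfold) PS.refl) (PS.sym T≋)) ⟩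
      2# ⊛ T (x ∷ y ∷ w) ∎)
    , (begin
      P (x ∷ y ∷ w)                   ≈⟨ PS.trans (P-desc x y w eq) H≋ ⟩
      X ⊛ (g ⊛ (2# ⊛ t))              ≈⟨ ⊛-cong PS.refl (⊛-cong (PS.sym v⊛r) PS.refl) ⟩
      X ⊛ (v ⊛ r ⊛ (2# ⊛ t))          ≈⟨ PS.solve 5 (λ x v r k t → x ⊠ (v ⊠ r ⊠ (k ⊠ t)) ≐ k ⊠ (x ⊠ v) ⊠ (r ⊠ (κ 1 ⊠ t))) PS.refl X v r 2# t ⟩
      2# ⊛ (X ⊛ v) ⊛ (r ⊛ (one₁ ⊛ t)) ≈⟨ ⊛-cong (PS.reflexive (cong shape (sym eq'))) (PS.sym T≋) ⟩
      shape (y <ᵇ x) ⊛ T (x ∷ y ∷ w)  ∎)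
    where
    open ≋-Reasoning
    t = T (y ∷ w)
    H≋ : H (y ∷ w) ≋ X ⊛ (g ⊛ (2# ⊛ t))
    H≋ = PS.trans (H-P-M y w) (⊛-cong PS.refl (⊛-cong PS.refl pm))
    T≋ : T (x ∷ y ∷ w) ≋ r ⊛ (one₁ ⊛ t)
    T≋ = T-∷ x y w false (cong (_∧ startsDesc (y ∷ w)) eq)

  P⊕M-P : ∀ x w → Unique (x ∷ w) → Shaped (x ∷ w)
  P⊕M-P x [] _ =
    PS.trans (⊕-cong P1 M1) (PS.solve 1 (λ g → g ⊞ g ≐ (κ 1 ⊞ κ 1) ⊠ (g ⊠ (κ 1 ⊠ κ 1))) PS.refl g)
    , PS.trans P1 (PS.solve 1 (λ g → g ≐ κ 1 ⊠ (g ⊠ (κ 1 ⊠ κ 1))) PS.refl g)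
    where
    P1 : P (x ∷ []) ≋ g
    P1 .at j = F₁-[] true (alt j) x
    M1 : M (x ∷ []) ≋ g
    M1 .at j = F₁-[] false (true ∷ alt j) x
  P⊕M-P x (y ∷ w) ((x≢y ∷ _) ∷ u) = by-cases (x <ᵇ y) refl
    where
    by-cases : ∀ b → (x <ᵇ y) ≡ b → Shaped (x ∷ y ∷ w)
    by-cases true  eq = P⊕M-asc x y w (P⊕M-P y w u) eq (trans (<ᵇ-flip x≢y) (cong not eq))
    by-cases false eq = P⊕M-desc x y w (P⊕M-P y w u) eq (trans (<ᵇ-flip x≢y) (cong not eq))

  -- Of the powers of `r` and `q` on the left, r²q = 4x/(1-x)² is split off. The step from 2T to H
  -- absorbs x/(1-x) and one 2; the other 2 remains and is the factor 2 of (b).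
  enriched-series : ∀ x w → Unique (x ∷ w) → let n = length (x ∷ w) in
    onePlusX ^ suc n ⊛ (invOneMinusX ^ suc n ⊛ q ^ suc (pkʳ (x ∷ w))) ≋ (one₁ ⊕ one₁) ⊛ (λ j → F (alt j) (x ∷ w))
  enriched-series x w u = begin
    e ^ suc n ⊛ (g ^ suc n ⊛ (q ⊛ Q))
      ≈⟨ PS.sym (⊛-assoc _ _ _) ⟩
    e ^ suc n ⊛ g ^ suc n ⊛ (q ⊛ Q)
      ≈⟨ ⊛-cong (PS.sym (^-⊛ e g (suc n))) PS.refl ⟩
    r ⊛ (r ⊛ R) ⊛ (q ⊛ Q)
      ≈⟨ PS.solve 4 (λ r R q Q → r ⊠ (r ⊠ R) ⊠ (q ⊠ Q) ≐ r ⊠ r ⊠ q ⊠ (R ⊠ Q)) PS.refl r R q Q ⟩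
    r ⊛ r ⊛ q ⊛ (R ⊛ Q)
      ≈⟨ ⊛-cong r⊛r⊛q PS.refl ⟩
    2# ⊛ 2# ⊛ (X ⊛ (g ⊛ g)) ⊛ (R ⊛ Q)
      ≈⟨ PS.solve 5 (λ k x g R Q → k ⊠ k ⊠ (x ⊠ (g ⊠ g)) ⊠ (R ⊠ Q) ≐ k ⊠ (x ⊠ (g ⊠ (k ⊠ (g ⊠ (R ⊠ Q)))))) PS.refl 2# X g R Q ⟩
    2# ⊛ (X ⊛ (g ⊛ (2# ⊛ T (x ∷ w))))
      ≈⟨ ⊛-cong PS.refl (⊛-cong PS.refl (⊛-cong PS.refl (PS.sym (proj₁ (P⊕M-P x w u))))) ⟩
    2# ⊛ (X ⊛ (g ⊛ (P (x ∷ w) ⊕ M (x ∷ w))))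
      ≈⟨ ⊛-cong PS.refl (PS.sym (H-P-M x w)) ⟩
    2# ⊛ H (x ∷ w) ∎
    where
    open ≋-Reasoning
    n = length (x ∷ w)
    R = r ^ length w
    Q = q ^ pkʳ (x ∷ w)

  -- The alphabet +(-+)^i is the sum H + P, and the extra q in `H⊕P` for an initial descent is what
  -- separates left peaks from peaks.
  left-enriched-series : ∀ x w → Unique (x ∷ w) → let n = length (x ∷ w) in
    onePlusX ^ n ⊛ (invOneMinusX ^ suc n ⊛ q ^ lpkʳ (x ∷ w)) ≋ (λ i → F (true ∷ alt i) (x ∷ w))
  left-enriched-series x w u = begin
    e ^ n ⊛ (g ⊛ g ^ n ⊛ q ^ lpkʳ (x ∷ w))
      ≈⟨ ⊛-cong PS.refl (⊛-cong PS.refl (^-+ q (pkʳ (x ∷ w)) (bit (startsDesc (x ∷ w))))) ⟩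
    e ^ n ⊛ (g ⊛ g ^ n ⊛ (Q ⊛ B))
      ≈⟨ PS.solve 5 (λ E g G Q B → E ⊠ (g ⊠ G ⊠ (Q ⊠ B)) ≐ E ⊠ G ⊠ (g ⊠ (Q ⊠ B))) PS.refl (e ^ n) g (g ^ n) Q B ⟩
    e ^ n ⊛ g ^ n ⊛ (g ⊛ (Q ⊛ B))
      ≈⟨ ⊛-cong (PS.sym (^-⊛ e g n)) PS.refl ⟩
    r ⊛ R ⊛ (g ⊛ (Q ⊛ B))
      ≈⟨ PS.solve 5 (λ r R g Q B → r ⊠ R ⊠ (g ⊠ (Q ⊠ B)) ≐ r ⊠ (B ⊠ (g ⊠ (R ⊠ Q)))) PS.refl r R g Q B ⟩
    r ⊛ (B ⊛ T (x ∷ w))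
      ≈⟨ PS.sym (H⊕P x w (proj₁ pmp) (proj₂ pmp)) ⟩
    H (x ∷ w) ⊕ P (x ∷ w)
      ≈⟨ mk≋ (λ i → trans (⊕-at _ _ i) (sym (F-∷ true (alt i) x w))) ⟩
    (λ i → F (true ∷ alt i) (x ∷ w)) ∎
    where
    open ≋-Reasoning
    pmp = P⊕M-P x w u
    n = length (x ∷ w)
    R = r ^ length w
    Q = q ^ pkʳ (x ∷ w)
    B = q ^ bit (startsDesc (x ∷ w))

open EnrichedSeries using (enriched-series; left-enriched-series)

-- Generating functions of one word in the size of a positive alphabet

module DescentSeries where
  private
    X g : PS₁
    X = X₁
    g = invOneMinusX

  H A : List ℕ → PS₁
  H w j = F (replicate j true) w
  A []      = 0₁
  A (x ∷ w) j = F₁ true (replicate j true) x w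

  H-A : ∀ x w → H (x ∷ w) ≋ X ⊛ (g ⊛ A (x ∷ w))
  H-A x w = prefixSums _ _ refl (λ j → F-∷ true (replicate j true) x w)

  -- An ascent turns A into H + A = A/(1-x), a descent turns it into H = xA/(1-x).
  A≋ : ∀ x w → Unique (x ∷ w) → A (x ∷ w) ≋ X ^ desʳ (x ∷ w) ⊛ g ^ length (x ∷ w)
  A≋ x [] _ = PS.trans (mk≋ (λ j → F₁-[] true (replicate j true) x))
    (PS.solve 1 (λ g → g ≐ κ 1 ⊠ (g ⊠ κ 1)) PS.refl g)
  A≋ x (y ∷ w) ((x≢y ∷ _) ∷ u) = by-cases (x <ᵇ y) refl
    where
    A' = A (y ∷ w)
    step : ∀ j → A (x ∷ y ∷ w) j ≡ H (y ∷ w) j + ι (x <ᵇ y) * A' j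
    step j = F₁-∷ true (replicate j true) x y w
    D = X ^ desʳ (y ∷ w)
    G = g ^ length (y ∷ w)
    by-cases : ∀ b → (x <ᵇ y) ≡ b → A (x ∷ y ∷ w) ≋ X ^ desʳ (x ∷ y ∷ w) ⊛ g ^ length (x ∷ y ∷ w)
    by-cases true eq rewrite trans (<ᵇ-flip x≢y) (cong not eq) = begin
      A (x ∷ y ∷ w)               ≈⟨ mk≋ (λ j → trans (step j) (trans (cong (H (y ∷ w) j +_)
                                        (trans (cong (λ b → ι b * A' j) eq) (*-identityˡ _))) (sym (⊕-at _ _ j)))) ⟩
      H (y ∷ w) ⊕ A'              ≈⟨ ⊕-cong (H-A y w) PS.refl ⟩
      X ⊛ (g ⊛ A') ⊕ A'           ≈⟨ PS.solve 3 (λ x g a → x ⊠ (g ⊠ a) ⊞ a ≐ (κ 1 ⊞ x ⊠ g) ⊠ a) PS.refl X g A' ⟩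
      (one₁ ⊕ X ⊛ g) ⊛ A'         ≈⟨ ⊛-cong (PS.sym g-unfold) (A≋ y w u) ⟩
      g ⊛ (D ⊛ G)                 ≈⟨ PS.solve 3 (λ g D G → g ⊠ (D ⊠ G) ≐ D ⊠ (g ⊠ G)) PS.refl g D G ⟩
      D ⊛ (g ⊛ G)                 ∎
      where open ≋-Reasoning
    by-cases false eq rewrite trans (<ᵇ-flip x≢y) (cong not eq) = begin
      A (x ∷ y ∷ w)               ≈⟨ mk≋ (λ j → trans (step j) (trans (cong (H (y ∷ w) j +_)
                                        (trans (cong (λ b → ι b * A' j) eq) (zeroˡ _))) (+-identityʳ _))) ⟩
      H (y ∷ w)                   ≈⟨ H-A y w ⟩
      X ⊛ (g ⊛ A')                ≈⟨ ⊛-cong PS.refl (⊛-cong PS.refl (A≋ y w u)) ⟩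
      X ⊛ (g ⊛ (D ⊛ G))           ≈⟨ PS.solve 4 (λ x g D G → x ⊠ (g ⊠ (D ⊠ G)) ≐ (x ⊠ D) ⊠ (g ⊠ G)) PS.refl X g D G ⟩
      X ⊛ D ⊛ (g ⊛ G)             ∎
      where open ≋-Reasoning

  -- The classical P-partition series of a linear order: weakly increasing maps that are strict at
  -- the descents.
  descent-series : ∀ x w → Unique (x ∷ w) →
    (λ j → F (replicate j true) (x ∷ w)) ≋ X₁ ^ suc (desʳ (x ∷ w)) ⊛ invOneMinusX ^ suc (length (x ∷ w))
  descent-series x w u = PS.trans (H-A x w) (PS.trans (⊛-cong PS.refl (⊛-cong PS.refl (A≋ x w u)))
    (PS.solve 4 (λ x g D G → x ⊠ (g ⊠ (D ⊠ G)) ≐ (x ⊠ D) ⊠ (g ⊠ G)) PS.refl X g _ _))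

open DescentSeries using (descent-series)

-- Agreement of the positional statistics with their recursive forms

countUpTo : (ℕ → Bool) → ℕ → ℕ
countUpTo p zero    = 0
countUpTo p (suc n) = bit (p 0) ℕ.+ countUpTo (p ∘ suc) n

length-filterᵇ-∷ : ∀ {A : Set} (p : A → Bool) x xs → length (filterᵇ p (x ∷ xs)) ≡ bit (p x) ℕ.+ length (filterᵇ p xs)
length-filterᵇ-∷ p x xs with p x
... | true  = refl
... | false = refl

count-upTo : ∀ p n → count p (map suc (upTo n)) ≡ countUpTo (p ∘ suc) n
count-upTo p n = trans (cong (count p) (map-upTo suc n)) (go suc n)
  where
  go : ∀ f n → count p (applyUpTo f n) ≡ countUpTo (p ∘ f) n
  go f zero    = refl
  go f (suc n) = trans (length-filterᵇ-∷ p (f 0) _) (cong (bit (p (f 0)) ℕ.+_) (go (f ∘ suc) n))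

des≡desʳ : ∀ w → des w ≡ desʳ w
des≡desʳ w = trans (count-upTo _ (length w)) (go w)
  where
  go : ∀ w → countUpTo (λ i → (suc i <ᵇ length w) ∧ (app w (suc (suc i)) <ᵇ app w (suc i))) (length w) ≡ desʳ w
  go []          = refl
  go (x ∷ [])    = refl
  go (x ∷ y ∷ w) = cong (bit (y <ᵇ x) ℕ.+_) (go (y ∷ w))

-- Position 1 contributes 0 in every word, so after a letter is dropped the remaining terms are
-- those of the tail by computation.
pk≡pkʳ : ∀ w → pk w ≡ pkʳ w
pk≡pkʳ w = trans (count-upTo _ (length w)) (go w)
  where
  go : ∀ w → countUpTo (λ i → (1 <ᵇ suc i) ∧ (suc i <ᵇ length w)
                    ∧ (app w (suc i ∸ 1) <ᵇ app w (suc i)) ∧ (app w (suc (suc i)) <ᵇ app w (suc i))) (length w) ≡ pkʳ w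
  go []              = refl
  go (x ∷ [])        = refl
  go (x ∷ y ∷ [])    = refl
  go (x ∷ y ∷ z ∷ w) = cong (bit ((x <ᵇ y) ∧ (z <ᵇ y)) ℕ.+_) (go (y ∷ z ∷ w))

lpk≡lpkʳ : ∀ w → lpk w ≡ lpkʳ w
lpk≡lpkʳ w = cong₂ ℕ._+_ (pk≡pkʳ w) (go w)
  where
  go : ∀ w → (if (1 <ᵇ length w) ∧ (app w 2 <ᵇ app w 1) then 1 else 0) ≡ bit (startsDesc w)
  go []          = refl
  go (x ∷ [])    = refl
  go (x ∷ y ∷ w) = refl

-- Sums over lists and splittings

Σl : {A : Set} → List A → (A → ℚ) → ℚ
Σl []       f = 0ℚ
Σl (x ∷ xs) f = f x + Σl xs f

module _ {A : Set} where
  Σl-cong∈ : ∀ (xs : List A) {f g} → (∀ {x} → x ∈ xs → f x ≡ g x) → Σl xs f ≡ Σl xs g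
  Σl-cong∈ []       eq = refl
  Σl-cong∈ (x ∷ xs) eq = cong₂ _+_ (eq (here refl)) (Σl-cong∈ xs (eq ∘ there))

  Σl-cong : ∀ (xs : List A) {f g} → (∀ x → f x ≡ g x) → Σl xs f ≡ Σl xs g
  Σl-cong xs eq = Σl-cong∈ xs (λ {x} _ → eq x)

  Σl-++ : ∀ (xs ys : List A) f → Σl (xs ++ ys) f ≡ Σl xs f + Σl ys f
  Σl-++ []       ys f = sym (+-identityˡ _)
  Σl-++ (x ∷ xs) ys f = trans (cong (f x +_) (Σl-++ xs ys f)) (sym (+-assoc _ _ _))

  Σl-+ : ∀ (xs : List A) f g → Σl xs (λ x → f x + g x) ≡ Σl xs f + Σl xs g
  Σl-+ []       f g = sym (+-identityˡ 0ℚ)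
  Σl-+ (x ∷ xs) f g = trans (cong₂ _+_ refl (Σl-+ xs f g)) (+-interchange _ _ _ _)

  Σl-*ˡ : ∀ (xs : List A) c f → Σl xs (λ x → c * f x) ≡ c * Σl xs f
  Σl-*ˡ []       c f = sym (zeroʳ c)
  Σl-*ˡ (x ∷ xs) c f = trans (cong₂ _+_ refl (Σl-*ˡ xs c f)) (sym (*-distribˡ-+ c _ _))

  Σl-*ʳ : ∀ (xs : List A) c f → Σl xs (λ x → f x * c) ≡ Σl xs f * c
  Σl-*ʳ xs c f = trans (Σl-cong xs (λ x → *-comm (f x) c)) (trans (Σl-*ˡ xs c f) (*-comm c _))

  Σl-0 : ∀ (xs : List A) → Σl xs (λ _ → 0ℚ) ≡ 0ℚ
  Σl-0 []       = refl
  Σl-0 (x ∷ xs) = trans (+-identityˡ _) (Σl-0 xs)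

  Σl-↭ : ∀ {xs ys : List A} f → xs ↭ ys → Σl xs f ≡ Σl ys f
  Σl-↭ f _↭_.refl          = refl
  Σl-↭ f (_↭_.prep x p)    = cong (f x +_) (Σl-↭ f p)
  Σl-↭ f (_↭_.swap x y p)  = trans (sym (+-assoc _ _ _)) (trans (cong₂ _+_ (+-comm (f x) (f y)) (Σl-↭ f p)) (+-assoc _ _ _))
  Σl-↭ f (_↭_.trans p q)   = trans (Σl-↭ f p) (Σl-↭ f q)

  Σl-Σ≤ : ∀ (xs : List A) n (f : A → ℕ → ℚ) → Σl xs (λ x → Σ≤ n (f x)) ≡ Σ≤ n (λ k → Σl xs (λ x → f x k))
  Σl-Σ≤ xs zero    f = refl
  Σl-Σ≤ xs (suc n) f = trans (Σl-+ xs _ _) (cong₂ _+_ (Σl-Σ≤ xs n f) refl)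

Σl-map : ∀ {A B : Set} (h : A → B) xs f → Σl (map h xs) f ≡ Σl xs (f ∘ h)
Σl-map h []       f = refl
Σl-map h (x ∷ xs) f = cong (f (h x) +_) (Σl-map h xs f)

Σl-concatMap : ∀ {A B : Set} (h : A → List B) xs f → Σl (concatMap h xs) f ≡ Σl xs (λ x → Σl (h x) f)
Σl-concatMap h []       f = refl
Σl-concatMap h (x ∷ xs) f = trans (Σl-++ (h x) _ f) (cong (Σl (h x) f +_) (Σl-concatMap h xs f))

Σl-const : ∀ {A : Set} (xs : List A) c → Σl xs (λ _ → c) ≡ nat (length xs) * c
Σl-const []       c = sym (trans (cong (_* c) nat-0) (zeroˡ c))
Σl-const (x ∷ xs) c = trans (cong (c +_) (Σl-const xs c)) (sym (trans (cong (_* c) (nat-suc (length xs)))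
  (trans (*-distribʳ-+ c 1ℚ _) (cong (_+ nat (length xs) * c) (*-identityˡ c)))))

Σl-swap : ∀ {A B : Set} (xs : List A) (ys : List B) (h : A → B → ℚ) → Σl xs (λ x → Σl ys (h x)) ≡ Σl ys (λ y → Σl xs (λ x → h x y))
Σl-swap []       ys h = sym (Σl-0 ys)
Σl-swap (x ∷ xs) ys h = trans (cong (Σl ys (h x) +_) (Σl-swap xs ys h)) (sym (Σl-+ ys _ _))

Σsplit-cong++ : ∀ {h h'} w → (∀ u v → u ++ v ≡ w → h u v ≡ h' u v) → Σsplit h w ≡ Σsplit h' w
Σsplit-cong++ []      eq = eq [] [] refl
Σsplit-cong++ (x ∷ w) eq = cong₂ _+_ (eq [] (x ∷ w) refl) (Σsplit-cong++ w (λ u v e → eq (x ∷ u) v (cong (x ∷_) e)))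

Σsplit-+ : ∀ h h' w → Σsplit (λ u v → h u v + h' u v) w ≡ Σsplit h w + Σsplit h' w
Σsplit-+ h h' []      = refl
Σsplit-+ h h' (x ∷ w) = trans (cong₂ _+_ refl (Σsplit-+ _ _ w)) (+-interchange _ _ _ _)

Σsplit-*ʳ : ∀ c h w → Σsplit (λ u v → h u v * c) w ≡ Σsplit h w * c
Σsplit-*ʳ c h w = trans (Σsplit-cong w (λ u v → *-comm (h u v) c)) (trans (Σsplit-*ˡ c h w) (*-comm c _))

-- Shuffles of words and the product rule

shuffle : List ℕ → List ℕ → List (List ℕ)
shuffle []      v       = v ∷ []
shuffle (x ∷ u) []      = (x ∷ u) ∷ []
shuffle (x ∷ u) (y ∷ v) = map (x ∷_) (shuffle u (y ∷ v)) ++ map (y ∷_) (shuffle (x ∷ u) v)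

shuffle-[] : ∀ u → shuffle u [] ≡ u ∷ []
shuffle-[] []      = refl
shuffle-[] (x ∷ u) = refl

Σl-shuffle-∷ : ∀ x u y v h → Σl (shuffle (x ∷ u) (y ∷ v)) h
  ≡ Σl (shuffle u (y ∷ v)) (h ∘ (x ∷_)) + Σl (shuffle (x ∷ u) v) (h ∘ (y ∷_))
Σl-shuffle-∷ x u y v h = trans (Σl-++ (map (x ∷_) (shuffle u (y ∷ v))) _ h)
  (cong₂ _+_ (Σl-map (x ∷_) (shuffle u (y ∷ v)) h) (Σl-map (y ∷_) (shuffle (x ∷ u) v) h))

Word = List ℕ

shuffle₂ : (Word → Word → ℚ) → Word → Word → Word → Word → ℚ
shuffle₂ h u₁ u₂ v₁ v₂ = Σl (shuffle u₁ v₁) (λ w₁ → Σl (shuffle u₂ v₂) (h w₁))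

-- Compatibility of cutting with shuffling: a cut of a shuffle cuts both words, and the pieces on
-- each side are shuffled independently.
shuffle-Σsplit : ∀ h u v → Σl (shuffle u v) (Σsplit h) ≡ Σsplit (λ u₁ u₂ → Σsplit (shuffle₂ h u₁ u₂) v) u
shuffle-Σsplit h [] v = trans (+-identityʳ _)
  (Σsplit-cong v (λ v₁ v₂ → sym (trans (+-identityʳ _) (+-identityʳ _))))
shuffle-Σsplit h (x ∷ u) [] = trans (+-identityʳ _) (Σsplit-cong (x ∷ u) go)
  where
  go : ∀ u₁ u₂ → h u₁ u₂ ≡ shuffle₂ h u₁ u₂ [] []
  go u₁ u₂ rewrite shuffle-[] u₁ | shuffle-[] u₂ = sym (trans (+-identityʳ _) (+-identityʳ _))
shuffle-Σsplit h (x ∷ u) (y ∷ v) = begin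
  Σl (shuffle (x ∷ u) (y ∷ v)) (Σsplit h)
    ≡⟨ Σl-shuffle-∷ x u y v (Σsplit h) ⟩
  Σl (shuffle u (y ∷ v)) (λ w → h [] (x ∷ w) + Σsplit hx w) + Σl (shuffle (x ∷ u) v) (λ w → h [] (y ∷ w) + Σsplit hy w)
    ≡⟨ cong₂ _+_ (Σl-+ (shuffle u (y ∷ v)) _ _) (Σl-+ (shuffle (x ∷ u) v) _ _) ⟩
  (a + Σl (shuffle u (y ∷ v)) (Σsplit hx)) + (b + Σl (shuffle (x ∷ u) v) (Σsplit hy))
    ≡⟨ cong₂ _+_ (cong (a +_) (trans (shuffle-Σsplit hx u (y ∷ v)) (Σsplit-+ _ _ u))) (cong (b +_) (shuffle-Σsplit hy (x ∷ u) v)) ⟩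
  (a + (c + k)) + (b + (e + f))
    ≡⟨ solve 6 (λ a b c d e f → (a :+ (c :+ d)) :+ (b :+ (e :+ f)) := ((a :+ b) :+ e) :+ (c :+ (d :+ f))) refl a b c k e f ⟩
  ((a + b) + e) + (c + (k + f))
    ≡⟨ cong₂ _+_ (cong (_+ e) (sym (trans (+-identityʳ _) (Σl-shuffle-∷ x u y v (h [])))))
         (trans (cong₂ _+_ c≡ (sym (Σsplit-+ _ _ u))) (sym (Σsplit-+ _ _ u))) ⟩
  (shuffle₂ h [] (x ∷ u) [] (y ∷ v) + e)
    + Σsplit (λ u₁ u₂ → shuffle₂ h (x ∷ u₁) u₂ [] (y ∷ v)
        + (Σsplit (λ v₁ v₂ → shuffle₂ hx u₁ u₂ (y ∷ v₁) v₂) v + Σsplit (λ v₁ v₂ → shuffle₂ hy (x ∷ u₁) u₂ v₁ v₂) v)) u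
    ≡⟨ cong ((shuffle₂ h [] (x ∷ u) [] (y ∷ v) + e) +_) (Σsplit-cong u (λ u₁ u₂ → cong₂ _+_ refl
         (trans (sym (Σsplit-+ _ _ v)) (Σsplit-cong v (λ v₁ v₂ → sym (Σl-shuffle-∷ x u₁ y v₁ (λ w₁ → Σl (shuffle u₂ v₂) (h w₁)))))))) ⟩
  Σsplit (λ u₁ u₂ → Σsplit (shuffle₂ h u₁ u₂) (y ∷ v)) (x ∷ u) ∎
  where
  open ≡-Reasoning
  hx hy : Word → Word → ℚ
  hx w = h (x ∷ w)
  hy w = h (y ∷ w)
  -- `a` and `b` collect the cuts before the first letter `x` or `y`. With `x` left of the cut, `c`
  -- and `k` separate whether `y ∷ v` is cut at its start; with `y` left of the cut, `e` and `f` do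
  -- the same for `x ∷ u`.
  a b c k e f : ℚ
  a = Σl (shuffle u (y ∷ v)) (λ w → h [] (x ∷ w))
  b = Σl (shuffle (x ∷ u) v) (λ w → h [] (y ∷ w))
  c = Σsplit (λ u₁ u₂ → shuffle₂ hx u₁ u₂ [] (y ∷ v)) u
  k = Σsplit (λ u₁ u₂ → Σsplit (λ v₁ v₂ → shuffle₂ hx u₁ u₂ (y ∷ v₁) v₂) v) u
  e = Σsplit (λ v₁ v₂ → shuffle₂ hy [] (x ∷ u) v₁ v₂) v
  f = Σsplit (λ u₁ u₂ → Σsplit (λ v₁ v₂ → shuffle₂ hy (x ∷ u₁) u₂ v₁ v₂) v) u
  c≡ : c ≡ Σsplit (λ u₁ u₂ → shuffle₂ h (x ∷ u₁) u₂ [] (y ∷ v)) u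
  c≡ = Σsplit-cong u (λ u₁ u₂ → cong (λ ws → Σl ws (λ w₁ → Σl (shuffle u₂ (y ∷ v)) (hx w₁))) (shuffle-[] u₁))

<ᵇ⇒< : ∀ x y → (x <ᵇ y) ≡ true → x ℕ.< y
<ᵇ⇒< x y eq = ℕ.<ᵇ⇒< x y (subst Data.Bool.T (sym eq) _)

ok-trans : ∀ c x y z → ok c x y ≡ true → ok c y z ≡ true → ok c x z ≡ true
ok-trans true  x y z p q = <ᵇ-true (ℕ.<-trans (<ᵇ⇒< x y p) (<ᵇ⇒< y z q))
ok-trans false x y z p q = <ᵇ-true (ℕ.<-trans (<ᵇ⇒< z y q) (<ᵇ⇒< y x p))

ok-flip : ∀ c {x y} → x ≢ y → ok c y x ≡ not (ok c x y)
ok-flip true  x≢y = <ᵇ-flip x≢y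
ok-flip false x≢y = <ᵇ-flip (x≢y ∘ sym)

∧-true : ∀ {a b} → a ∧ b ≡ true → a ≡ true × b ≡ true
∧-true {true} {true} refl = refl , refl

all-ok-trans : ∀ c x y w → ok c x y ≡ true → all (ok c y) w ≡ true → all (ok c x) w ≡ true
all-ok-trans c x y []      p q = refl
all-ok-trans c x y (z ∷ w) p q with ∧-true {ok c y z} q
... | yz , q' = cong₂ _∧_ (ok-trans c x y z p yz) (all-ok-trans c x y w p q')

-- Transitivity turns the comparison of neighbours into a comparison with all later letters, which
-- by `all-shuffle` has the same value on every shuffle.
mono-∷ : ∀ c x w → mono c (x ∷ w) ≡ all (ok c x) w ∧ mono c w
mono-∷ c x []      = refl
mono-∷ c x (y ∷ w) = trans (cong (ok c x y ∧_) (mono-∷ c y w)) (trans (go (ok c x y) refl) (cong ((ok c x y ∧ all (ok c x) w) ∧_) (sym (mono-∷ c y w))))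
  where
  go : ∀ b → ok c x y ≡ b → (b ∧ (all (ok c y) w ∧ mono c w)) ≡ ((b ∧ all (ok c x) w) ∧ (all (ok c y) w ∧ mono c w))
  go false eq = refl
  go true  eq with all (ok c y) w in eq'
  ... | false = sym (Bool.∧-zeroʳ _)
  ... | true  = cong (_∧ mono c w) (sym (all-ok-trans c x y w eq eq'))

all-shuffle : ∀ p u v {w} → w ∈ shuffle u v → all p w ≡ all p u ∧ all p v
all-shuffle p []      v       (here refl) = refl
all-shuffle p (x ∷ u) []      (here refl) = sym (Bool.∧-identityʳ _)
all-shuffle p (x ∷ u) (y ∷ v) w∈ with ∈-++⁻ (map (x ∷_) (shuffle u (y ∷ v))) w∈
... | inj₁ w∈₁ with ∈-map⁻ (x ∷_) w∈₁
...   | w' , w'∈ , refl = trans (cong (p x ∧_) (all-shuffle p u (y ∷ v) w'∈)) (sym (Bool.∧-assoc (p x) _ _))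
all-shuffle p (x ∷ u) (y ∷ v) w∈ | inj₂ w∈₂ with ∈-map⁻ (y ∷_) w∈₂
...   | w' , w'∈ , refl = trans (cong (p y ∧_) (all-shuffle p (x ∷ u) v w'∈))
          (trans (sym (Bool.∧-assoc (p y) _ _)) (trans (cong (_∧ all p v) (Bool.∧-comm (p y) (all p (x ∷ u)))) (Bool.∧-assoc (all p (x ∷ u)) _ _)))

Apart : Word → Word → Set
Apart u v = ∀ {x y} → x ∈ u → y ∈ v → x ≢ y

-- Two monotone words without a common letter have exactly one monotone shuffle, their merge; a word
-- that is not monotone has no monotone shuffle with anything.
mono-shuffle : ∀ c u v → Apart u v → Σl (shuffle u v) (ι ∘ mono c) ≡ ι (mono c u) * ι (mono c v)
mono-shuffle c []      v       ap = trans (+-identityʳ _) (sym (*-identityˡ _))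
mono-shuffle c (x ∷ u) []      ap = trans (+-identityʳ _) (sym (*-identityʳ _))
mono-shuffle c (x ∷ u) (y ∷ v) ap = begin
  Σl (shuffle (x ∷ u) (y ∷ v)) (ι ∘ mono c)
    ≡⟨ Σl-shuffle-∷ x u y v (ι ∘ mono c) ⟩
  Σl (shuffle u (y ∷ v)) (λ w → ι (mono c (x ∷ w))) + Σl (shuffle (x ∷ u) v) (λ w → ι (mono c (y ∷ w)))
    ≡⟨ cong₂ _+_ (first x u (y ∷ v) (mono-shuffle c u (y ∷ v) (ap ∘ there)))
                 (first y (x ∷ u) v (mono-shuffle c (x ∷ u) v (λ p → ap p ∘ there))) ⟩
  (ι (all (ok c x) u) * ι (all (ok c x) (y ∷ v))) * (mu * ι (mono c (y ∷ v)))
    + (ι (all (ok c y) (x ∷ u)) * ι (all (ok c y) v)) * (ι (mono c (x ∷ u)) * mv)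
    ≡⟨ cong₂ _+_ (cong (λ z → (ι (all (ok c x) u) * ι (all (ok c x) (y ∷ v))) * (mu * z)) (m∷ y v))
                 (cong (λ z → (ι (all (ok c y) (x ∷ u)) * ι (all (ok c y) v)) * (z * mv)) (m∷ x u)) ⟩
  (ι (all (ok c x) u) * ι (all (ok c x) (y ∷ v))) * (mu * (ι (all (ok c y) v) * mv))
    + (ι (all (ok c y) (x ∷ u)) * ι (all (ok c y) v)) * (ι (all (ok c x) u) * mu * mv)
    ≡⟨ by-cases (ok c x y) refl ⟩
  (ι (all (ok c x) u) * mu) * (ι (all (ok c y) v) * mv)
    ≡⟨ cong₂ _*_ (m∷ x u) (m∷ y v) ⟨
  ι (mono c (x ∷ u)) * ι (mono c (y ∷ v)) ∎
  where
  open ≡-Reasoning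
  mu mv : ℚ
  mu = ι (mono c u)
  mv = ι (mono c v)
  m∷ : ∀ x w → ι (mono c (x ∷ w)) ≡ ι (all (ok c x) w) * ι (mono c w)
  m∷ x w = trans (cong ι (mono-∷ c x w)) (ι-∧ (all (ok c x) w) _)
  first : ∀ x u v → Σl (shuffle u v) (ι ∘ mono c) ≡ ι (mono c u) * ι (mono c v) →
    Σl (shuffle u v) (λ w → ι (mono c (x ∷ w))) ≡ (ι (all (ok c x) u) * ι (all (ok c x) v)) * (ι (mono c u) * ι (mono c v))
  first x u v ih = trans (Σl-cong∈ (shuffle u v) (λ {w} w∈ → trans (m∷ x w) (cong (_* ι (mono c w))
      (trans (cong ι (all-shuffle (ok c x) u v w∈)) (ι-∧ (all (ok c x) u) _)))))
    (trans (Σl-*ˡ (shuffle u v) _ _) (cong₂ _*_ refl ih))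
  absorb : ∀ x y w → ok c x y ≡ true → ι (all (ok c x) (y ∷ w)) * ι (all (ok c y) w) ≡ ι (all (ok c y) w)
  absorb x y w eq with all (ok c y) w in eq'
  ... | false = zeroʳ _
  ... | true  = trans (*-identityʳ _) (cong ι (cong₂ _∧_ eq (all-ok-trans c x y w eq eq')))
  vanish : ∀ x y w → ok c x y ≡ false → ι (all (ok c x) (y ∷ w)) ≡ 0ℚ
  vanish x y w eq = cong (λ b → ι (b ∧ all (ok c x) w)) eq
  Ax Ay : ℚ
  Ax = ι (all (ok c x) u)
  Ay = ι (all (ok c y) v)
  by-cases : ∀ b → ok c x y ≡ b →
    (Ax * ι (all (ok c x) (y ∷ v))) * (mu * (Ay * mv)) + (ι (all (ok c y) (x ∷ u)) * Ay) * (Ax * mu * mv) ≡ (Ax * mu) * (Ay * mv)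
  -- If `x` precedes `y`, only the shuffles beginning with `x` survive: there the conditions of `x`
  -- on `y ∷ v` follow from those of `y` on `v`, while a shuffle beginning with `y` violates the
  -- order at `x`.
  by-cases true eq = begin
    (Ax * ι (all (ok c x) (y ∷ v))) * (mu * (Ay * mv)) + (ι (all (ok c y) (x ∷ u)) * Ay) * (Ax * mu * mv)
      ≡⟨ solve 6 (λ a b m A n z → (a :* b) :* (m :* (A :* n)) :+ (z :* A) :* (a :* m :* n) := (a :* m) :* (b :* A :* n) :+ z :* (A :* (a :* m :* n)))
           refl Ax (ι (all (ok c x) (y ∷ v))) mu Ay mv (ι (all (ok c y) (x ∷ u))) ⟩
    (Ax * mu) * (ι (all (ok c x) (y ∷ v)) * Ay * mv) + ι (all (ok c y) (x ∷ u)) * (Ay * (Ax * mu * mv))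
      ≡⟨ cong₂ _+_ (cong (λ z → (Ax * mu) * (z * mv)) (absorb x y v eq))
           (trans (cong (_* (Ay * (Ax * mu * mv))) (vanish y x u (trans (ok-flip c (ap (here refl) (here refl))) (cong not eq)))) (zeroˡ _)) ⟩
    (Ax * mu) * (Ay * mv) + 0ℚ ≡⟨ +-identityʳ _ ⟩
    (Ax * mu) * (Ay * mv) ∎
  by-cases false eq = begin
    (Ax * ι (all (ok c x) (y ∷ v))) * (mu * (Ay * mv)) + (ι (all (ok c y) (x ∷ u)) * Ay) * (Ax * mu * mv)
      ≡⟨ solve 6 (λ a b m A n z → (a :* b) :* (m :* (A :* n)) :+ (z :* A) :* (a :* m :* n) := b :* (a :* (m :* (A :* n))) :+ (z :* a :* m) :* (A :* n))
           refl Ax (ι (all (ok c x) (y ∷ v))) mu Ay mv (ι (all (ok c y) (x ∷ u))) ⟩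
    ι (all (ok c x) (y ∷ v)) * (Ax * (mu * (Ay * mv))) + (ι (all (ok c y) (x ∷ u)) * Ax * mu) * (Ay * mv)
      ≡⟨ cong₂ _+_ (trans (cong (_* (Ax * (mu * (Ay * mv)))) (vanish x y v eq)) (zeroˡ _))
           (cong (λ z → (z * mu) * (Ay * mv)) (absorb y x u (trans (ok-flip c (ap (here refl) (here refl))) (cong not eq)))) ⟩
    0ℚ + (Ax * mu) * (Ay * mv) ≡⟨ +-identityˡ _ ⟩
    (Ax * mu) * (Ay * mv) ∎

-- The product rule for fundamental quasisymmetric functions in a signed alphabet.
F-shuffle : ∀ X u v → Apart u v → Σl (shuffle u v) (F X) ≡ F X u * F X v
F-shuffle []      []      v  ap = trans (+-identityʳ _) (sym (*-identityˡ _))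
F-shuffle []      (x ∷ u) [] ap = trans (+-identityʳ _) (sym (zeroˡ _))
F-shuffle []      (x ∷ u) (y ∷ v) ap = trans (Σl-shuffle-∷ x u y v (F [])) (trans (cong₂ _+_ (Σl-0 (shuffle u (y ∷ v))) (Σl-0 (shuffle (x ∷ u) v)))
  (trans (+-identityˡ 0ℚ) (sym (zeroˡ _))))
F-shuffle (c ∷ X) u v ap = begin
  Σl (shuffle u v) (Σsplit (λ w₁ w₂ → ι (mono c w₁) * F X w₂))
    ≡⟨ shuffle-Σsplit _ u v ⟩
  Σsplit (λ u₁ u₂ → Σsplit (shuffle₂ (λ w₁ w₂ → ι (mono c w₁) * F X w₂) u₁ u₂) v) u
    ≡⟨ Σsplit-cong++ u (λ u₁ u₂ eu → trans (Σsplit-cong++ v (λ v₁ v₂ ev → factor u₁ u₂ v₁ v₂ eu ev)) (Σsplit-*ˡ _ _ v)) ⟩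
  Σsplit (λ u₁ u₂ → (ι (mono c u₁) * F X u₂) * F (c ∷ X) v) u
    ≡⟨ Σsplit-*ʳ _ _ u ⟩
  F (c ∷ X) u * F (c ∷ X) v ∎
  where
  open ≡-Reasoning
  factor : ∀ u₁ u₂ v₁ v₂ → u₁ ++ u₂ ≡ u → v₁ ++ v₂ ≡ v →
    shuffle₂ (λ w₁ w₂ → ι (mono c w₁) * F X w₂) u₁ u₂ v₁ v₂ ≡ (ι (mono c u₁) * F X u₂) * (ι (mono c v₁) * F X v₂)
  factor u₁ u₂ v₁ v₂ refl refl = begin
    Σl (shuffle u₁ v₁) (λ w₁ → Σl (shuffle u₂ v₂) (λ w₂ → ι (mono c w₁) * F X w₂))
      ≡⟨ Σl-cong (shuffle u₁ v₁) (λ w₁ → Σl-*ˡ (shuffle u₂ v₂) _ _) ⟩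
    Σl (shuffle u₁ v₁) (λ w₁ → ι (mono c w₁) * Σl (shuffle u₂ v₂) (F X))
      ≡⟨ Σl-*ʳ (shuffle u₁ v₁) _ _ ⟩
    Σl (shuffle u₁ v₁) (ι ∘ mono c) * Σl (shuffle u₂ v₂) (F X)
      ≡⟨ cong₂ _*_ (mono-shuffle c u₁ v₁ (λ p q → ap (∈-++⁺ˡ p) (∈-++⁺ˡ q)))
                   (F-shuffle X u₂ v₂ (λ p q → ap (∈-++⁺ʳ u₁ p) (∈-++⁺ʳ v₁ q))) ⟩
    (ι (mono c u₁) * ι (mono c v₁)) * (F X u₂ * F X v₂)
      ≡⟨ solve 4 (λ a b x y → (a :* b) :* (x :* y) := (a :* x) :* (b :* y)) refl _ _ _ _ ⟩
    (ι (mono c u₁) * F X u₂) * (ι (mono c v₁) * F X v₂) ∎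

-- Lists without repetition

module _ {A : Set} where
  removed : ∀ {x : A} {xs} u v → x ∉ xs → xs ⊆ u ++ x ∷ v → xs ⊆ u ++ v
  removed {x} u v x∉xs sub {z} z∈ with ∈-++⁻ u (sub z∈)
  ... | inj₁ z∈u          = ∈-++⁺ˡ z∈u
  ... | inj₂ (here refl)  = contradiction z∈ x∉xs
  ... | inj₂ (there z∈v)  = ∈-++⁺ʳ u z∈v

  unique-⊆⇒length≤ : ∀ {xs ys : List A} → Unique xs → xs ⊆ ys → length xs ≤ length ys
  unique-⊆⇒length≤ {[]}     _ _ = z≤n
  unique-⊆⇒length≤ {x ∷ xs} u@(_ ∷ uxs) sub with ∈-∃++ (sub (here refl))
  ... | as , bs , refl = subst (suc (length xs) ≤_) (sym (↭-length (shift x as bs)))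
    (s≤s (unique-⊆⇒length≤ uxs (removed as bs (Unique[x∷xs]⇒x∉xs u) (sub ∘ there))))

  unique-⊆⇒↭ : ∀ {xs ys : List A} → Unique xs → xs ⊆ ys → length ys ≤ length xs → xs ↭ ys
  unique-⊆⇒↭ {[]}     {[]} _ _ _ = ↭-refl
  unique-⊆⇒↭ {x ∷ xs} u@(_ ∷ uxs) sub len with ∈-∃++ (sub (here refl))
  ... | as , bs , refl = ↭-trans (↭-prep x (unique-⊆⇒↭ uxs (removed as bs (Unique[x∷xs]⇒x∉xs u) (sub ∘ there))
      (ℕ.≤-pred (subst (_≤ suc (length xs)) (↭-length (shift x as bs)) len))))
    (↭-sym (shift x as bs))

  unique-≐⇒↭ : ∀ {xs ys : List A} → Unique xs → Unique ys → xs ⊆ ys → ys ⊆ xs → xs ↭ ys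
  unique-≐⇒↭ uxs uys p q = unique-⊆⇒↭ uxs p (unique-⊆⇒length≤ uys q)

  unique-filterᵇ : ∀ (p : A → Bool) {xs} → Unique xs → Unique (filterᵇ p xs)
  unique-filterᵇ p = Unique.filter⁺ _

  Σl-filterᵇ : ∀ (p : A → Bool) xs f → Σl (filterᵇ p xs) f ≡ Σl xs (λ x → ι (p x) * f x)
  Σl-filterᵇ p []       f = refl
  Σl-filterᵇ p (x ∷ xs) f with p x
  ... | true  = cong₂ _+_ (sym (*-identityˡ _)) (Σl-filterᵇ p xs f)
  ... | false = trans (Σl-filterᵇ p xs f) (sym (trans (cong (_+ _) (zeroˡ _)) (+-identityˡ _)))

  ∈-filterᵇ⁻ : ∀ (p : A → Bool) xs {x} → x ∈ filterᵇ p xs → x ∈ xs × p x ≡ true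
  ∈-filterᵇ⁻ p (y ∷ ys) x∈ with p y in eq
  ∈-filterᵇ⁻ p (y ∷ ys) (here refl) | true = here refl , eq
  ∈-filterᵇ⁻ p (y ∷ ys) (there x∈)  | true with ∈-filterᵇ⁻ p ys x∈
  ... | x∈' , px = there x∈' , px
  ∈-filterᵇ⁻ p (y ∷ ys) x∈ | false with ∈-filterᵇ⁻ p ys x∈
  ... | x∈' , px = there x∈' , px

  ∈-filterᵇ⁺ : ∀ (p : A → Bool) xs {x} → x ∈ xs → p x ≡ true → x ∈ filterᵇ p xs
  ∈-filterᵇ⁺ p (y ∷ ys) (here refl) px rewrite px = here refl
  ∈-filterᵇ⁺ p (y ∷ ys) (there x∈)  px with p y
  ... | true  = there (∈-filterᵇ⁺ p ys x∈ px)
  ... | false = ∈-filterᵇ⁺ p ys x∈ px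

-- A left inverse ρ of z ↦ x on the pairs z ∈ f x makes the blocks f x disjoint.
unique-concatMap : ∀ {A B : Set} (f : A → List B) (ρ : B → A) {xs} → Unique xs →
  (∀ {x} → x ∈ xs → Unique (f x)) → (∀ {x z} → x ∈ xs → z ∈ f x → ρ z ≡ x) → Unique (concatMap f xs)
unique-concatMap f ρ {[]}     _ _ _ = []
unique-concatMap f ρ {x ∷ xs} u@(_ ∷ uxs) uf ρf = Unique.++⁺ (uf (here refl)) (unique-concatMap f ρ uxs (uf ∘ there) (ρf ∘ there)) disjoint
  where
  disjoint : ∀ {z} → z ∈ f x × z ∈ concatMap f xs → ⊥
  disjoint (z∈ , z∈') with find (∈-concatMap⁻ f z∈')
  ... | y , y∈ , z∈fy = Unique[x∷xs]⇒x∉xs u (subst (_∈ xs) (trans (sym (ρf (there y∈) z∈fy)) (ρf (here refl) z∈)) y∈)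

-- Shuffles

∈-shuffle⇒↭ : ∀ u v {w} → w ∈ shuffle u v → w ↭ u ++ v
∈-shuffle⇒↭ []      v       (here refl) = ↭-refl
∈-shuffle⇒↭ (x ∷ u) []      (here refl) = ↭-reflexive (sym (++-identityʳ (x ∷ u)))
∈-shuffle⇒↭ (x ∷ u) (y ∷ v) w∈ with ∈-++⁻ (map (x ∷_) (shuffle u (y ∷ v))) w∈
... | inj₁ w∈₁ with ∈-map⁻ (x ∷_) w∈₁
...   | w' , w'∈ , refl = ↭-prep x (∈-shuffle⇒↭ u (y ∷ v) w'∈)
∈-shuffle⇒↭ (x ∷ u) (y ∷ v) w∈ | inj₂ w∈₂ with ∈-map⁻ (y ∷_) w∈₂
...   | w' , w'∈ , refl = ↭-trans (↭-prep y (∈-shuffle⇒↭ (x ∷ u) v w'∈)) (↭-sym (shift y (x ∷ u) v))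

unique-shuffle : ∀ u v → Apart u v → Unique (shuffle u v)
unique-shuffle []      v       ap = [] ∷ []
unique-shuffle (x ∷ u) []      ap = [] ∷ []
unique-shuffle (x ∷ u) (y ∷ v) ap = Unique.++⁺
  (Unique.map⁺ ∷-injectiveʳ (unique-shuffle u (y ∷ v) (ap ∘ there)))
  (Unique.map⁺ ∷-injectiveʳ (unique-shuffle (x ∷ u) v (λ p → ap p ∘ there)))
  disjoint
  where
  disjoint : ∀ {z} → z ∈ map (x ∷_) (shuffle u (y ∷ v)) × z ∈ map (y ∷_) (shuffle (x ∷ u) v) → ⊥
  disjoint (p , q) with ∈-map⁻ (x ∷_) p | ∈-map⁻ (y ∷_) q
  ... | _ , _ , refl | _ , _ , eq = ap (here refl) (here refl) (∷-injectiveˡ eq)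

module _ {P : Pred ℕ 0ℓ} (P? : Decidable P) where
  -- A predicate separating the letters lets both words be read off from a shuffle. With
  -- `∈-shuffle-filters`, the shuffles are exactly the words with these two restrictions.
  shuffle-filters : ∀ u v → All (∁ P) u → All P v → ∀ {w} → w ∈ shuffle u v → filter (∁? P?) w ≡ u × filter P? w ≡ v
  shuffle-filters [] v _ Pv (here refl) = filter-none (∁? P?) (All.map (λ p q → q p) Pv) , filter-all P? Pv
  shuffle-filters (x ∷ u) [] Pu _ (here refl) = filter-all (∁? P?) Pu , filter-none P? Pu
  shuffle-filters (x ∷ u) (y ∷ v) (¬Px ∷ Pu) (Py ∷ Pv) w∈ with ∈-++⁻ (map (x ∷_) (shuffle u (y ∷ v))) w∈
  ... | inj₁ w∈₁ with ∈-map⁻ (x ∷_) w∈₁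
  ...   | w' , w'∈ , refl with shuffle-filters u (y ∷ v) Pu (Py ∷ Pv) w'∈
  ...     | e₁ , e₂ = trans (filter-accept (∁? P?) ¬Px) (cong (x ∷_) e₁) , trans (filter-reject P? ¬Px) e₂
  shuffle-filters (x ∷ u) (y ∷ v) (¬Px ∷ Pu) (Py ∷ Pv) w∈ | inj₂ w∈₂ with ∈-map⁻ (y ∷_) w∈₂
  ...   | w' , w'∈ , refl with shuffle-filters (x ∷ u) v (¬Px ∷ Pu) Pv w'∈
  ...     | e₁ , e₂ = trans (filter-reject (∁? P?) (λ ¬Py → ¬Py Py)) e₁ , trans (filter-accept P? Py) (cong (y ∷_) e₂)

  ∈-shuffle-filters : ∀ w → w ∈ shuffle (filter (∁? P?) w) (filter P? w)
  ∈-shuffle-filters []      = here refl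
  ∈-shuffle-filters (x ∷ w) with P? x
  ... | yes Px = second x (filter (∁? P?) w) (filter P? w) (∈-shuffle-filters w)
    where
    second : ∀ x u v {w} → w ∈ shuffle u v → x ∷ w ∈ shuffle u (x ∷ v)
    second x []      v (here refl) = here refl
    second x (y ∷ u) v w∈          = ∈-++⁺ʳ (map (y ∷_) (shuffle u (x ∷ v))) (∈-map⁺ (x ∷_) w∈)
  ... | no ¬Px = first x (filter (∁? P?) w) (filter P? w) (∈-shuffle-filters w)
    where
    first : ∀ x u v {w} → w ∈ shuffle u v → x ∷ w ∈ shuffle (x ∷ u) v
    first x u []      w∈ rewrite shuffle-[] u with here refl ← w∈ = here refl
    first x u (y ∷ v) w∈ = ∈-++⁺ˡ (∈-map⁺ (x ∷_) w∈)

-- Makes `perms` an iterated shuffle with one-letter words, so that its properties come from those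
-- of shuffles.
insertions≡shuffle : ∀ x w → insertions x w ≡ shuffle (x ∷ []) w
insertions≡shuffle x []      = refl
insertions≡shuffle x (y ∷ w) = cong (λ ws → (x ∷ y ∷ w) ∷ map (y ∷_) ws) (insertions≡shuffle x w)

-- The permutations of [n]

range : ℕ → List ℕ
range = applyUpTo suc

segment : ℕ → ℕ → List ℕ
segment k = applyUpTo (λ i → suc (k ℕ.+ i))

applyUpTo-+ : ∀ {A : Set} (f : ℕ → A) k m → applyUpTo f (k ℕ.+ m) ≡ applyUpTo f k ++ applyUpTo (f ∘ (k ℕ.+_)) m
applyUpTo-+ f zero    m = refl
applyUpTo-+ f (suc k) m = cong (f 0 ∷_) (applyUpTo-+ (f ∘ suc) k m)

range-+ : ∀ k m → range (k ℕ.+ m) ≡ range k ++ segment k m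
range-+ = applyUpTo-+ suc

range-suc : ∀ n → range (suc n) ↭ suc n ∷ range n
range-suc n = ↭-trans (↭-reflexive (sym (applyUpTo-∷ʳ suc n))) (↭-sym (∷↭∷ʳ (suc n) (range n)))

∈-range⁻ : ∀ {n x} → x ∈ range n → 1 ≤ x × x ≤ n
∈-range⁻ x∈ with ∈-applyUpTo⁻ suc x∈
... | i , i<n , refl = s≤s z≤n , i<n

∈-range⁺ : ∀ {n x} → 1 ≤ x → x ≤ n → x ∈ range n
∈-range⁺ {n} {suc x} _ x<n = ∈-applyUpTo⁺ suc x<n

unique-range : ∀ n → Unique (range n)
unique-range n = Unique.applyUpTo⁺₁ suc n (λ i<j _ eq → ℕ.<⇒≢ i<j (ℕ.suc-injective eq))

perms⇒↭ : ∀ n {π} → π ∈ perms n → π ↭ range n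
perms⇒↭ zero    (here refl) = ↭-refl
perms⇒↭ (suc n) π∈ with find (∈-concatMap⁻ (insertions (suc n)) {perms n} π∈)
... | w , w∈ , π∈ins = ↭-trans (∈-shuffle⇒↭ (suc n ∷ []) w (subst (_ ∈_) (insertions≡shuffle (suc n) w) π∈ins))
  (↭-trans (↭-prep (suc n) (perms⇒↭ n w∈)) (↭-sym (range-suc n)))

range≤ : ∀ n → All (_≤ n) (range n)
range≤ n = All.tabulate (λ x∈ → proj₂ (∈-range⁻ x∈))

segment> : ∀ k m → All (∁ (_≤ k)) (segment k m)
segment> k m = All.applyUpTo⁺₂ _ m (λ i → ℕ.<⇒≱ (s≤s (ℕ.m≤m+n k i)))

perms≤ : ∀ n {π} → π ∈ perms n → All (_≤ n) π
perms≤ n π∈ = All-resp-↭ (↭-sym (perms⇒↭ n π∈)) (range≤ n)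

low high : ℕ → List ℕ → List ℕ
low  k = filter (ℕ._≤? k)
high k = filter (∁? (ℕ._≤? k))

low-range : ∀ k m → low k (range (k ℕ.+ m)) ≡ range k
low-range k m = trans (cong (low k) (range-+ k m)) (trans (filter-++ (ℕ._≤? k) (range k) (segment k m))
  (trans (cong₂ _++_ (filter-all (ℕ._≤? k) (range≤ k)) (filter-none (ℕ._≤? k) (segment> k m))) (++-identityʳ _)))

high-range : ∀ k m → high k (range (k ℕ.+ m)) ≡ segment k m
high-range k m = trans (cong (high k) (range-+ k m)) (trans (filter-++ (∁? (ℕ._≤? k)) (range k) (segment k m))
  (cong₂ _++_ (filter-none (∁? (ℕ._≤? k)) (All.map (λ p q → q p) (range≤ k))) (filter-all (∁? (ℕ._≤? k)) (segment> k m))))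

-- The letters up to n form a rearrangement of [n], the only letter above is n + 1, and
-- `∈-shuffle-filters` puts the two parts back together.
↭⇒perms : ∀ n {π} → π ↭ range n → π ∈ perms n
↭⇒perms zero    p with refl ← ↭-empty-inv p = here refl
↭⇒perms (suc n) {π} p = ∈-concatMap⁺ (insertions (suc n)) {perms n} (lose low∈ π∈ins)
  where
  low≡ : low n (range (suc n)) ≡ range n
  low≡ = trans (cong (low n ∘ range) (sym (ℕ.+-comm n 1))) (low-range n 1)
  high≡ : high n (range (suc n)) ≡ suc n ∷ []
  high≡ = trans (cong (high n ∘ range) (sym (ℕ.+-comm n 1))) (trans (high-range n 1) (cong (λ x → suc x ∷ []) (ℕ.+-identityʳ n)))
  low∈ : low n π ∈ perms n
  low∈ = ↭⇒perms n (↭-trans (filter-↭ (ℕ._≤? n) p) (↭-reflexive low≡))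
  high-π : high n π ≡ suc n ∷ []
  high-π = ↭-singleton-inv (↭-trans (filter-↭ (∁? (ℕ._≤? n)) p) (↭-reflexive high≡))
  π∈ins : π ∈ insertions (suc n) (low n π)
  π∈ins = subst (π ∈_) (trans (cong (λ u → shuffle u (low n π)) high-π) (sym (insertions≡shuffle (suc n) (low n π))))
    (∈-shuffle-filters (ℕ._≤? n) π)

apart-> : ∀ {k u v} → All (∁ (_≤ k)) u → All (_≤ k) v → Apart u v
apart-> u> v≤ x∈ y∈ refl = All.lookup u> x∈ (All.lookup v≤ y∈)

unique-perms : ∀ n → Unique (perms n)
unique-perms zero    = [] ∷ []
unique-perms (suc n) = unique-concatMap (insertions (suc n)) (low n) (unique-perms n)
  (λ {w} w∈ → subst Unique (sym (insertions≡shuffle (suc n) w)) (unique-shuffle (suc n ∷ []) w (apart-> >n (perms≤ n w∈))))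
  (λ {w} w∈ z∈ → proj₂ (shuffle-filters (ℕ._≤? n) (suc n ∷ []) w >n (perms≤ n w∈) (subst (_ ∈_) (insertions≡shuffle (suc n) w) z∈)))
  where
  >n : All (∁ (_≤ n)) (suc n ∷ [])
  >n = ℕ.1+n≰n ∷ []

unique-↭ : ∀ {xs ys : List ℕ} → xs ↭ ys → Unique xs → Unique ys
unique-↭ p = Permutation.Unique-resp-↭ (setoid ℕ) (↭⇒↭ₛ p)

perms-unique : ∀ n {π} → π ∈ perms n → Unique π
perms-unique n {π} π∈ = unique-↭ (↭-sym (perms⇒↭ n π∈)) (unique-range n)

perms-length : ∀ n {π} → π ∈ perms n → length π ≡ n
perms-length n π∈ = trans (↭-length (perms⇒↭ n π∈)) (length-applyUpTo suc n)

-- Inverse permutations and the last letter of the alphabet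

Σsplit-assoc : ∀ (h : Word → Word → Word → ℚ) w →
  Σsplit (λ u v → Σsplit (h u) v) w ≡ Σsplit (λ z v₂ → Σsplit (λ u v₁ → h u v₁ v₂) z) w
Σsplit-assoc h []      = refl
Σsplit-assoc h (x ∷ w) = trans (+-assoc _ _ _) (cong (h [] [] (x ∷ w) +_)
  (trans (cong₂ _+_ refl (Σsplit-assoc (λ u → h (x ∷ u)) w)) (sym (Σsplit-+ _ _ w))))

Σsplit-F[]ʳ : ∀ (h : Word → ℚ) w → Σsplit (λ u v → h u * F [] v) w ≡ h w
Σsplit-F[]ʳ h []      = *-identityʳ _
Σsplit-F[]ʳ h (x ∷ w) = trans (cong₂ _+_ (zeroʳ _) (Σsplit-F[]ʳ (h ∘ (x ∷_)) w)) (+-identityˡ _)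

Σsplit-F[]ˡ : ∀ (h : Word → ℚ) w → Σsplit (λ u v → F [] u * h v) w ≡ h w
Σsplit-F[]ˡ h []      = *-identityˡ _
Σsplit-F[]ˡ h (x ∷ w) = trans (cong₂ _+_ (*-identityˡ _) (trans (Σsplit-*ˡ 0ℚ (λ _ → h) w) (zeroˡ _))) (+-identityʳ _)

F-snoc : ∀ X c w → F (X ++ c ∷ []) w ≡ Σsplit (λ u v → F X u * ι (mono c v)) w
F-snoc []      c w = trans (Σsplit-F[]ʳ (ι ∘ mono c) w) (sym (Σsplit-F[]ˡ (ι ∘ mono c) w))
F-snoc (a ∷ X) c w = begin
  Σsplit (λ u v → ι (mono a u) * F (X ++ c ∷ []) v) w
    ≡⟨ Σsplit-cong w (λ u v → trans (cong (ι (mono a u) *_) (F-snoc X c v))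
         (trans (sym (Σsplit-*ˡ _ _ v)) (Σsplit-cong v (λ v₁ v₂ → sym (*-assoc _ _ _))))) ⟩
  Σsplit (λ u v → Σsplit (λ v₁ v₂ → ι (mono a u) * F X v₁ * ι (mono c v₂)) v) w
    ≡⟨ Σsplit-assoc (λ u v₁ v₂ → ι (mono a u) * F X v₁ * ι (mono c v₂)) w ⟩
  Σsplit (λ z v₂ → Σsplit (λ u v₁ → ι (mono a u) * F X v₁ * ι (mono c v₂)) z) w
    ≡⟨ Σsplit-cong w (λ z v₂ → Σsplit-*ʳ _ _ z) ⟩
  Σsplit (λ z v₂ → F (a ∷ X) z * ι (mono c v₂)) w ∎
  where open ≡-Reasoning

-- Relative order of letters and lists of positions

SameOrder : (ℕ → ℕ) → (ℕ → ℕ) → List ℕ → Set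
SameOrder f g L = ∀ {a b} → a ∈ L → b ∈ L → (f a <ᵇ f b) ≡ (g a <ᵇ g b)

mono-sameOrder : ∀ c f g L → SameOrder f g L → mono c (map f L) ≡ mono c (map g L)
mono-sameOrder c f g []          so = refl
mono-sameOrder c f g (a ∷ [])    so = refl
mono-sameOrder true  f g (a ∷ b ∷ L) so = cong₂ _∧_ (so (here refl) (there (here refl))) (mono-sameOrder true f g (b ∷ L) (λ p q → so (there p) (there q)))
mono-sameOrder false f g (a ∷ b ∷ L) so = cong₂ _∧_ (so (there (here refl)) (here refl)) (mono-sameOrder false f g (b ∷ L) (λ p q → so (there p) (there q)))

Σsplit-map : ∀ h (f : ℕ → ℕ) L → Σsplit h (map f L) ≡ Σsplit (λ u v → h (map f u) (map f v)) L
Σsplit-map h f []      = refl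
Σsplit-map h f (a ∷ L) = cong (h [] (map f (a ∷ L)) +_) (Σsplit-map (λ u → h (f a ∷ u)) f L)

-- `F` only compares letters, so it is constant on words with the same standardisation.
F-sameOrder : ∀ X f g L → SameOrder f g L → F X (map f L) ≡ F X (map g L)
F-sameOrder []      f g []      so = refl
F-sameOrder []      f g (a ∷ L) so = refl
F-sameOrder (c ∷ X) f g L       so = trans (Σsplit-map _ f L) (trans (Σsplit-cong++ L (λ { u v refl →
    cong₂ _*_ (cong ι (mono-sameOrder c f g u (λ p q → so (∈-++⁺ˡ p) (∈-++⁺ˡ q))))
              (F-sameOrder X f g v (λ p q → so (∈-++⁺ʳ u p) (∈-++⁺ʳ u q))) }))
  (sym (Σsplit-map _ g L)))

≡ᵇ-refl : ∀ n → (n ≡ᵇ n) ≡ true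
≡ᵇ-refl zero    = refl
≡ᵇ-refl (suc n) = ≡ᵇ-refl n

≡ᵇ-true : ∀ m n → (m ≡ᵇ n) ≡ true → m ≡ n
≡ᵇ-true m n eq = ℕ.≡ᵇ⇒≡ m n (subst Data.Bool.T (sym eq) _)

≢⇒≡ᵇ-false : ∀ {m n} → m ≢ n → (m ≡ᵇ n) ≡ false
≢⇒≡ᵇ-false {m} {n} m≢n with m ≡ᵇ n in eq
... | true  = contradiction (≡ᵇ-true m n eq) m≢n
... | false = refl

Σ≤-δ : ∀ n c (h : ℕ → ℚ) → c ≤ n → Σ≤ n (λ k → ι (c ≡ᵇ k) * h k) ≡ h c
Σ≤-δ zero    zero    h _ = *-identityˡ _
Σ≤-δ (suc n) c       h c≤ with ℕ.m≤n⇒m<n∨m≡n c≤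
... | inj₁ (s≤s c≤n) = trans (cong₂ _+_ (Σ≤-δ n c h c≤n)
        (trans (cong (λ b → ι b * h (suc n)) (≢⇒≡ᵇ-false (ℕ.<⇒≢ (s≤s c≤n)))) (zeroˡ _))) (+-identityʳ _)
... | inj₂ refl = trans (cong₂ _+_
        (trans (Σ≤-cong n (λ k k≤n → trans (cong (λ b → ι b * h k) (≢⇒≡ᵇ-false (ℕ.<⇒≢ (s≤s k≤n) ∘ sym))) (zeroˡ _))) (Σ≤-0 n))
        (trans (cong (λ b → ι b * h (suc n)) (≡ᵇ-refl n)) (*-identityˡ _))) (+-identityˡ _)

posOf-here : ∀ x w → posOf x (x ∷ w) ≡ 1
posOf-here x w rewrite ≡ᵇ-refl x = refl

posOf-there : ∀ {x a} w → x ≢ a → posOf a (x ∷ w) ≡ suc (posOf a w)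
posOf-there w x≢a rewrite ≢⇒≡ᵇ-false x≢a = refl

posOf-pos : ∀ {a w} → a ∈ w → (0 <ᵇ posOf a w) ≡ true
posOf-pos {a} {x ∷ w} _ with x ≡ᵇ a
... | true  = refl
... | false = refl

posOf≢0 : ∀ {a w} → a ∈ w → posOf a w ≢ 0
posOf≢0 a∈ eq with () ← trans (sym (posOf-pos a∈)) (cong (0 <ᵇ_) eq)

tail-∈ : ∀ {x a : ℕ} {w} → x ≢ a → a ∈ x ∷ w → a ∈ w
tail-∈ x≢a (here refl) = contradiction refl x≢a
tail-∈ x≢a (there a∈)  = a∈

module _ {Q : Pred ℕ 0ℓ} (Q? : Decidable Q) where
  -- Deleting letters shifts positions but keeps their order, which by `F-sameOrder` is all that `F`
  -- sees of an inverse.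
  posOf-filter : ∀ w {a b} → a ∈ w → b ∈ w → Q a → Q b →
    (posOf a w <ᵇ posOf b w) ≡ (posOf a (filter Q? w) <ᵇ posOf b (filter Q? w))
  posOf-filter (x ∷ w) {a} {b} a∈ b∈ Qa Qb with x ℕ.≟ a | x ℕ.≟ b
  ... | yes refl | yes refl rewrite filter-accept Q? {xs = w} Qa | posOf-here x w | posOf-here x (filter Q? w) = refl
  ... | yes refl | no x≢b
    rewrite filter-accept Q? {xs = w} Qa | posOf-here x w | posOf-here x (filter Q? w)
          | posOf-there w x≢b | posOf-there (filter Q? w) x≢b
          | posOf-pos (tail-∈ x≢b b∈) | posOf-pos (∈-filter⁺ Q? (tail-∈ x≢b b∈) Qb) = refl
  ... | no x≢a | yes refl
    rewrite filter-accept Q? {xs = w} Qb | posOf-here x w | posOf-here x (filter Q? w)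
          | posOf-there w x≢a | posOf-there (filter Q? w) x≢a = refl
  ... | no x≢a | no x≢b with Q? x
  ...   | yes _ rewrite posOf-there w x≢a | posOf-there w x≢b | posOf-there (filter Q? w) x≢a | posOf-there (filter Q? w) x≢b =
            posOf-filter w (tail-∈ x≢a a∈) (tail-∈ x≢b b∈) Qa Qb
  ...   | no _ rewrite posOf-there w x≢a | posOf-there w x≢b = posOf-filter w (tail-∈ x≢a a∈) (tail-∈ x≢b b∈) Qa Qb

positions : List ℕ → List ℕ → List ℕ
positions w = map (λ a → posOf a w)

positions-∷ : ∀ c x w L → x ∉ L → mono c (positions (x ∷ w) L) ≡ mono c (positions w L)
positions-∷ c x w L x∉L = mono-sameOrder c (λ a → posOf a (x ∷ w)) (λ a → posOf a w) L
  (λ a∈ b∈ → cong₂ _<ᵇ_ (posOf-there {x} w (λ { refl → x∉L a∈ })) (posOf-there {x} w (λ { refl → x∉L b∈ })))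

positions-self : ∀ {L} → Unique L → mono true (positions L L) ≡ true
positions-self {[]}        _ = refl
positions-self {x ∷ []}    _ = refl
positions-self {x ∷ y ∷ L} u@((x≢y ∷ _) ∷ uL) = cong₂ _∧_
  (trans (cong₂ _<ᵇ_ (posOf-here x (y ∷ L)) (posOf-there (y ∷ L) x≢y)) (posOf-pos {y} {y ∷ L} (here refl)))
  (trans (positions-∷ true x (y ∷ L) (y ∷ L) (Unique[x∷xs]⇒x∉xs u)) (positions-self uL))

all-true : ∀ {A : Set} (p : A → Bool) {xs x} → all p xs ≡ true → x ∈ xs → p x ≡ true
all-true p {y ∷ ys} eq (here refl) = proj₁ (∧-true {p y} eq)
all-true p {y ∷ ys} eq (there x∈)  = all-true p (proj₂ (∧-true {p y} eq)) x∈

-- Each listed element precedes the next one in w, so w cannot start with any but the first of them.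
positions-increasing : ∀ {L} w → Unique L → w ↭ L → mono true (positions w L) ≡ true → w ≡ L
positions-increasing {[]}    w _ p _ = ↭-empty-inv p
positions-increasing {l ∷ L} [] _ p _ = contradiction (sym (↭-length p)) ℕ.1+n≢0
positions-increasing {l ∷ L} (x ∷ w) u@(_ ∷ uL) p eq with x ℕ.≟ l
... | yes refl = cong (x ∷_) (positions-increasing w uL (drop-∷ p)
    (trans (sym (positions-∷ true x w L (Unique[x∷xs]⇒x∉xs u))) (proj₂ (∧-true {all _ (positions (x ∷ w) L)} (trans (sym (mono-∷ true _ (positions (x ∷ w) L))) eq)))))
... | no x≢l = contradiction first λ ()
  where
  x∈L : x ∈ L
  x∈L = tail-∈ (x≢l ∘ sym) (∈-resp-↭ p (here refl))
  first : false ≡ true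
  first = trans (sym (<ᵇ-false {posOf l (x ∷ w)} {posOf x (x ∷ w)} (subst₂ _≤_ (sym (posOf-here x w)) (sym (posOf-there w x≢l)) (s≤s z≤n))))
    (all-true (posOf l (x ∷ w) <ᵇ_) (proj₁ (∧-true {all _ (positions (x ∷ w) L)} (trans (sym (mono-∷ true _ (positions (x ∷ w) L))) eq)))
      (∈-map⁺ (λ a → posOf a (x ∷ w)) x∈L))

mono-snoc : ∀ c w y x → mono c (w ++ y ∷ x ∷ []) ≡ mono c (w ++ y ∷ []) ∧ ok c y x
mono-snoc c []          y x = Bool.∧-identityʳ _
mono-snoc c (a ∷ [])    y x = trans (cong (ok c a y ∧_) (mono-snoc c [] y x)) (sym (Bool.∧-assoc (ok c a y) true (ok c y x)))
mono-snoc c (a ∷ b ∷ w) y x = trans (cong (ok c a b ∧_) (mono-snoc c (b ∷ w) y x)) (sym (Bool.∧-assoc (ok c a b) _ (ok c y x)))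

mono-reverse : ∀ c w → mono c (reverse w) ≡ mono (not c) w
mono-reverse c []          = refl
mono-reverse c (x ∷ [])    = refl
mono-reverse c (x ∷ y ∷ w) = begin
  mono c (reverse (x ∷ y ∷ w))            ≡⟨ cong (mono c) (trans (unfold-reverse x (y ∷ w)) (trans (cong (_∷ʳ x) (unfold-reverse y w)) (++-assoc (reverse w) _ _))) ⟩
  mono c (reverse w ++ y ∷ x ∷ [])        ≡⟨ mono-snoc c (reverse w) y x ⟩
  mono c (reverse w ++ y ∷ []) ∧ ok c y x ≡⟨ cong₂ _∧_ (trans (cong (mono c) (sym (unfold-reverse y w))) (mono-reverse c (y ∷ w))) (ok-not c) ⟩
  mono (not c) (y ∷ w) ∧ ok (not c) x y   ≡⟨ Bool.∧-comm (mono (not c) (y ∷ w)) _ ⟩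
  mono (not c) (x ∷ y ∷ w)                ∎
  where
  open ≡-Reasoning
  ok-not : ∀ c → ok c y x ≡ ok (not c) x y
  ok-not true  = refl
  ok-not false = refl

-- For increasing `L`, the one word on its letters whose positions, read along `L`, are
-- `c`-monotone: positions decrease along `L` exactly when they increase along its reverse.
arrange : Bool → List ℕ → List ℕ
arrange true  L = L
arrange false L = reverse L

arrange-↭ : ∀ c L → arrange c L ↭ L
arrange-↭ true  L = ↭-refl
arrange-↭ false L = ↭-reverse L

mono-arrange : ∀ c L → mono c (arrange c L) ≡ mono true L
mono-arrange true  L = refl
mono-arrange false L = mono-reverse false L

mono-positions-arrange : ∀ c w L → mono c (positions w L) ≡ mono true (positions w (arrange c L))
mono-positions-arrange true  w L = refl
mono-positions-arrange false w L = sym (trans (cong (mono true) (reverse-map _ L)) (mono-reverse true (positions w L)))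

positions-monotone : ∀ c w L → Unique L → w ↭ L → mono c (positions w L) ≡ true → w ≡ arrange c L
positions-monotone c w L u p eq = positions-increasing w (unique-↭ (↭-sym (arrange-↭ c L)) u) (↭-trans p (↭-sym (arrange-↭ c L)))
  (trans (sym (mono-positions-arrange c w L)) eq)

positions-arrange : ∀ c L → Unique L → mono c (positions (arrange c L) L) ≡ true
positions-arrange c L u = trans (mono-positions-arrange c (arrange c L) L) (positions-self (unique-↭ (↭-sym (arrange-↭ c L)) u))

mono-segment : ∀ k m → mono true (segment k m) ≡ true
mono-segment k m = go (λ i → suc (k ℕ.+ i)) m (λ i → <ᵇ-true (s≤s (ℕ.+-monoʳ-< k (ℕ.n<1+n i))))
  where
  go : ∀ f m → (∀ i → (f i <ᵇ f (suc i)) ≡ true) → mono true (applyUpTo f m) ≡ true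
  go f zero          lt = refl
  go f (suc zero)    lt = refl
  go f (suc (suc m)) lt = cong₂ _∧_ (lt 0) (go (f ∘ suc) (suc m) (lt ∘ suc))

unique-segment : ∀ k m → Unique (segment k m)
unique-segment k m = Unique.applyUpTo⁺₁ _ m (λ {i} {j} i<j _ eq → ℕ.<⇒≢ i<j (ℕ.+-cancelˡ-≡ k i j (ℕ.suc-injective eq)))

inv-positions : ∀ n π → length π ≡ n → inv π ≡ positions π (range n)
inv-positions n π refl = cong (positions π) (map-upTo suc (length π))

-- Maps from a monotone word

letter : Bool → PS₁
letter true  = invOneMinusX
letter false = onePlusX

same : Bool → Bool → Bool
same true  c = c
same false c = not c

-- On a `c`-monotone word a letter of sign `c` can take a factor of any length, giving 1/(1-x), and
-- a letter of the other sign at most one position, giving 1+x.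
monotoneSeries : Bool → List Bool → PS₁
monotoneSeries c []      = one₁
monotoneSeries c (a ∷ X) = letter (same a c) ⊛ monotoneSeries c X

-- Each letter contributes 1+x to one of the two series and 1/(1-x) to the other, so its sign
-- disappears from the product.
monotoneSeries-product : ∀ X → monotoneSeries false X ⊛ monotoneSeries true X ≋ r ^ length X
monotoneSeries-product []      = ⊛-identityˡ one₁
monotoneSeries-product (a ∷ X) = PS.trans
  (PS.solve 4 (λ a b c d → (a ⊠ b) ⊠ (c ⊠ d) ≐ (a ⊠ c) ⊠ (b ⊠ d)) PS.refl (letter (same a false)) (monotoneSeries false X) (letter (same a true)) (monotoneSeries true X))
  (⊛-cong (pair a) (monotoneSeries-product X))
  where
  pair : ∀ a → letter (same a false) ⊛ letter (same a true) ≋ r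
  pair true  = PS.refl
  pair false = ⊛-comm invOneMinusX onePlusX

mono-++ : ∀ c u v → mono c (u ++ v) ≡ true → mono c u ≡ true × mono c v ≡ true
mono-++ c []          v eq = refl , eq
mono-++ c (x ∷ [])    v eq = refl , proj₂ (∧-true {all (ok c x) v} (trans (sym (mono-∷ c x v)) eq))
mono-++ c (x ∷ y ∷ u) v eq =
  cong₂ _∧_ (proj₁ (∧-true {ok c x y} eq)) (proj₁ (mono-++ c (y ∷ u) v (proj₂ (∧-true {ok c x y} eq)))) ,
  proj₂ (mono-++ c (y ∷ u) v (proj₂ (∧-true {ok c x y} eq)))

ok-asym : ∀ c x y → ok c x y ≡ true → ok (not c) x y ≡ false
ok-asym true  x y eq = <ᵇ-false (ℕ.<⇒≤ (<ᵇ⇒< x y eq))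
ok-asym false x y eq = <ᵇ-false (ℕ.<⇒≤ (<ᵇ⇒< y x eq))

mono-letter : ∀ a c u → mono c u ≡ true → ι (mono a u) ≡ letter (same a c) (length u)
mono-letter true  true  u eq = cong ι eq
mono-letter false false u eq = cong ι eq
mono-letter true  false []          eq = refl
mono-letter true  false (x ∷ [])    eq = refl
mono-letter true  false (x ∷ y ∷ u) eq = cong (λ b → ι (b ∧ mono true (y ∷ u))) (ok-asym false x y (proj₁ (∧-true {ok false x y} eq)))
mono-letter false true  []          eq = refl
mono-letter false true  (x ∷ [])    eq = refl
mono-letter false true  (x ∷ y ∷ u) eq = cong (λ b → ι (b ∧ mono false (y ∷ u))) (ok-asym true x y (proj₁ (∧-true {ok true x y} eq)))

Σsplit-⊛ : ∀ f g w → Σsplit (λ u v → f (length u) * g (length v)) w ≡ (f ⊛ g) (length w)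
Σsplit-⊛ f g []      = sym (⊛-0 f g)
Σsplit-⊛ f g (x ∷ w) = trans (cong (f 0 * g (suc (length w)) +_) (Σsplit-⊛ (f ∘ suc) g w)) (sym (⊛-sucˡ f g (length w)))

F-monotone : ∀ c X w → mono c w ≡ true → F X w ≡ monotoneSeries c X (length w)
F-monotone c []      []      eq = refl
F-monotone c []      (x ∷ w) eq = refl
F-monotone c (a ∷ X) w       eq = trans (Σsplit-cong++ w (λ { u v refl →
    cong₂ _*_ (mono-letter a c u (proj₁ (mono-++ c u v eq))) (F-monotone c X v (proj₂ (mono-++ c u v eq))) }))
  (Σsplit-⊛ (letter (same a c)) (monotoneSeries c X) w)

Σsplit-take : ∀ h w → Σsplit h w ≡ Σ≤ (length w) (λ k → h (take k w) (drop k w))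
Σsplit-take h []      = refl
Σsplit-take h (x ∷ w) = trans (cong (h [] (x ∷ w) +_) (Σsplit-take (λ u → h (x ∷ u)) w)) (sym (Σ≤-suc (length w) _))

take-drop-++ : ∀ {A : Set} (xs ys : List A) k → length xs ≡ k → take k (xs ++ ys) ≡ xs × drop k (xs ++ ys) ≡ ys
take-drop-++ []       ys zero    eq = refl , refl
take-drop-++ (x ∷ xs) ys (suc k) eq with take-drop-++ xs ys k (ℕ.suc-injective eq)
... | e₁ , e₂ = cong (x ∷_) e₁ , e₂

Σsplit-range : ∀ h (f : ℕ → ℕ) n → Σsplit h (map f (range n)) ≡ Σ≤ n (λ k → h (map f (range k)) (map f (segment k (n ∸ k))))
Σsplit-range h f n = trans (Σsplit-map h f (range n)) (trans (Σsplit-take _ (range n))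
  (trans (cong (λ l → Σ≤ l (λ k → h (map f (take k (range n))) (map f (drop k (range n))))) (length-applyUpTo suc n))
  (Σ≤-cong n (λ k k≤n → cong₂ (λ u v → h (map f u) (map f v)) (proj₁ (cut k k≤n)) (proj₂ (cut k k≤n))))))
  where
  cut : ∀ k → k ≤ n → take k (range n) ≡ range k × drop k (range n) ≡ segment k (n ∸ k)
  cut k k≤n with eq ← range-+ k (n ∸ k) rewrite ℕ.m+[n∸m]≡n k≤n | eq =
    take-drop-++ (range k) (segment k (n ∸ k)) k (length-applyUpTo suc k)

-- The sum over a permutation and its inverse

Φ : List Bool → List Bool → PS₁
Φ X Y n = Σl (perms n) (λ π → F X π * F Y (inv π))

-- The permutations of [k + m] in whose inverse the last m entries are c-monotone are
-- the shuffles of a permutation of [k] with the c-monotone arrangement of k+1, …, k+m.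
module LastBlock (c : Bool) (k m : ℕ) where
  top : List ℕ
  top = arrange c (segment k m)

  monotoneTop : List ℕ → Bool
  monotoneTop w = mono c (positions w (segment k m))

  top> : All (∁ (_≤ k)) top
  top> = All-resp-↭ (↭-sym (arrange-↭ c (segment k m))) (segment> k m)

  low-high : ∀ {u w} → u ∈ perms k → w ∈ shuffle top u → high k w ≡ top × low k w ≡ u
  low-high {u} u∈ w∈ = shuffle-filters (ℕ._≤? k) top u top> (perms≤ k u∈) w∈

  ∈-perms : ∀ {w a} → w ∈ perms (k ℕ.+ m) → a ∈ range (k ℕ.+ m) → a ∈ w
  ∈-perms w∈ a∈ = ∈-resp-↭ (↭-sym (perms⇒↭ (k ℕ.+ m) w∈)) a∈

  segment∈ : ∀ {w a} → w ∈ perms (k ℕ.+ m) → a ∈ segment k m → a ∈ w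
  segment∈ w∈ a∈ = ∈-perms w∈ (subst (_ ∈_) (sym (range-+ k m)) (∈-++⁺ʳ (range k) a∈))

  range∈ : ∀ {w a} → w ∈ perms (k ℕ.+ m) → a ∈ range k → a ∈ w
  range∈ w∈ a∈ = ∈-perms w∈ (subst (_ ∈_) (sym (range-+ k m)) (∈-++⁺ˡ a∈))

  monotoneTop-high : ∀ {w} → w ∈ perms (k ℕ.+ m) → monotoneTop w ≡ mono c (positions (high k w) (segment k m))
  monotoneTop-high {w} w∈ = mono-sameOrder c _ _ (segment k m) (λ a∈ b∈ →
    posOf-filter (∁? (ℕ._≤? k)) w (segment∈ w∈ a∈) (segment∈ w∈ b∈) (All.lookup (segment> k m) a∈) (All.lookup (segment> k m) b∈))

  low-perms : ∀ {w} → w ∈ perms (k ℕ.+ m) → low k w ∈ perms k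
  low-perms w∈ = ↭⇒perms k (↭-trans (filter-↭ (ℕ._≤? k) (perms⇒↭ (k ℕ.+ m) w∈)) (↭-reflexive (low-range k m)))

  high-↭ : ∀ {w} → w ∈ perms (k ℕ.+ m) → high k w ↭ segment k m
  high-↭ w∈ = ↭-trans (filter-↭ (∁? (ℕ._≤? k)) (perms⇒↭ (k ℕ.+ m) w∈)) (↭-reflexive (high-range k m))

  perms-monotoneTop : filterᵇ monotoneTop (perms (k ℕ.+ m)) ↭ concatMap (shuffle top) (perms k)
  perms-monotoneTop = unique-≐⇒↭ (unique-filterᵇ monotoneTop (unique-perms (k ℕ.+ m)))
    (unique-concatMap (shuffle top) (low k) (unique-perms k)
      (λ {u} u∈ → unique-shuffle top u (apart-> top> (perms≤ k u∈)))
      (λ u∈ w∈ → proj₂ (low-high u∈ w∈)))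
    to from
    where
    to : filterᵇ monotoneTop (perms (k ℕ.+ m)) ⊆ concatMap (shuffle top) (perms k)
    to {w} w∈ᶠ with ∈-filterᵇ⁻ monotoneTop (perms (k ℕ.+ m)) w∈ᶠ
    ... | w∈ , mt = ∈-concatMap⁺ (shuffle top) (lose (low-perms w∈) (subst (λ u → w ∈ shuffle u (low k w)) high≡top (∈-shuffle-filters (ℕ._≤? k) w)))
      where
      high≡top : high k w ≡ top
      high≡top = positions-monotone c (high k w) (segment k m) (unique-segment k m) (high-↭ w∈) (trans (sym (monotoneTop-high w∈)) mt)
    from : concatMap (shuffle top) (perms k) ⊆ filterᵇ monotoneTop (perms (k ℕ.+ m))
    from {w} w∈ᶜ with find (∈-concatMap⁻ (shuffle top) {perms k} w∈ᶜ)
    ... | u , u∈ , w∈ˢ = ∈-filterᵇ⁺ monotoneTop (perms (k ℕ.+ m)) w∈ (trans (monotoneTop-high w∈)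
        (trans (cong (λ h → mono c (positions h (segment k m))) (proj₁ (low-high u∈ w∈ˢ))) (positions-arrange c (segment k m) (unique-segment k m))))
      where
      w∈ : w ∈ perms (k ℕ.+ m)
      w∈ = ↭⇒perms (k ℕ.+ m) (↭-trans (∈-shuffle⇒↭ top u w∈ˢ) (↭-trans (++⁺ʳ u (arrange-↭ c (segment k m)))
        (↭-trans (++-comm (segment k m) u) (↭-trans (++⁺ʳ (segment k m) (perms⇒↭ k u∈)) (↭-reflexive (sym (range-+ k m)))))))

  F-low : ∀ Y {w} → w ∈ perms (k ℕ.+ m) → F Y (positions w (range k)) ≡ F Y (inv (low k w))
  F-low Y {w} w∈ = trans (F-sameOrder Y _ _ (range k) (λ a∈ b∈ →
      posOf-filter (ℕ._≤? k) w (range∈ w∈ a∈) (range∈ w∈ b∈) (All.lookup (range≤ k) a∈) (All.lookup (range≤ k) b∈)))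
    (cong (F Y) (sym (inv-positions k (low k w) (perms-length k (low-perms w∈)))))

  F-top : ∀ X → F X top ≡ monotoneSeries c X m
  F-top X = trans (F-monotone c X top (trans (mono-arrange c (segment k m)) (mono-segment k m)))
    (cong (monotoneSeries c X) (trans (↭-length (arrange-↭ c (segment k m))) (length-applyUpTo _ m)))

  -- On the shuffles of `top` with a fixed `u`, the factor belonging to `Y` is constant, because it
  -- depends on the low letters only. The sum over these shuffles therefore concerns `F X` alone and
  -- factors by `F-shuffle`.
  sum : ∀ X Y → Σl (perms (k ℕ.+ m)) (λ π → F X π * (F Y (positions π (range k)) * ι (mono c (positions π (segment k m)))))
    ≡ Φ X Y k * monotoneSeries c X m
  sum X Y = begin
    Σl (perms (k ℕ.+ m)) (λ π → F X π * (F Y (positions π (range k)) * ι (monotoneTop π)))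
      ≡⟨ Σl-cong∈ (perms (k ℕ.+ m)) (λ {π} π∈ → trans (cong (λ z → F X π * (z * ι (monotoneTop π))) (F-low Y π∈))
           (solve 3 (λ a b c → a :* (b :* c) := c :* (a :* b)) refl (F X π) (F Y (inv (low k π))) (ι (monotoneTop π)))) ⟩
    Σl (perms (k ℕ.+ m)) (λ π → ι (monotoneTop π) * (F X π * F Y (inv (low k π))))
      ≡⟨ Σl-filterᵇ monotoneTop (perms (k ℕ.+ m)) _ ⟨
    Σl (filterᵇ monotoneTop (perms (k ℕ.+ m))) (λ π → F X π * F Y (inv (low k π)))
      ≡⟨ Σl-↭ _ perms-monotoneTop ⟩
    Σl (concatMap (shuffle top) (perms k)) (λ π → F X π * F Y (inv (low k π)))
      ≡⟨ Σl-concatMap (shuffle top) (perms k) _ ⟩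
    Σl (perms k) (λ u → Σl (shuffle top u) (λ π → F X π * F Y (inv (low k π))))
      ≡⟨ Σl-cong∈ (perms k) (λ {u} u∈ → trans (Σl-cong∈ (shuffle top u) (λ {w} w∈ → cong (λ z → F X w * F Y (inv z)) (proj₂ (low-high u∈ w∈))))
           (trans (Σl-*ʳ (shuffle top u) _ _) (trans (cong (_* F Y (inv u)) (trans (F-shuffle X top u (apart-> top> (perms≤ k u∈))) (cong (_* F X u) (F-top X))))
           (solve 3 (λ a b c → a :* b :* c := (b :* c) :* a) refl (monotoneSeries c X m) (F X u) (F Y (inv u)))))) ⟩
    Σl (perms k) (λ u → (F X u * F Y (inv u)) * monotoneSeries c X m)
      ≡⟨ Σl-*ʳ (perms k) _ _ ⟩
    Φ X Y k * monotoneSeries c X m ∎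
    where open ≡-Reasoning

-- The last letter `c` takes a suffix of the inverse, namely the positions of the values k+1, ...,
-- n. Summing over k is a convolution.
Φ-snoc : ∀ X Y c → Φ X (Y ++ c ∷ []) ≋ Φ X Y ⊛ monotoneSeries c X
Φ-snoc X Y c .at n = begin
  Σl (perms n) (λ π → F X π * F (Y ++ c ∷ []) (inv π))
    ≡⟨ Σl-cong∈ (perms n) (λ {π} π∈ → trans (cong (F X π *_) (trans (cong (F (Y ++ c ∷ [])) (inv-positions n π (perms-length n π∈)))
         (trans (F-snoc Y c (positions π (range n))) (Σsplit-range _ (λ a → posOf a π) n)))) (sym (Σ≤-*ˡ n _ _))) ⟩
  Σl (perms n) (λ π → Σ≤ n (λ k → term π k (n ∸ k)))
    ≡⟨ Σl-Σ≤ (perms n) n (λ π k → term π k (n ∸ k)) ⟩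
  Σ≤ n (λ k → Σl (perms n) (λ π → term π k (n ∸ k)))
    ≡⟨ Σ≤-cong n (λ k k≤n → trans (cong (λ l → Σl (perms l) (λ π → term π k (n ∸ k))) (sym (ℕ.m+[n∸m]≡n k≤n))) (LastBlock.sum c k (n ∸ k) X Y)) ⟩
  Σ≤ n (λ k → Φ X Y k * monotoneSeries c X (n ∸ k))
    ≡⟨ ⊛-at _ _ n ⟨
  (Φ X Y ⊛ monotoneSeries c X) n ∎
  where
  open ≡-Reasoning
  term : List ℕ → ℕ → ℕ → ℚ
  term π k m = F X π * (F Y (positions π (range k)) * ι (mono c (positions π (segment k m))))

Φ-[] : ∀ X → Φ X [] ≋ one₁
Φ-[] X .at zero    = trans (+-identityʳ _) (trans (*-identityʳ _) (F-[] X))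
Φ-[] X .at (suc n) = trans (Σl-cong∈ (perms (suc n)) (λ {π} π∈ →
    trans (cong (λ w → F X π * F [] w) (inv-positions (suc n) π (perms-length (suc n) π∈))) (zeroʳ _)))
  (Σl-0 (perms (suc n)))

Φ-alt : ∀ X j → Φ X (alt j) ≋ r ^ (length X ℕ.* j)
Φ-alt X zero    = PS.trans (Φ-[] X) (PS.reflexive (cong (r ^_) (sym (ℕ.*-zeroʳ (length X)))))
Φ-alt X (suc j) = begin
  Φ X (alt (suc j))                                          ≈⟨ PS.reflexive (cong (Φ X) (alt-snoc j)) ⟩
  Φ X ((alt j ++ false ∷ []) ++ true ∷ [])                   ≈⟨ Φ-snoc X (alt j ++ false ∷ []) true ⟩
  Φ X (alt j ++ false ∷ []) ⊛ monotoneSeries true X          ≈⟨ ⊛-cong (Φ-snoc X (alt j) false) PS.refl ⟩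
  Φ X (alt j) ⊛ monotoneSeries false X ⊛ monotoneSeries true X  ≈⟨ ⊛-assoc _ _ _ ⟩
  Φ X (alt j) ⊛ (monotoneSeries false X ⊛ monotoneSeries true X) ≈⟨ ⊛-cong (Φ-alt X j) (monotoneSeries-product X) ⟩
  r ^ (length X ℕ.* j) ⊛ r ^ length X                        ≈⟨ PS.trans (⊛-comm _ _) (PS.sym (^-+ r (length X) _)) ⟩
  r ^ (length X ℕ.+ length X ℕ.* j)                          ≈⟨ PS.reflexive (cong (r ^_) (sym (ℕ.*-suc (length X) j))) ⟩
  r ^ (length X ℕ.* suc j)                                   ∎
  where open ≋-Reasoning

F-singleton : ∀ X x → F X (x ∷ []) ≡ nat (length X)
F-singleton []      x = sym nat-0
F-singleton (c ∷ X) x = trans (F-∷ c X x []) (trans (+-comm _ _) (trans (cong₂ _+_ (F₁-[] c X x) (F-singleton X x)) (sym (nat-suc (length X)))))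

-- Inserting n + 1 everywhere is a shuffle with a one-letter word, on which `F X` is |X|. Each new
-- value thus multiplies the sum by |X|, whatever the signs.
ΣF-perms : ∀ X n → Σl (perms n) (F X) ≡ nat (length X ℕ.^ n)
ΣF-perms X zero    = trans (+-identityʳ _) (trans (F-[] X) (sym nat-1))
ΣF-perms X (suc n) = begin
  Σl (concatMap (insertions (suc n)) (perms n)) (F X)
    ≡⟨ Σl-concatMap (insertions (suc n)) (perms n) (F X) ⟩
  Σl (perms n) (λ w → Σl (insertions (suc n) w) (F X))
    ≡⟨ Σl-cong∈ (perms n) (λ {w} w∈ → trans (cong (λ ws → Σl ws (F X)) (insertions≡shuffle (suc n) w))
         (trans (F-shuffle X (suc n ∷ []) w (apart-> (ℕ.1+n≰n ∷ []) (perms≤ n w∈))) (cong (_* F X w) (F-singleton X (suc n))))) ⟩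
  Σl (perms n) (λ w → nat (length X) * F X w)
    ≡⟨ Σl-*ˡ (perms n) _ _ ⟩
  nat (length X) * Σl (perms n) (F X)
    ≡⟨ cong (nat (length X) *_) (ΣF-perms X n) ⟩
  nat (length X) * nat (length X ℕ.^ n)
    ≡⟨ nat-* (length X) _ ⟨
  nat (length X ℕ.^ suc n) ∎
  where open ≡-Reasoning

-- Series in two variables

infixl 7 _⊗_
_⊗_ : PS₁ → PS₁ → PS₂
(f ⊗ g) i j = f i * g j

*₂-at : ∀ F G i j → (F *₂ G) i j ≡ Σ≤ i (λ a → Σ≤ j (λ b → F a b * G (i ∸ a) (j ∸ b)))
*₂-at F G i j = trans (sumTo-def i _) (Σ≤-cong i (λ a _ → trans (sumTo-def j _) (Σ≤-cong j (λ b _ → *-def _ _))))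

*₂-cong : ∀ {F F' G G'} → F ≋₂ F' → G ≋₂ G' → (F *₂ G) ≋₂ (F' *₂ G')
*₂-cong {F} {F'} {G} {G'} p q i j = trans (*₂-at F G i j) (trans (Σ≤-cong i (λ a _ → Σ≤-cong j (λ b _ → cong₂ _*_ (p a b) (q _ _))))
  (sym (*₂-at F' G' i j)))

≋₂-trans : ∀ {F G H} → F ≋₂ G → G ≋₂ H → F ≋₂ H
≋₂-trans p q i j = trans (p i j) (q i j)

⊗-cong : ∀ {f f' g g'} → f ≋ f' → g ≋ g' → (f ⊗ g) ≋₂ (f' ⊗ g')
⊗-cong p q i j = cong₂ _*_ (at p i) (at q j)

⊗-*₂ : ∀ f g f' g' → ((f ⊗ g) *₂ (f' ⊗ g')) ≋₂ ((f ⊛ f') ⊗ (g ⊛ g'))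
⊗-*₂ f g f' g' i j = begin
  ((f ⊗ g) *₂ (f' ⊗ g')) i j
    ≡⟨ *₂-at (f ⊗ g) (f' ⊗ g') i j ⟩
  Σ≤ i (λ a → Σ≤ j (λ b → (f a * g b) * (f' (i ∸ a) * g' (j ∸ b))))
    ≡⟨ Σ≤-cong i (λ a _ → trans (Σ≤-cong j (λ b _ → solve 4 (λ x y z w → (x :* y) :* (z :* w) := (x :* z) :* (y :* w)) refl (f a) (g b) (f' (i ∸ a)) (g' (j ∸ b))))
         (Σ≤-*ˡ j _ _)) ⟩
  Σ≤ i (λ a → (f a * f' (i ∸ a)) * Σ≤ j (λ b → g b * g' (j ∸ b)))
    ≡⟨ Σ≤-*ʳ i _ _ ⟩
  Σ≤ i (λ a → f a * f' (i ∸ a)) * Σ≤ j (λ b → g b * g' (j ∸ b))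
    ≡⟨ cong₂ _*_ (⊛-at f f' i) (⊛-at g g' j) ⟨
  (f ⊛ f') i * (g ⊛ g') j ∎
  where open ≡-Reasoning

inS-⊗ : ∀ {f f'} → f ≋ f' → inS f ≋₂ (f' ⊗ one₁)
inS-⊗ p i zero    = trans (at p i) (sym (*-identityʳ _))
inS-⊗ p i (suc j) = sym (zeroʳ _)

inT-⊗ : ∀ {f f'} → f ≋ f' → inT f ≋₂ (one₁ ⊗ f')
inT-⊗ p zero    j = trans (at p j) (sym (*-identityˡ _))
inT-⊗ p (suc i) j = sym (zeroˡ _)

one₂-⊗ : one₂ ≋₂ (one₁ ⊗ one₁)
one₂-⊗ zero    zero    = sym (*-identityˡ _)
one₂-⊗ zero    (suc j) = sym (zeroʳ _)
one₂-⊗ (suc i) zero    = sym (zeroˡ _)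
one₂-⊗ (suc i) (suc j) = sym (zeroˡ _)

pow₂-⊗ : ∀ {F f g} m → F ≋₂ (f ⊗ g) → pow₂ F m ≋₂ ((f ^ m) ⊗ (g ^ m))
pow₂-⊗ zero    p = one₂-⊗
pow₂-⊗ (suc m) p = ≋₂-trans (*₂-cong p (pow₂-⊗ m p)) (⊗-*₂ _ _ _ _)

inS-inT : ∀ {f f' g g'} → f ≋ f' → g ≋ g' → (inS f *₂ inT g) ≋₂ (f' ⊗ g')
inS-inT p q = ≋₂-trans (*₂-cong (inS-⊗ p) (inT-⊗ q)) (≋₂-trans (⊗-*₂ _ _ _ _)
  (⊗-cong (PS.trans (⊛-comm _ one₁) (⊛-identityˡ _)) (⊛-identityˡ _)))

Σl₂ : {A : Set} → List A → (A → PS₂) → PS₂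
Σl₂ xs h i j = Σl xs (λ x → h x i j)

sumList₂-def : ∀ {A : Set} (h : A → PS₂) xs → sumList₂ h xs ≋₂ Σl₂ xs h
sumList₂-def h []       i j = refl
sumList₂-def h (x ∷ xs) i j = trans (+-def _ _) (cong (h x i j +_) (sumList₂-def h xs i j))

Σl₂-cong : ∀ {A : Set} (xs : List A) {h h'} → (∀ x → h x ≋₂ h' x) → Σl₂ xs h ≋₂ Σl₂ xs h'
Σl₂-cong xs p i j = Σl-cong xs (λ x → p x i j)

*₂-Σl₂ : ∀ {A : Set} (xs : List A) F (h : A → PS₂) → (F *₂ Σl₂ xs h) ≋₂ Σl₂ xs (λ x → F *₂ h x)
*₂-Σl₂ xs F h i j = begin
  (F *₂ Σl₂ xs h) i j
    ≡⟨ *₂-at F (Σl₂ xs h) i j ⟩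
  Σ≤ i (λ a → Σ≤ j (λ b → F a b * Σl xs (λ x → h x (i ∸ a) (j ∸ b))))
    ≡⟨ Σ≤-cong i (λ a _ → trans (Σ≤-cong j (λ b _ → sym (Σl-*ˡ xs _ _)))
         (sym (Σl-Σ≤ xs j (λ x b → F a b * h x (i ∸ a) (j ∸ b))))) ⟩
  Σ≤ i (λ a → Σl xs (λ x → Σ≤ j (λ b → F a b * h x (i ∸ a) (j ∸ b))))
    ≡⟨ sym (Σl-Σ≤ xs i (λ x a → Σ≤ j (λ b → F a b * h x (i ∸ a) (j ∸ b)))) ⟩
  Σl xs (λ x → Σ≤ i (λ a → Σ≤ j (λ b → F a b * h x (i ∸ a) (j ∸ b))))
    ≡⟨ Σl-cong xs (λ x → sym (*₂-at F (h x) i j)) ⟩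
  Σl₂ xs (λ x → F *₂ h x) i j ∎
  where open ≡-Reasoning

⊗-Σl₂ : ∀ {A : Set} (xs : List A) f g {F G} (a b : A → PS₁) → F ≋₂ (f ⊗ g) → G ≋₂ Σl₂ xs (λ x → a x ⊗ b x) →
  (F *₂ G) ≋₂ Σl₂ xs (λ x → (f ⊛ a x) ⊗ (g ⊛ b x))
⊗-Σl₂ xs f g a b p q = ≋₂-trans (*₂-cong p q) (≋₂-trans (*₂-Σl₂ xs (f ⊗ g) (λ x → a x ⊗ b x)) (Σl₂-cong xs (λ x → ⊗-*₂ f g (a x) (b x))))

-- The two-sided series

leftSeries rightSeries : ℕ → List ℕ → PS₁
leftSeries  n π = onePlusX ^ n ⊛ (invOneMinusX ^ suc n ⊛ q ^ lpk π)
rightSeries n π = onePlusX ^ suc n ⊛ (invOneMinusX ^ suc n ⊛ q ^ suc (ipk π))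

-- For one permutation every factor is a series in s times a series in t, so the prefactors can be
-- distributed over the sum and multiplied variable by variable.
Fser-expand : ∀ n → Fser n ≋₂ Σl₂ (perms n) (λ π → leftSeries n π ⊗ rightSeries n π)
Fser-expand n = ⊗-Σl₂ (perms n) _ _ _ _ (inS-inT (pow₁-def n PS.refl) (pow₁-def (suc n) PS.refl))
  (⊗-Σl₂ (perms n) _ _ _ _ (inS-inT (pow₁-def (suc n) PS.refl) (pow₁-def (suc n) PS.refl))
    (≋₂-trans (sumList₂-def _ (perms n)) (Σl₂-cong (perms n) (λ π →
      ≋₂-trans (*₂-cong (pow₂-⊗ (lpk π) (inS-⊗ fourYOver≋q)) (pow₂-⊗ (suc (ipk π)) (inT-⊗ fourYOver≋q)))
      (≋₂-trans (⊗-*₂ _ _ _ _) (⊗-cong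
        (PS.trans (⊛-cong PS.refl (one-^ (suc (ipk π)))) (PS.trans (⊛-comm _ one₁) (⊛-identityˡ _)))
        (PS.trans (⊛-cong (one-^ (lpk π)) PS.refl) (⊛-identityˡ _))))))))

posOf-injective : ∀ w {a b} → a ∈ w → b ∈ w → posOf a w ≡ posOf b w → a ≡ b
posOf-injective (x ∷ w) {a} {b} a∈ b∈ eq with x ℕ.≟ a | x ℕ.≟ b
... | yes refl | yes refl = refl
... | yes refl | no x≢b = contradiction (ℕ.suc-injective (trans (sym (posOf-there w x≢b)) (trans (sym eq) (posOf-here x w)))) (posOf≢0 (tail-∈ x≢b b∈))
... | no x≢a | yes refl = contradiction (ℕ.suc-injective (trans (sym (posOf-there w x≢a)) (trans eq (posOf-here x w)))) (posOf≢0 (tail-∈ x≢a a∈))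
... | no x≢a | no x≢b = posOf-injective w (tail-∈ x≢a a∈) (tail-∈ x≢b b∈)
  (ℕ.suc-injective (trans (sym (posOf-there w x≢a)) (trans eq (posOf-there w x≢b))))

unique-map : ∀ {A B : Set} (f : A → B) {xs} → (∀ {a b} → a ∈ xs → b ∈ xs → f a ≡ f b → a ≡ b) → Unique xs → Unique (map f xs)
unique-map f inj []       = []
unique-map f inj (p ∷ u) = All.map⁺ (All.tabulate (λ b∈ eq → All.lookup p b∈ (inj (here refl) (there b∈) eq)))
  ∷ unique-map f (λ p q → inj (there p) (there q)) u

inv-unique : ∀ n {π} → π ∈ perms n → Unique (inv π)
inv-unique n {π} π∈ = subst Unique (sym (inv-positions n π (perms-length n π∈)))
  (unique-map _ (λ a∈ b∈ → posOf-injective π (∈π a∈) (∈π b∈)) (unique-range n))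
  where
  ∈π : ∀ {a} → a ∈ range n → a ∈ π
  ∈π = ∈-resp-↭ (↭-sym (perms⇒↭ n π∈))

inv-length : ∀ n {π} → π ∈ perms n → length (inv π) ≡ n
inv-length n {π} π∈ = trans (cong length (inv-positions n π (perms-length n π∈))) (trans (length-map _ (range n)) (length-applyUpTo suc n))

leftSeries-F : ∀ n π → length π ≡ suc n → Unique π → leftSeries (suc n) π ≋ (λ i → F (true ∷ alt i) π)
leftSeries-F n π@(x ∷ w) refl u rewrite lpk≡lpkʳ π = left-enriched-series x w u

rightSeries-F : ∀ n π → length (inv π) ≡ suc n → Unique (inv π) → rightSeries (suc n) π ≋ (one₁ ⊕ one₁) ⊛ (λ j → F (alt j) (inv π))
rightSeries-F n π len u rewrite pk≡pkʳ (inv π) = go (inv π) len u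
  where
  go : ∀ σ → length σ ≡ suc n → Unique σ →
    onePlusX ^ suc (suc n) ⊛ (invOneMinusX ^ suc (suc n) ⊛ q ^ suc (pkʳ σ)) ≋ (one₁ ⊕ one₁) ⊛ (λ j → F (alt j) σ)
  go (x ∷ w) refl u = enriched-series x w u

2⊛ : ∀ f k → ((one₁ ⊕ one₁) ⊛ f) k ≡ nat 2 * f k
2⊛ f k = trans (at (PS.solve 1 (λ f → (κ 1 ⊞ κ 1) ⊠ f ≐ f ⊞ f) PS.refl f) k) (trans (⊕-at f f k)
  (trans (sym (trans (*-distribʳ-+ (f k) 1ℚ 1ℚ) (cong₂ _+_ (*-identityˡ _) (*-identityˡ _))))
    (cong (_* f k) (trans (cong₂ _+_ (sym nat-1) (sym nat-1)) (sym (nat-+ 1 1))))))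

length-alt : ∀ i → length (alt i) ≡ 2 ℕ.* i
length-alt zero    = refl
length-alt (suc i) = trans (cong (2 ℕ.+_) (length-alt i)) (sym (ℕ.*-suc 2 i))

-- The common value behind all three parts. The 2 comes from `enriched-series`, and the exponent is
-- |X| j with X = +(-+)^i of length 2i + 1.
Fser≡r^ : ∀ n i j → Fser (suc n) i j ≡ nat 2 * (r ^ (2 ℕ.* i ℕ.* j ℕ.+ j)) (suc n)
Fser≡r^ n i j = begin
  Fser (suc n) i j
    ≡⟨ Fser-expand (suc n) i j ⟩
  Σl (perms (suc n)) (λ π → leftSeries (suc n) π i * rightSeries (suc n) π j)
    ≡⟨ Σl-cong∈ (perms (suc n)) (λ {π} π∈ → trans (cong₂ _*_
         (at (leftSeries-F n π (perms-length (suc n) π∈) (perms-unique (suc n) π∈)) i)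
         (trans (at (rightSeries-F n π (inv-length (suc n) π∈) (inv-unique (suc n) π∈)) j) (2⊛ _ j)))
         (solve 3 (λ a t b → a :* (t :* b) := t :* (a :* b)) refl (F (true ∷ alt i) π) (nat 2) (F (alt j) (inv π)))) ⟩
  Σl (perms (suc n)) (λ π → nat 2 * (F (true ∷ alt i) π * F (alt j) (inv π)))
    ≡⟨ Σl-*ˡ (perms (suc n)) _ _ ⟩
  nat 2 * Φ (true ∷ alt i) (alt j) (suc n)
    ≡⟨ cong (nat 2 *_) (at (Φ-alt (true ∷ alt i) j) (suc n)) ⟩
  nat 2 * (r ^ (suc (length (alt i)) ℕ.* j)) (suc n)
    ≡⟨ cong (λ l → nat 2 * (r ^ l) (suc n)) (trans (cong (λ l → suc l ℕ.* j) (length-alt i)) (ℕ.+-comm j (2 ℕ.* i ℕ.* j))) ⟩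
  nat 2 * (r ^ (2 ℕ.* i ℕ.* j ℕ.+ j)) (suc n) ∎
  where open ≡-Reasoning

part-a : ∀ n i j → LHSa n i j ≡ RHSa n i j
-- Every coefficient of 1/((1-s)(1-t)) is 1, and so is the constant term of every power of `r`.
part-a zero i j = trans (+-def _ _) (trans (cong₂ _+_ (trans (inS-inT {invOneMinusX} PS.refl PS.refl i j) (*-identityˡ 1ℚ)) refl)
  (trans (+-identityʳ 1ℚ) (sym (trans (at (pow₁-def (2 ℕ.* i ℕ.* j ℕ.+ j) (mk≋ (*₁-def onePlusX invOneMinusX))) 0) (r^-0 (2 ℕ.* i ℕ.* j ℕ.+ j))))))
part-a (suc n) i j = begin
  0ℚ ℚ.+ ½ ℚ.* Fser (suc n) i j            ≡⟨ trans (+-def _ _) (trans (+-identityˡ _) (*-def _ _)) ⟩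
  ½ * Fser (suc n) i j                     ≡⟨ cong (½ *_) (Fser≡r^ n i j) ⟩
  ½ * (nat 2 * R (suc n))                  ≡⟨ *-assoc _ _ _ ⟨
  ½ * nat 2 * R (suc n)                    ≡⟨ cong (_* R (suc n)) (trans (cong (½ *_) (sym (nat-def 2))) (sym (*-def ½ (ℕ→ℚ 2)))) ⟩
  1ℚ * R (suc n)                           ≡⟨ *-identityˡ _ ⟩
  R (suc n)                                ≡⟨ at (pow₁-def (2 ℕ.* i ℕ.* j ℕ.+ j) (mk≋ (*₁-def onePlusX invOneMinusX))) (suc n) ⟨
  RHSa (suc n) i j                         ∎
  where
  open ≡-Reasoning
  R = r ^ (2 ℕ.* i ℕ.* j ℕ.+ j)

part-b : ∀ n → n ℕ.≥ 1 → Fser n ≋₂ RHSb n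
part-b (suc n) _ i j = trans (Fser≡r^ n i j) (sym (trans (*-def _ _) (cong₂ _*_ (nat-def 2)
  (trans (sumTo-def (suc n) _) (trans (Σ≤-cong (suc n) (λ k _ → nat-def _)) (sym (r^-coefficients (2 ℕ.* i ℕ.* j ℕ.+ j) (suc n))))))))

-- Eulerian polynomials

Beul-series : ∀ k → (Beul k *₁ pow₁ invOneMinusX (suc k)) ≋ (λ m → nat (suc (2 ℕ.* m) ℕ.^ k))
Beul-series k = begin
  Beul k *₁ pow₁ invOneMinusX (suc k)    ≈⟨ *₁-cong (*₁-cong (pow₁-def (suc k) PS.refl) (mk≋ (λ m → nat-def _))) (pow₁-def (suc k) PS.refl) ⟩
  o ⊛ p ⊛ g                              ≈⟨ PS.solve 3 (λ o p g → o ⊠ p ⊠ g ≐ (o ⊠ g) ⊠ p) PS.refl o p g ⟩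
  o ⊛ g ⊛ p                              ≈⟨ ⊛-cong (PS.trans (PS.sym (^-⊛ oneMinusX invOneMinusX (suc k))) (PS.trans (^-cong (suc k) oneMinusX⊛g) (one-^ (suc k)))) PS.refl ⟩
  one₁ ⊛ p                               ≈⟨ ⊛-identityˡ p ⟩
  p                                      ∎
  where
  open ≋-Reasoning
  o g p : PS₁
  o = oneMinusX ^ suc k
  g = invOneMinusX ^ suc k
  p m = nat (suc (2 ℕ.* m) ℕ.^ k)

nat-length-filterᵇ : ∀ {A : Set} (p : A → Bool) xs → nat (length (filterᵇ p xs)) ≡ Σl xs (ι ∘ p)
nat-length-filterᵇ p []       = nat-0
nat-length-filterᵇ p (x ∷ xs) = trans (cong nat (length-filterᵇ-∷ p x xs)) (trans (nat-+ (bit (p x)) _) (cong₂ _+_ (nat-bit (p x)) (nat-length-filterᵇ p xs)))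
  where
  nat-bit : ∀ b → nat (bit b) ≡ ι b
  nat-bit true  = nat-1
  nat-bit false = nat-0

X^-coefficients : ∀ a m → (X₁ ^ a) m ≡ ι (a ≡ᵇ m)
X^-coefficients zero    zero    = refl
X^-coefficients zero    (suc m) = refl
X^-coefficients (suc a) zero    = X⊛-0 _
X^-coefficients (suc a) (suc m) = trans (X⊛-suc _ m) (X^-coefficients a m)

Σl-⊛ : ∀ {A : Set} (xs : List A) (h : A → PS₁) f k → ((λ m → Σl xs (λ x → h x m)) ⊛ f) k ≡ Σl xs (λ x → (h x ⊛ f) k)
Σl-⊛ xs h f k = trans (⊛-at _ f k) (trans (Σ≤-cong k (λ a _ → sym (Σl-*ʳ xs _ _)))
  (trans (sym (Σl-Σ≤ xs k (λ x a → h x a * f (k ∸ a)))) (Σl-cong xs (λ x → sym (⊛-at (h x) f k)))))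

-- For k = 0 this is 1/(1-t), in agreement with 0^0 = 1. Otherwise each permutation contributes its
-- `descent-series`, and these add up by `ΣF-perms`.
Aeul-series : ∀ k → (Aeul k *₁ pow₁ invOneMinusX (suc k)) ≋ (λ j → nat (j ℕ.^ k))
Aeul-series zero = PS.trans (*₁-cong PS.refl (pow₁-def 1 PS.refl)) (PS.trans (PS.solve 1 (λ g → κ 1 ⊠ (g ⊠ κ 1) ≐ g) PS.refl invOneMinusX)
  (mk≋ (λ j → sym nat-1)))
Aeul-series (suc k) .at j = begin
  (Aeul (suc k) *₁ pow₁ invOneMinusX (suc (suc k))) j
    ≡⟨ at (*₁-cong (mk≋ (λ m → trans (nat-def _) (trans (nat-length-filterᵇ _ (perms (suc k))) (Σl-cong (perms (suc k)) (λ π → sym (X^-coefficients (suc (des π)) m))))))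
             (pow₁-def (suc (suc k)) PS.refl)) j ⟩
  ((λ m → Σl (perms (suc k)) (λ π → (X₁ ^ suc (des π)) m)) ⊛ invOneMinusX ^ suc (suc k)) j
    ≡⟨ Σl-⊛ (perms (suc k)) (λ π → X₁ ^ suc (des π)) _ j ⟩
  Σl (perms (suc k)) (λ π → (X₁ ^ suc (des π) ⊛ invOneMinusX ^ suc (suc k)) j)
    ≡⟨ Σl-cong∈ (perms (suc k)) (λ {π} π∈ → descents π (perms-length (suc k) π∈) (perms-unique (suc k) π∈)) ⟩
  Σl (perms (suc k)) (F (replicate j true))
    ≡⟨ ΣF-perms (replicate j true) (suc k) ⟩
  nat (length (replicate j true) ℕ.^ suc k)
    ≡⟨ cong (λ l → nat (l ℕ.^ suc k)) (length-replicate j) ⟩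
  nat (j ℕ.^ suc k) ∎
  where
  open ≡-Reasoning
  descents : ∀ π → length π ≡ suc k → Unique π → (X₁ ^ suc (des π) ⊛ invOneMinusX ^ suc (suc k)) j ≡ F (replicate j true) π
  descents π@(x ∷ w) refl u rewrite des≡desʳ π = sym (at (descent-series x w u) j)

-- Boolean quantifiers

bool-iff : ∀ {a b} → (a ≡ true → b ≡ true) → (b ≡ true → a ≡ true) → a ≡ b
bool-iff {true}  {b}     p q = sym (p refl)
bool-iff {false} {true}  p q = q refl
bool-iff {false} {false} p q = refl

module _ {A : Set} where
  any-true⁻ : ∀ (p : A → Bool) xs → any p xs ≡ true → ∃ λ x → x ∈ xs × p x ≡ true
  any-true⁻ p (x ∷ xs) eq with p x in px
  ... | true  = x , here refl , px
  ... | false with any-true⁻ p xs eq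
  ...   | y , y∈ , py = y , there y∈ , py

  any-true⁺ : ∀ (p : A → Bool) {xs x} → x ∈ xs → p x ≡ true → any p xs ≡ true
  any-true⁺ p {x ∷ xs} (here refl) px rewrite px = refl
  any-true⁺ p {y ∷ xs} (there x∈)  px = trans (cong (p y ∨_) (any-true⁺ p x∈ px)) (Bool.∨-zeroʳ (p y))

  any-↭ : ∀ (p : A → Bool) {xs ys} → xs ↭ ys → any p xs ≡ any p ys
  any-↭ p {xs} {ys} xs↭ys = bool-iff (to xs↭ys) (to (↭-sym xs↭ys))
    where
    to : ∀ {xs ys} → xs ↭ ys → any p xs ≡ true → any p ys ≡ true
    to {xs} xs↭ys eq with any-true⁻ p xs eq
    ... | x , x∈ , px = any-true⁺ p (∈-resp-↭ xs↭ys x∈) px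

  any-cong∈ : ∀ {p p' : A → Bool} xs → (∀ {x} → x ∈ xs → p x ≡ p' x) → any p xs ≡ any p' xs
  any-cong∈ []       eq = refl
  any-cong∈ (x ∷ xs) eq = cong₂ _∨_ (eq (here refl)) (any-cong∈ xs (eq ∘ there))

  any-none : ∀ {p : A → Bool} xs → (∀ {x} → x ∈ xs → p x ≡ false) → any p xs ≡ false
  any-none []       eq = refl
  any-none (x ∷ xs) eq = cong₂ _∨_ (eq (here refl)) (any-none xs (eq ∘ there))

  all-true⁺ : ∀ {p : A → Bool} xs → (∀ {x} → x ∈ xs → p x ≡ true) → all p xs ≡ true
  all-true⁺ []       eq = refl
  all-true⁺ (x ∷ xs) eq = cong₂ _∧_ (eq (here refl)) (all-true⁺ xs (eq ∘ there))

  all-cong∈ : ∀ {p p' : A → Bool} xs → (∀ {x} → x ∈ xs → p x ≡ p' x) → all p xs ≡ all p' xs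
  all-cong∈ []       eq = refl
  all-cong∈ (x ∷ xs) eq = cong₂ _∧_ (eq (here refl)) (all-cong∈ xs (eq ∘ there))

  all-absorb : ∀ (p : A → Bool) {xs x} → x ∈ xs → (p x ∧ all p xs) ≡ all p xs
  all-absorb p {xs} {x} x∈ = bool-iff (proj₂ ∘ ∧-true {p x}) (λ eq → cong₂ _∧_ (all-true p eq x∈) eq)

  all-↭ : ∀ (p : A → Bool) {xs ys} → xs ↭ ys → all p xs ≡ all p ys
  all-↭ p xs↭ys = bool-iff (λ eq → all-true⁺ _ (λ y∈ → all-true p eq (∈-resp-↭ (↭-sym xs↭ys) y∈)))
                           (λ eq → all-true⁺ _ (λ x∈ → all-true p eq (∈-resp-↭ xs↭ys x∈)))

  foldr-∧ : ∀ (p : A → Bool) xs → foldr (λ x b → b ∧ p x) true xs ≡ all p xs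
  foldr-∧ p []       = refl
  foldr-∧ p (x ∷ xs) = trans (cong (_∧ p x) (foldr-∧ p xs)) (Bool.∧-comm (all p xs) (p x))

all-map : ∀ {A B : Set} (p : B → Bool) (f : A → B) xs → all p (map f xs) ≡ all (p ∘ f) xs
all-map p f []       = refl
all-map p f (x ∷ xs) = cong (p (f x) ∧_) (all-map p f xs)

any-map : ∀ {A B : Set} (p : B → Bool) (f : A → B) xs → any p (map f xs) ≡ any (p ∘ f) xs
any-map p f []       = refl
any-map p f (x ∷ xs) = cong (p (f x) ∨_) (any-map p f xs)

count-cong∈ : ∀ {p p'} xs → (∀ {x} → x ∈ xs → p x ≡ p' x) → count p xs ≡ count p' xs
count-cong∈ []       eq = refl
count-cong∈ {p} {p'} (x ∷ xs) eq = trans (length-filterᵇ-∷ p x xs) (trans (cong₂ (λ b c → bit b ℕ.+ c) (eq (here refl)) (count-cong∈ xs (eq ∘ there)))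
  (sym (length-filterᵇ-∷ p' x xs)))

count-map : ∀ p (f : ℕ → ℕ) xs → count p (map f xs) ≡ count (p ∘ f) xs
count-map p f []       = refl
count-map p f (x ∷ xs) = trans (length-filterᵇ-∷ p (f x) (map f xs)) (trans (cong (bit (p (f x)) ℕ.+_) (count-map p f xs)) (sym (length-filterᵇ-∷ (p ∘ f) x xs)))

count-↭ : ∀ p {xs ys} → xs ↭ ys → count p xs ≡ count p ys
count-↭ p xs↭ys = ↭-length (filter-↭ _ xs↭ys)

-- Permutations as functions

InR : ℕ → ℕ → Set
InR n i = 1 ≤ i × i ≤ n

-- An injective self-map of the finite set [n] is bijective. Values outside [n] are left free, so
-- that `app π`, which is 0 there, fits.
record IsPerm (n : ℕ) (f : ℕ → ℕ) : Set where
  field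
    maps : ∀ {i} → InR n i → InR n (f i)
    inj  : ∀ {i j} → InR n i → InR n j → f i ≡ f j → i ≡ j
open IsPerm

tab : ℕ → (ℕ → ℕ) → List ℕ
tab n f = map f (range n)

app-applyUpTo : ∀ (f : ℕ → ℕ) n i → i < n → app (applyUpTo f n) (suc i) ≡ f i
app-applyUpTo f (suc n) zero    _         = refl
app-applyUpTo f (suc n) (suc i) (s≤s i<n) = app-applyUpTo (f ∘ suc) n i i<n

app-tab : ∀ n f {i} → InR n i → app (tab n f) i ≡ f i
app-tab n f {suc i} (_ , i<n) = trans (cong (λ w → app w (suc i)) (map-applyUpTo suc f n)) (app-applyUpTo (f ∘ suc) n i i<n)

tab-app : ∀ w → tab (length w) (app w) ≡ w
tab-app w = trans (map-applyUpTo suc (app w) (length w)) (go w)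
  where
  go : ∀ w → applyUpTo (λ i → app w (suc i)) (length w) ≡ w
  go []      = refl
  go (x ∷ w) = cong (x ∷_) (go w)

tab-cong : ∀ n {f g} → (∀ {i} → InR n i → f i ≡ g i) → tab n f ≡ tab n g
tab-cong n eq = map-cong-local (All.tabulate (λ i∈ → eq (∈-range⁻ i∈)))

app-∈ : ∀ w {i} → InR (length w) i → app w i ∈ w
app-∈ (x ∷ w) {suc zero}    _             = here refl
app-∈ (x ∷ w) {suc (suc i)} (_ , s≤s i≤l) = there (app-∈ w (s≤s z≤n , i≤l))

app-injective : ∀ {w i j} → Unique w → InR (length w) i → InR (length w) j → app w i ≡ app w j → i ≡ j
app-injective {x ∷ w} {suc zero}    {suc zero}    _ _ _ _ = refl
app-injective {x ∷ w} {suc zero}    {suc (suc j)} (x∉ ∷ _) _ (_ , s≤s j≤) eq = contradiction eq (All.lookup x∉ (app-∈ w (s≤s z≤n , j≤)))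
app-injective {x ∷ w} {suc (suc i)} {suc zero}    (x∉ ∷ _) (_ , s≤s i≤) _ eq = contradiction (sym eq) (All.lookup x∉ (app-∈ w (s≤s z≤n , i≤)))
app-injective {x ∷ w} {suc (suc i)} {suc (suc j)} (_ ∷ u) (_ , s≤s i≤) (_ , s≤s j≤) eq = cong suc (app-injective u (s≤s z≤n , i≤) (s≤s z≤n , j≤) eq)

perms⇒IsPerm : ∀ n {π} → π ∈ perms n → IsPerm n (app π)
perms⇒IsPerm n {π} π∈ with refl ← perms-length n π∈ = record
  { maps = λ ir → ∈-range⁻ (∈-resp-↭ (perms⇒↭ n π∈) (app-∈ π ir))
  ; inj  = app-injective (perms-unique n π∈) }

IsPerm⇒perms : ∀ n {f} → IsPerm n f → tab n f ∈ perms n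
IsPerm⇒perms n {f} pf = ↭⇒perms n (unique-⊆⇒↭
  (unique-map f (λ a∈ b∈ → inj pf (∈-range⁻ a∈) (∈-range⁻ b∈)) (unique-range n))
  (λ x∈ → image (∈-map⁻ f x∈))
  (ℕ.≤-reflexive (sym (length-map f (range n)))))
  where
  image : ∀ {x} → (∃ λ a → a ∈ range n × x ≡ f a) → x ∈ range n
  image (a , a∈ , refl) = let (l , u) = maps pf (∈-range⁻ a∈) in ∈-range⁺ l u

tab-perms : ∀ n {π} → π ∈ perms n → tab n (app π) ≡ π
tab-perms n {π} π∈ with refl ← perms-length n π∈ = tab-app π

app-posOf : ∀ w {a} → a ∈ w → app w (posOf a w) ≡ a × InR (length w) (posOf a w)
app-posOf (x ∷ w) {a} a∈ with x ℕ.≟ a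
... | yes refl rewrite posOf-here x w = refl , s≤s z≤n , s≤s z≤n
... | no x≢a rewrite posOf-there w x≢a with posOf a w | app-posOf w (tail-∈ x≢a a∈)
...   | suc p | eq , (_ , p≤) = eq , s≤s z≤n , s≤s p≤

Σl-range-const : ∀ n c {h} → (∀ {i} → InR n i → h i ≡ c) → Σl (range n) h ≡ nat n * c
Σl-range-const n c eq = trans (Σl-cong∈ (range n) (λ i∈ → eq (∈-range⁻ i∈))) (trans (Σl-const (range n) c)
  (cong (λ l → nat l * c) (length-applyUpTo suc n)))

-- Orbits

it : (ℕ → ℕ) → ℕ → ℕ → ℕ
it f zero    i = i
it f (suc m) i = f (it f m i)

iter≡it : ∀ π m i → iter π m i ≡ it (app π) m i
iter≡it π zero    i = refl
iter≡it π (suc m) i = cong (app π) (iter≡it π m i)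

it-+ : ∀ f a b i → it f (a ℕ.+ b) i ≡ it f a (it f b i)
it-+ f zero    b i = refl
it-+ f (suc a) b i = cong f (it-+ f a b i)

it-* : ∀ f a b i → it f b i ≡ i → it f (a ℕ.* b) i ≡ i
it-* f zero    b i eq = refl
it-* f (suc a) b i eq = trans (it-+ f b (a ℕ.* b) i) (trans (cong (it f b) (it-* f a b i eq)) eq)

module _ {n f} (pf : IsPerm n f) where
  it-InR : ∀ m {i} → InR n i → InR n (it f m i)
  it-InR zero    ir = ir
  it-InR (suc m) ir = maps pf (it-InR m ir)

  it-cancel : ∀ a {i j} → InR n i → InR n j → it f a i ≡ it f a j → i ≡ j
  it-cancel zero    ir jr eq = eq
  it-cancel (suc a) ir jr eq = it-cancel a ir jr (inj pf (it-InR a ir) (it-InR a jr) eq)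

  -- Two equal iterates a < b give a return after b - a steps.
  it-return : ∀ {a b i} → InR n i → a < b → it f a i ≡ it f b i → it f (b ∸ a) i ≡ i
  it-return {a} {b} {i} ir a<b eq = sym (it-cancel a ir (it-InR (b ∸ a) ir)
    (trans eq (trans (cong (λ c → it f c i) (sym (ℕ.m+[n∸m]≡n (ℕ.<⇒≤ a<b)))) (it-+ f a (b ∸ a) i))))

  -- Pigeonhole: the n + 1 iterates of exponent 0, ..., n lie in [n], so two of them coincide, and
  -- `it-return` turns this into a return.
  return : ∀ {i} → InR n i → ∃ λ l → l < n × it f (suc l) i ≡ i
  return {i} ir with ℕ.anyUpTo? (λ l → it f (suc l) i ℕ.≟ i) n
  ... | yes p = p
  ... | no ¬p = contradiction (unique-⊆⇒length≤ orbit-unique orbit-⊆) (subst₂ _≰_ (sym (length-applyUpTo (λ m → it f m i) (suc n))) (sym (length-applyUpTo suc n)) ℕ.1+n≰n)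
    where
    orbit : List ℕ
    orbit = applyUpTo (λ m → it f m i) (suc n)
    orbit-unique : Unique orbit
    orbit-unique = Unique.applyUpTo⁺₁ _ (suc n) (λ {a} {b} a<b b≤n eq → ¬p (pred (b ∸ a) , bound a<b b≤n , subst (λ c → it f c i ≡ i) (sym (suc-pred-∸ a<b)) (it-return ir a<b eq)))
      where
      suc-pred-∸ : ∀ {a b} → a < b → suc (pred (b ∸ a)) ≡ b ∸ a
      suc-pred-∸ a<b = ℕ.suc-pred _ {{ℕ.>-nonZero (ℕ.m<n⇒0<n∸m a<b)}}
      bound : ∀ {a b} → a < b → b < suc n → pred (b ∸ a) < n
      bound {a} {b} a<b (s≤s b≤n) = subst (_≤ n) (sym (suc-pred-∸ a<b)) (ℕ.≤-trans (ℕ.m∸n≤m b a) b≤n)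
    orbit-⊆ : orbit ⊆ range n
    orbit-⊆ x∈ with ∈-applyUpTo⁻ (λ m → it f m i) x∈
    ... | m , _ , refl = let (l , u) = it-InR m ir in ∈-range⁺ l u

Reach : (ℕ → ℕ) → ℕ → ℕ → Set
Reach f i j = ∃ λ m → it f m i ≡ j

reach-trans : ∀ {f i j k} → Reach f i j → Reach f j k → Reach f i k
reach-trans {f} {i} (a , refl) (b , refl) = b ℕ.+ a , it-+ f b a i

-- The exponent is reduced modulo a return time. This bounds the search in `Rb` and makes
-- reachability symmetric.
reach-reduce : ∀ {f i j l} → it f (suc l) i ≡ i → Reach f i j → ∃ λ m → m < suc l × it f m i ≡ j
reach-reduce {f} {i} {j} {l} ret (m , eq) = m % suc l , m%n<n m (suc l) , trans (sym mod) eq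
  where
  mod : it f m i ≡ it f (m % suc l) i
  mod = trans (cong (λ c → it f c i) (m≡m%n+[m/n]*n m (suc l))) (trans (it-+ f (m % suc l) (m / suc l ℕ.* suc l) i)
    (cong (it f (m % suc l)) (it-* f (m / suc l) (suc l) i ret)))

-- Whether j lies in the f-cycle of i.
Rb : (ℕ → ℕ) → ℕ → ℕ → ℕ → Bool
Rb f n i j = any (λ m → it f m i ≡ᵇ j) (upTo n)

Rb-sound : ∀ f n i j → Rb f n i j ≡ true → ∃ λ m → m < n × it f m i ≡ j
Rb-sound f n i j eq with any-true⁻ (λ m → it f m i ≡ᵇ j) (upTo n) eq
... | m , m∈ , eq' = m , ∈-upTo⁻ m∈ , ≡ᵇ-true _ _ eq'

Rb-cong : ∀ f g n i j → (∀ m → it f m i ≡ it g m i) → Rb f n i j ≡ Rb g n i j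
Rb-cong f g n i j eq = any-cong∈ (upTo n) (λ {m} _ → cong (_≡ᵇ j) (eq m))

module _ {n f} (pf : IsPerm n f) where
  Rb-complete : ∀ {i j} → InR n i → Reach f i j → Rb f n i j ≡ true
  Rb-complete {i} {j} ir p with return pf ir
  ... | l , l<n , ret with reach-reduce ret p
  ...   | m , m<l , refl = any-true⁺ (λ m → it f m i ≡ᵇ j) (∈-upTo⁺ (ℕ.<-≤-trans m<l l<n)) (≡ᵇ-refl (it f m i))

  Rb⇒Reach : ∀ {i j} → Rb f n i j ≡ true → Reach f i j
  Rb⇒Reach {i} {j} eq with Rb-sound f n i j eq
  ... | m , _ , p = m , p

  reach-sym : ∀ {i j} → InR n i → Reach f i j → Reach f j i
  reach-sym {i} ir p with return pf ir
  ... | l , _ , ret with reach-reduce ret p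
  ...   | m , m<l , refl = suc l ∸ m , trans (sym (it-+ f (suc l ∸ m) m i)) (trans (cong (λ c → it f c i) (ℕ.m∸n+n≡m (ℕ.<⇒≤ m<l))) ret)

  Rb-refl : ∀ {i} → InR n i → Rb f n i i ≡ true
  Rb-refl ir = Rb-complete ir (0 , refl)

  Rb-sym : ∀ {i j} → InR n i → InR n j → Rb f n i j ≡ Rb f n j i
  Rb-sym ir jr = bool-iff (λ eq → Rb-complete jr (reach-sym ir (Rb⇒Reach eq))) (λ eq → Rb-complete ir (reach-sym jr (Rb⇒Reach eq)))

  Rb-trans : ∀ {i j k} → InR n i → Rb f n i j ≡ true → Rb f n j k ≡ true → Rb f n i k ≡ true
  Rb-trans ir p q = Rb-complete ir (reach-trans (Rb⇒Reach p) (Rb⇒Reach q))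

-- Decreasing order puts the newest element at the head, for induction on n, and makes the last
-- representative of a class its minimum.
desc : ℕ → List ℕ
desc = applyDownFrom suc

desc-↭ : ∀ n → desc n ↭ range n
desc-↭ n = ↭-trans (↭-reflexive (sym (reverse-applyUpTo suc n))) (↭-reverse (range n))

∈-desc⁻ : ∀ {n x} → x ∈ desc n → InR n x
∈-desc⁻ {n} x∈ = ∈-range⁻ (∈-resp-↭ (desc-↭ n) x∈)

∈-desc⁺ : ∀ {n x} → InR n x → x ∈ desc n
∈-desc⁺ {n} (l , u) = ∈-resp-↭ (↭-sym (desc-↭ n)) (∈-range⁺ l u)

-- Counts the last representative of each class of B in the list.
classes : (ℕ → ℕ → Bool) → List ℕ → ℕ
classes B []       = 0
classes B (x ∷ xs) = bit (not (any (B x) xs)) ℕ.+ classes B xs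

classes-cong∈ : ∀ {B B'} xs → (∀ {i j} → i ∈ xs → j ∈ xs → B i j ≡ B' i j) → classes B xs ≡ classes B' xs
classes-cong∈ []       eq = refl
classes-cong∈ (x ∷ xs) eq = cong₂ ℕ._+_ (cong (bit ∘ not) (any-cong∈ xs (λ j∈ → eq (here refl) (there j∈))))
  (classes-cong∈ xs (λ p q → eq (there p) (there q)))

classes-map : ∀ B (τ : ℕ → ℕ) xs → classes B (map τ xs) ≡ classes (λ i j → B (τ i) (τ j)) xs
classes-map B τ []       = refl
classes-map B τ (x ∷ xs) = cong₂ ℕ._+_ (cong (bit ∘ not) (any-map (B (τ x)) τ xs)) (classes-map B τ xs)

module Classes {n f} (pf : IsPerm n f) where
  private
    B : ℕ → ℕ → Bool
    B = Rb f n

  any-related : ∀ {x y} xs → All (InR n) (x ∷ y ∷ xs) → B x y ≡ true → any (B x) xs ≡ any (B y) xs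
  any-related {x} {y} xs (xr ∷ yr ∷ xsr) xy = any-cong∈ xs (λ z∈ → bool-iff
    (Rb-trans pf yr (trans (Rb-sym pf yr xr) xy))
    (Rb-trans pf xr xy))

  -- Unrelated neighbours contribute independently of each other. Of two related ones only the later
  -- can count, and it counts under the same condition whichever it is.
  classes-swap : ∀ x y xs → All (InR n) (x ∷ y ∷ xs) → classes B (x ∷ y ∷ xs) ≡ classes B (y ∷ x ∷ xs)
  classes-swap x y xs rs@(xr ∷ yr ∷ _) with B x y in xy | B y x in yx
  ... | true  | false with () ← trans (sym xy) (trans (Rb-sym pf xr yr) yx)
  ... | false | true  with () ← trans (sym xy) (trans (Rb-sym pf xr yr) yx)
  ... | true  | true  = cong (λ b → bit (not b) ℕ.+ classes B xs) (sym (any-related xs rs xy))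
  ... | false | false = trans (sym (ℕ.+-assoc (bit (not (any (B x) xs))) _ _)) (trans (cong (ℕ._+ classes B xs) (ℕ.+-comm (bit (not (any (B x) xs))) _))
          (ℕ.+-assoc (bit (not (any (B y) xs))) _ _))

  classes-↭ : ∀ {xs ys} → xs ↭ ys → All (InR n) xs → classes B xs ≡ classes B ys
  classes-↭ _↭_.refl rs = refl
  classes-↭ (_↭_.prep x p) (xr ∷ rs) = cong₂ ℕ._+_ (cong (bit ∘ not) (any-↭ (B x) p)) (classes-↭ p rs)
  classes-↭ (_↭_.swap x y p) rs@(xr ∷ yr ∷ rs') = trans (classes-swap x y _ rs)
    (cong₂ ℕ._+_ (cong (bit ∘ not) (any-↭ (B y) (↭-prep x p))) (cong₂ ℕ._+_ (cong (bit ∘ not) (any-↭ (B x) p)) (classes-↭ p rs')))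
  classes-↭ (_↭_.trans p q) rs = trans (classes-↭ p rs) (classes-↭ q (All-resp-↭ p rs))

-- The statistics of Defs in terms of the relation "in the same cycle"

module Stats {n π} (π∈ : π ∈ perms n) where
  private
    f : ℕ → ℕ
    f = app π
    pf : IsPerm n f
    pf = perms⇒IsPerm n π∈
    B : ℕ → ℕ → Bool
    B = Rb f n
    len : length π ≡ n
    len = perms-length n π∈

  -- A return time `l` within reach of the fuel guarantees that the search stops at the least return
  -- time from `m` on. Minimality is what makes the listed orbit free of repetition.
  cycLenFrom-spec : ∀ i m fuel l → m ≤ l → l < m ℕ.+ fuel → it f l i ≡ i → ∃ λ k → cycLenFrom π i m fuel ≡ k × m ≤ k × k ≤ l × it f k i ≡ i
    × (∀ j → m ≤ j → j < k → it f j i ≢ i)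
  cycLenFrom-spec i m zero l m≤l l< _ = contradiction (subst (l <_) (ℕ.+-identityʳ m) l<) (ℕ.≤⇒≯ m≤l)
  cycLenFrom-spec i m (suc fuel) l m≤l l< ret with iter π m i ≡ᵇ i in eq
  ... | true  = m , refl , ℕ.≤-refl , m≤l , trans (sym (iter≡it π m i)) (≡ᵇ-true _ _ eq) , λ j m≤j j<m → contradiction j<m (ℕ.≤⇒≯ m≤j)
  ... | false with cycLenFrom-spec i (suc m) fuel l (ℕ.≤∧≢⇒< m≤l m≢l) (subst (l <_) (ℕ.+-suc m fuel) l<) ret
    where
    m≢l : m ≢ l
    m≢l refl with () ← trans (sym eq) (trans (cong (_≡ᵇ i) (trans (iter≡it π m i) ret)) (≡ᵇ-refl i))
  ...   | k , eq' , m<k , k≤l , retk , min = k , eq' , ℕ.<⇒≤ m<k , k≤l , retk , min'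
    where
    min' : ∀ j → m ≤ j → j < k → it f j i ≢ i
    min' j m≤j j<k with ℕ.m≤n⇒m<n∨m≡n m≤j
    ... | inj₁ m<j  = min j m<j j<k
    ... | inj₂ refl = λ ret' → contradiction (trans (sym eq) (trans (cong (_≡ᵇ i) (trans (iter≡it π m i) ret')) (≡ᵇ-refl i))) λ ()

  cycLen≡ : ∀ {i} → InR n i → cycLen π i ≡ count (B i) (desc n)
  cycLen≡ {i} ir with return pf ir
  ... | l , l<n , ret with cycLenFrom-spec i 1 (length π) (suc l) (s≤s z≤n) (s≤s (subst (suc l ≤_) (sym len) l<n)) ret
  ...   | suc k , eq , _ , k≤l , retk , min = trans eq (trans (sym (length-applyUpTo (λ m → it f m i) (suc k)))
            (↭-length (unique-≐⇒↭ orbit-unique (unique-filterᵇ (B i) (unique-↭ (↭-sym (desc-↭ n)) (unique-range n))) to from)))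
    where
    orbit : List ℕ
    orbit = applyUpTo (λ m → it f m i) (suc k)
    orbit-unique : Unique orbit
    orbit-unique = Unique.applyUpTo⁺₁ (λ m → it f m i) (suc k) (λ {a} {b} a<b b<k e →
      min (b ∸ a) (ℕ.m<n⇒0<n∸m a<b) (ℕ.≤-<-trans (ℕ.m∸n≤m b a) b<k) (it-return pf ir a<b e))
    to : orbit ⊆ filterᵇ (B i) (desc n)
    to x∈ with ∈-applyUpTo⁻ (λ m → it f m i) x∈
    ... | m , _ , refl = ∈-filterᵇ⁺ (B i) (desc n) (∈-desc⁺ (it-InR pf m ir)) (Rb-complete pf ir (m , refl))
    from : filterᵇ (B i) (desc n) ⊆ orbit
    from {x} x∈ with ∈-filterᵇ⁻ (B i) (desc n) x∈
    ... | _ , rel with reach-reduce retk (Rb⇒Reach pf rel)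
    ...   | m , m<k , refl = ∈-applyUpTo⁺ (λ m → it f m i) m<k

  idx≡range : idx π ≡ range n
  idx≡range = trans (map-upTo suc (length π)) (cong range len)

  allOddCycles≡ : allOddCycles π ≡ all (λ i → isOdd (count (B i) (desc n))) (desc n)
  allOddCycles≡ = trans (cong (foldr (λ i b → b ∧ isOdd (cycLen π i)) true) idx≡range)
    (trans (foldr-∧ (λ i → isOdd (cycLen π i)) (range n)) (trans (sym (all-↭ _ (desc-↭ n)))
    (all-cong∈ (desc n) (λ i∈ → cong isOdd (cycLen≡ (∈-desc⁻ i∈))))))

  -- The elements below `suc i` are exactly `desc i`, so a cycle minimum is what `classes` counts at
  -- the entry `suc i`.
  isCycMin≡ : ∀ {i} → InR n (suc i) → isCycMin π (suc i) ≡ not (any (B (suc i)) (desc i))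
  isCycMin≡ {i} ir = trans (foldr-∧ P (upTo (length π))) (trans (cong (λ l → all P (upTo l)) len) go)
    where
    P : ℕ → Bool
    P m = (suc i ≡ᵇ iter π m (suc i)) ∨ (suc i <ᵇ iter π m (suc i))
    P-true : ∀ m → suc i ≤ it f m (suc i) → P m ≡ true
    P-true m i≤ rewrite iter≡it π m (suc i) with ℕ.m≤n⇒m<n∨m≡n i≤
    ... | inj₁ lt = trans (cong ((suc i ≡ᵇ it f m (suc i)) ∨_) (<ᵇ-true lt)) (Bool.∨-zeroʳ _)
    ... | inj₂ eq = cong (_∨ (suc i <ᵇ it f m (suc i))) (trans (cong (suc i ≡ᵇ_) (sym eq)) (≡ᵇ-refl (suc i)))
    P-false : ∀ m → it f m (suc i) < suc i → P m ≡ false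
    P-false m lt rewrite iter≡it π m (suc i) = cong₂ _∨_ (≢⇒≡ᵇ-false (ℕ.<⇒≢ lt ∘ sym)) (<ᵇ-false (ℕ.<⇒≤ lt))
    go : all P (upTo n) ≡ not (any (B (suc i)) (desc i))
    go with any (B (suc i)) (desc i) in eq
    ... | false = all-true⁺ (upTo n) (λ {m} _ → P-true m (ℕ.≮⇒≥ (λ lt → contradiction
          (trans (sym eq) (any-true⁺ (B (suc i)) (∈-desc⁺ (proj₁ (it-InR pf m ir) , ℕ.≤-pred lt)) (Rb-complete pf ir (m , refl)))) λ ())))
    ... | true with any-true⁻ (B (suc i)) (desc i) eq
    ...   | j , j∈ , rel with Rb-sound f n (suc i) j rel
    ...     | m , m<n , refl with all P (upTo n) in eq'
    ...       | false = refl
    ...       | true with () ← trans (sym (all-true P eq' (∈-upTo⁺ m<n))) (P-false m (s≤s (proj₂ (∈-desc⁻ j∈))))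

  cyc≡ : cyc π ≡ classes B (desc n)
  cyc≡ = trans (cong (count (isCycMin π)) idx≡range) (trans (sym (count-↭ (isCycMin π) (desc-↭ n))) (go n ℕ.≤-refl))
    where
    go : ∀ k → k ≤ n → count (isCycMin π) (desc k) ≡ classes B (desc k)
    go zero    _   = refl
    go (suc k) k<n = trans (length-filterᵇ-∷ (isCycMin π) (suc k) (desc k))
      (cong₂ (λ b c → bit b ℕ.+ c) (isCycMin≡ (s≤s z≤n , k<n)) (go k (ℕ.<⇒≤ k<n)))

  cyc≤n : cyc π ≤ n
  cyc≤n = subst (cyc π ≤_) (trans (cong length idx≡range) (length-applyUpTo suc n)) (length-filter _ (idx π))

-- Adding the largest element as a fixed point, or into a cycle just after i

fixf : ℕ → (ℕ → ℕ) → ℕ → ℕ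
fixf n f j = if j ≡ᵇ suc n then suc n else f j

insf : ℕ → ℕ → (ℕ → ℕ) → ℕ → ℕ
insf n i f j = if j ≡ᵇ suc n then f i else (if j ≡ᵇ i then suc n else f j)

if-≡ : ∀ {A : Set} m {x y : A} → (if m ≡ᵇ m then x else y) ≡ x
if-≡ m rewrite ≡ᵇ-refl m = refl

if-≢ : ∀ {A : Set} {m n} {x y : A} → m ≢ n → (if m ≡ᵇ n then x else y) ≡ y
if-≢ m≢n rewrite ≢⇒≡ᵇ-false m≢n = refl

InR-suc : ∀ {n j} → InR n j → InR (suc n) j
InR-suc (l , u) = l , ℕ.m≤n⇒m≤1+n u

InR-top : ∀ n → InR (suc n) (suc n)
InR-top n = s≤s z≤n , ℕ.≤-refl

InR≢ : ∀ {n j} → InR n j → j ≢ suc n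
InR≢ (_ , u) refl = ℕ.1+n≰n u

InR-pred : ∀ {n j} → InR (suc n) j → j ≢ suc n → InR n j
InR-pred (l , u) j≢ = l , ℕ.≤-pred (ℕ.≤∧≢⇒< u j≢)

data View (n : ℕ) : ℕ → Set where
  new : View n (suc n)
  old : ∀ {j} → InR n j → View n j

view : ∀ {n j} → InR (suc n) j → View n j
view {n} {j} jr with j ℕ.≟ suc n
... | yes refl = new
... | no j≢    = old (InR-pred jr j≢)

module FixPoint {n f} (pf : IsPerm n f) where
  private s = fixf n f

  s-top : s (suc n) ≡ suc n
  s-top = if-≡ (suc n)

  s-low : ∀ {j} → InR n j → s j ≡ f j
  s-low jr = if-≢ (InR≢ jr)

  isPerm : IsPerm (suc n) s
  isPerm = record { maps = λ ir → m (view ir) ; inj = λ ir jr → i (view ir) (view jr) }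
    where
    m : ∀ {j} → View n j → InR (suc n) (s j)
    m new      rewrite s-top = InR-top n
    m (old jr) rewrite s-low jr = InR-suc (maps pf jr)
    i : ∀ {j k} → View n j → View n k → s j ≡ s k → j ≡ k
    i new      new      eq = refl
    i new      (old kr) eq = contradiction (sym (trans (sym s-top) (trans eq (s-low kr)))) (InR≢ (maps pf kr))
    i (old jr) new      eq = contradiction (trans (sym (s-low jr)) (trans eq s-top)) (InR≢ (maps pf jr))
    i (old jr) (old kr) eq = inj pf jr kr (trans (sym (s-low jr)) (trans eq (s-low kr)))

  it-low : ∀ m {j} → InR n j → it s m j ≡ it f m j
  it-low zero    jr = refl
  it-low (suc m) jr = trans (cong s (it-low m jr)) (s-low (it-InR pf m jr))

  it-top : ∀ m → it s m (suc n) ≡ suc n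
  it-top zero    = refl
  it-top (suc m) = trans (cong s (it-top m)) s-top

  R-low : ∀ {j k} → InR n j → Rb s (suc n) j k ≡ Rb f n j k
  R-low {j} {k} jr = bool-iff
    (λ eq → let (m , e) = Rb⇒Reach isPerm eq in Rb-complete pf jr (m , trans (sym (it-low m jr)) e))
    (λ eq → let (m , e) = Rb⇒Reach pf eq in Rb-complete isPerm (InR-suc jr) (m , trans (it-low m jr) e))

  R-low-top : ∀ {j} → InR n j → Rb s (suc n) j (suc n) ≡ false
  R-low-top {j} jr = Bool.¬-not (λ eq → let (m , e) = Rb⇒Reach isPerm eq in InR≢ (it-InR pf m jr) (trans (sym (it-low m jr)) e))

  R-top-low : ∀ {j} → InR n j → Rb s (suc n) (suc n) j ≡ false
  R-top-low {j} jr = Bool.¬-not (λ eq → let (m , e) = Rb⇒Reach isPerm eq in InR≢ jr (trans (sym e) (it-top m)))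

module Insert {n f i} (pf : IsPerm n f) (ir : InR n i) where
  private s = insf n i f

  s-top : s (suc n) ≡ f i
  s-top = if-≡ (suc n)

  s-i : s i ≡ suc n
  s-i = trans (if-≢ (InR≢ ir)) (if-≡ i)

  s-low : ∀ {j} → InR n j → j ≢ i → s j ≡ f j
  s-low jr j≢i = trans (if-≢ (InR≢ jr)) (if-≢ j≢i)

  isPerm : IsPerm (suc n) s
  isPerm = record { maps = λ ir → m (view ir) ; inj = λ ir jr → j (view ir) (view jr) }
    where
    m : ∀ {j} → View n j → InR (suc n) (s j)
    m new rewrite s-top = InR-suc (maps pf ir)
    m {j} (old jr) with j ℕ.≟ i
    ... | yes refl rewrite s-i = InR-top n
    ... | no j≢i   rewrite s-low jr j≢i = InR-suc (maps pf jr)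
    j : ∀ {j k} → View n j → View n k → s j ≡ s k → j ≡ k
    j new new eq = refl
    j {k = k} new (old kr) eq with k ℕ.≟ i
    ... | yes refl = contradiction (trans (sym s-top) (trans eq s-i)) (InR≢ (maps pf ir))
    ... | no k≢i   = contradiction (sym (inj pf ir kr (trans (sym s-top) (trans eq (s-low kr k≢i))))) k≢i
    j {j = j} (old jr) new eq with j ℕ.≟ i
    ... | yes refl = contradiction (trans (sym s-top) (trans (sym eq) s-i)) (InR≢ (maps pf ir))
    ... | no j≢i   = contradiction (inj pf jr ir (trans (sym (s-low jr j≢i)) (trans eq s-top))) j≢i
    j {j} {k} (old jr) (old kr) eq with j ℕ.≟ i | k ℕ.≟ i
    ... | yes refl | yes refl = refl
    ... | yes refl | no k≢i   = contradiction (trans (sym (s-low kr k≢i)) (trans (sym eq) s-i)) (InR≢ (maps pf kr))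
    ... | no j≢i   | yes refl = contradiction (trans (sym (s-low jr j≢i)) (trans eq s-i)) (InR≢ (maps pf jr))
    ... | no j≢i   | no k≢i   = inj pf jr kr (trans (sym (s-low jr j≢i)) (trans eq (s-low kr k≢i)))

  -- Contracting the new element to i sends cycles of s to cycles of f.
  ρ : ℕ → ℕ
  ρ j = if j ≡ᵇ suc n then i else j

  ρ-top : ρ (suc n) ≡ i
  ρ-top = if-≡ (suc n)

  ρ-low : ∀ {j} → InR n j → ρ j ≡ j
  ρ-low jr = if-≢ (InR≢ jr)

  -- One step of `s` contracts to one step of `f`, except for the step from `i` to the new element,
  -- which contracts to none.
  ρ-step : ∀ {j} → InR (suc n) j → Reach f (ρ j) (ρ (s j))
  ρ-step {j} jr with view jr
  ... | new = 1 , trans (cong f ρ-top) (sym (trans (cong ρ s-top) (ρ-low (maps pf ir))))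
  ... | old jr' with j ℕ.≟ i
  ...   | yes refl = 0 , trans (ρ-low jr') (sym (trans (cong ρ s-i) ρ-top))
  ...   | no j≢i   = 1 , trans (cong f (ρ-low jr')) (sym (trans (cong ρ (s-low jr' j≢i)) (ρ-low (maps pf jr'))))

  reach-ρ : ∀ m {j} → InR (suc n) j → Reach f (ρ j) (ρ (it s m j))
  reach-ρ zero    jr = 0 , refl
  reach-ρ (suc m) jr = reach-trans (reach-ρ m jr) (ρ-step (it-InR isPerm m jr))

  -- Conversely a step of `f` lifts to one step of `s`, or to two at `i`, where the path passes
  -- through the new element.
  s-step : ∀ {j} → InR n j → Reach s j (f j)
  s-step {j} jr with j ℕ.≟ i
  ... | yes refl = 2 , trans (cong s s-i) s-top
  ... | no j≢i   = 1 , s-low jr j≢i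

  reach-s : ∀ m {j} → InR n j → Reach s j (it f m j)
  reach-s zero    jr = 0 , refl
  reach-s (suc m) jr = reach-trans (reach-s m jr) (s-step (it-InR pf m jr))

  from-ρ : ∀ {j} → View n j → Reach s (ρ j) j
  from-ρ new      = 1 , trans (cong s ρ-top) s-i
  from-ρ (old jr) = 0 , ρ-low jr

  ρ-InR : ∀ {j} → View n j → InR n (ρ j)
  ρ-InR new      = subst (InR n) (sym ρ-top) ir
  ρ-InR (old jr) = subst (InR n) (sym (ρ-low jr)) jr

  R-ρ : ∀ {j k} → InR (suc n) j → InR (suc n) k → Rb s (suc n) j k ≡ Rb f n (ρ j) (ρ k)
  R-ρ {j} {k} jr kr = bool-iff
    (λ eq → let (m , e) = Rb⇒Reach isPerm eq in Rb-complete pf (ρ-InR (view jr)) (subst (Reach f (ρ j)) (cong ρ e) (reach-ρ m jr)))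
    (λ eq → let (m , e) = Rb⇒Reach pf eq in Rb-complete isPerm jr
      (reach-trans (reach-sym isPerm (InR-suc (ρ-InR (view jr))) (from-ρ (view jr)))
      (reach-trans (subst (Reach s (ρ j)) e (reach-s m (ρ-InR (view jr)))) (from-ρ (view kr)))))

fix : ℕ → List ℕ → List ℕ
fix n π = tab (suc n) (fixf n (app π))

ins : ℕ → List ℕ → ℕ → List ℕ
ins n π i = tab (suc n) (insf n i (app π))

extensions : ℕ → List ℕ → List (List ℕ)
extensions n π = fix n π ∷ map (ins n π) (range n)

length-insertions : ∀ x w → length (insertions x w) ≡ suc (length w)
length-insertions x []      = refl
length-insertions x (y ∷ w) = cong suc (trans (length-map (y ∷_) (insertions x w)) (length-insertions x w))

length-concatMap : ∀ {A B C : Set} (f : A → List B) (g : A → List C) xs → (∀ {x} → x ∈ xs → length (f x) ≡ length (g x)) →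
  length (concatMap f xs) ≡ length (concatMap g xs)
length-concatMap f g []       eq = refl
length-concatMap f g (x ∷ xs) eq = trans (length-++ (f x)) (trans (cong₂ ℕ._+_ (eq (here refl)) (length-concatMap f g xs (eq ∘ there))) (sym (length-++ (g x))))

-- Every permutation of [n+1] is shown to be an extension. Both lists have n + 1 entries for each
-- permutation of [n], so repetitions among the extensions are excluded by counting.
perms-extensions : ∀ n → perms (suc n) ↭ concatMap (extensions n) (perms n)
perms-extensions n = unique-⊆⇒↭ (unique-perms (suc n)) (λ {σ} σ∈ → decompose σ∈)
  (ℕ.≤-reflexive (length-concatMap (extensions n) (insertions (suc n)) (perms n) (λ {w} w∈ →
    trans (cong suc (trans (length-map (ins n w) (range n)) (length-applyUpTo suc n))) (sym (trans (length-insertions (suc n) w) (cong suc (perms-length n w∈)))))))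
  where
  decompose : ∀ {σ} → σ ∈ perms (suc n) → σ ∈ concatMap (extensions n) (perms n)
  decompose {σ} σ∈ with app-posOf σ (∈-resp-↭ (↭-sym (perms⇒↭ (suc n) σ∈)) (∈-range⁺ (s≤s z≤n) ℕ.≤-refl))
  ... | s-i , ir with view (subst (λ l → InR l (posOf (suc n) σ)) (perms-length (suc n) σ∈) ir)
  ...   | p with posOf (suc n) σ
  ...     | i = by-view p s-i
    where
    s : ℕ → ℕ
    s = app σ
    ps : IsPerm (suc n) s
    ps = perms⇒IsPerm (suc n) σ∈
    by-view : ∀ {i} → View n i → s i ≡ suc n → σ ∈ concatMap (extensions n) (perms n)
    by-view new s-top = ∈-concatMap⁺ (extensions n) (lose (IsPerm⇒perms n pf) (here (trans (sym (tab-perms (suc n) σ∈)) (tab-cong (suc n) (λ jr → same-s (view jr))))))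
      where
      pf : IsPerm n s
      pf = record
        { maps = λ jr → InR-pred (maps ps (InR-suc jr)) (λ eq → InR≢ jr (inj ps (InR-suc jr) (InR-top n) (trans eq (sym s-top))))
        ; inj  = λ jr kr → inj ps (InR-suc jr) (InR-suc kr) }
      same-s : ∀ {j} → View n j → s j ≡ fixf n (app (tab n s)) j
      same-s new      = trans s-top (sym (if-≡ (suc n)))
      same-s (old jr) = sym (trans (if-≢ (InR≢ jr)) (app-tab n s jr))
    by-view {i} (old ir) s-i = ∈-concatMap⁺ (extensions n) (lose (IsPerm⇒perms n pf) (there
        (subst (_∈ map (ins n (tab n f)) (range n)) (trans (tab-cong (suc n) (λ jr → sym (same-s (view jr)))) (tab-perms (suc n) σ∈))
          (∈-map⁺ (ins n (tab n f)) (∈-range⁺ (proj₁ ir) (proj₂ ir))))))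
      where
      -- The new element is bypassed in its cycle: its preimage `i` is sent to its image.
      f : ℕ → ℕ
      f j = if j ≡ᵇ i then s (suc n) else s j
      f-i : f i ≡ s (suc n)
      f-i = if-≡ i
      f-≢ : ∀ {j} → j ≢ i → f j ≡ s j
      f-≢ = if-≢
      pf : IsPerm n f
      pf = record { maps = m ; inj = λ {j} {k} → inj' j k }
        where
        m : ∀ {j} → InR n j → InR n (f j)
        m {j} jr with j ℕ.≟ i
        ... | yes refl rewrite f-i = InR-pred (maps ps (InR-top n)) (λ eq → InR≢ ir (inj ps (InR-suc ir) (InR-top n) (trans s-i (sym eq))))
        ... | no j≢i rewrite f-≢ j≢i = InR-pred (maps ps (InR-suc jr)) (λ eq → j≢i (inj ps (InR-suc jr) (InR-suc ir) (trans eq (sym s-i))))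
        inj' : ∀ j k → InR n j → InR n k → f j ≡ f k → j ≡ k
        inj' j k jr kr eq with j ℕ.≟ i | k ℕ.≟ i
        ... | yes refl | yes refl = refl
        ... | yes refl | no k≢i   = contradiction (sym (inj ps (InR-top n) (InR-suc kr) (trans (sym f-i) (trans eq (f-≢ k≢i))))) (InR≢ kr)
        ... | no j≢i   | yes refl = contradiction (inj ps (InR-suc jr) (InR-top n) (trans (sym (f-≢ j≢i)) (trans eq f-i))) (InR≢ jr)
        ... | no j≢i   | no k≢i   = inj ps (InR-suc jr) (InR-suc kr) (trans (sym (f-≢ j≢i)) (trans eq (f-≢ k≢i)))
      same-s : ∀ {j} → View n j → s j ≡ insf n i (app (tab n f)) j
      same-s new = sym (trans (if-≡ (suc n)) (trans (app-tab n f ir) f-i))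
      same-s {j} (old jr) with j ℕ.≟ i
      ... | yes refl = trans s-i (sym (trans (if-≢ (InR≢ jr)) (if-≡ i)))
      ... | no j≢i   = sym (trans (if-≢ (InR≢ jr)) (trans (if-≢ j≢i) (trans (app-tab n f jr) (f-≢ j≢i))))

Σl-perms-suc : ∀ n h → Σl (perms (suc n)) h ≡ Σl (perms n) (λ π → h (fix n π) + Σl (range n) (λ i → h (ins n π i)))
Σl-perms-suc n h = trans (Σl-↭ h (perms-extensions n)) (trans (Σl-concatMap (extensions n) (perms n) h)
  (Σl-cong (perms n) (λ π → cong (h (fix n π) +_) (Σl-map (ins n π) (range n) h))))

-- Weights of permutations: z to the number of cycles, if all cycles are odd;
-- mweight marks an element i whose cycle has to be even instead.

Relation = ℕ → ℕ → Bool

R : ℕ → List ℕ → Relation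
R n π = Rb (app π) n

R-tab : ∀ n {f} → IsPerm n f → ∀ {j k} → InR n j → R n (tab n f) j k ≡ Rb f n j k
R-tab n {f} pf {j} {k} jr = Rb-cong _ f n j k same-it
  where
  same-it : ∀ m → it (app (tab n f)) m j ≡ it f m j
  same-it zero    = refl
  same-it (suc m) = trans (cong (app (tab n f)) (same-it m)) (app-tab n f (it-InR pf m jr))

module Weights (z : ℕ) where
  size : Relation → ℕ → ℕ → ℕ
  size B n j = count (B j) (desc n)

  odd : Relation → ℕ → ℕ → Bool
  odd B n j = isOdd (size B n j)

  modd : Relation → ℕ → ℕ → ℕ → Bool
  modd B n i j = isOdd (bit (B j i) ℕ.+ size B n j)

  zpow : Relation → ℕ → ℚ
  zpow B n = nat (z ℕ.^ classes B (desc n))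

  weight : Relation → ℕ → ℚ
  weight B n = ι (all (odd B n) (desc n)) * zpow B n

  mweight : Relation → ℕ → ℕ → ℚ
  mweight B n i = ι (all (modd B n i) (desc n)) * zpow B n

  _≈[_]_ : Relation → ℕ → Relation → Set
  B ≈[ n ] B' = ∀ {j k} → InR n j → InR n k → B j k ≡ B' j k

  size-cong : ∀ {B B' n} → B ≈[ n ] B' → ∀ {j} → InR n j → size B n j ≡ size B' n j
  size-cong {n = n} eq jr = count-cong∈ (desc n) (λ k∈ → eq jr (∈-desc⁻ k∈))

  zpow-cong : ∀ {B B'} n → B ≈[ n ] B' → zpow B n ≡ zpow B' n
  zpow-cong n eq = cong (λ c → nat (z ℕ.^ c)) (classes-cong∈ (desc n) (λ p q → eq (∈-desc⁻ p) (∈-desc⁻ q)))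

  weight-cong : ∀ {B B'} n → B ≈[ n ] B' → weight B n ≡ weight B' n
  weight-cong {B} {B'} n eq = cong₂ _*_ (cong ι (all-cong∈ (desc n) (λ j∈ → cong isOdd (size-cong {B} {B'} eq (∈-desc⁻ j∈))))) (zpow-cong n eq)

  mweight-cong : ∀ {B B'} n {i} → InR n i → B ≈[ n ] B' → mweight B n i ≡ mweight B' n i
  mweight-cong {B} {B'} n {i} ir eq = cong₂ _*_ (cong ι (all-cong∈ (desc n) (λ j∈ →
    cong isOdd (cong₂ (λ b c → bit b ℕ.+ c) (eq (∈-desc⁻ j∈) ir) (size-cong {B} {B'} eq (∈-desc⁻ j∈)))))) (zpow-cong n eq)

  size-suc : ∀ B n j → size B (suc n) j ≡ bit (B j (suc n)) ℕ.+ size B n j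
  size-suc B n j = length-filterᵇ-∷ (B j) (suc n) (desc n)

  module _ {n f} (pf : IsPerm n f) where
    private
      B = Rb f n
      B' = Rb (fixf n f) (suc n)
    open FixPoint pf

    classes-fix : classes B' (desc (suc n)) ≡ suc (classes B (desc n))
    classes-fix = cong₂ ℕ._+_ (cong (bit ∘ not) (any-none (desc n) (λ k∈ → R-top-low (∈-desc⁻ k∈))))
      (classes-cong∈ (desc n) (λ p _ → R-low (∈-desc⁻ p)))

    size-fix : ∀ {j} → InR n j → size B' (suc n) j ≡ size B n j
    size-fix {j} jr = trans (size-suc B' n j) (cong₂ ℕ._+_ (cong bit (R-low-top jr)) (count-cong∈ (desc n) (λ _ → R-low jr)))

    size-fix-top : size B' (suc n) (suc n) ≡ 1
    size-fix-top = trans (size-suc B' n (suc n)) (cong₂ ℕ._+_ (cong bit (Rb-refl isPerm (InR-top n)))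
      (trans (count-cong∈ {p' = λ _ → false} (desc n) (λ k∈ → R-top-low (∈-desc⁻ k∈))) (count-false (desc n))))
      where
      count-false : ∀ xs → count (λ _ → false) xs ≡ 0
      count-false []       = refl
      count-false (x ∷ xs) = count-false xs

    weight-fix : weight B' (suc n) ≡ nat z * weight B n
    weight-fix = trans (cong₂ _*_ (cong ι (cong₂ _∧_ (cong isOdd size-fix-top) (all-cong∈ (desc n) (λ j∈ → cong isOdd (size-fix (∈-desc⁻ j∈))))))
        (trans (cong (λ c → nat (z ℕ.^ c)) classes-fix) (nat-* z _)))
      (solve 3 (λ a b c → a :* (b :* c) := b :* (a :* c)) refl (ι (all (odd B n) (desc n))) (nat z) (zpow B n))

    -- The cycle of the marked element has length 1 and so is not even.
    mweight-fix : mweight B' (suc n) (suc n) ≡ 0ℚ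
    mweight-fix = trans (cong (λ b → ι (b ∧ all (modd B' (suc n) (suc n)) (desc n)) * zpow B' (suc n))
        (cong₂ (λ b c → isOdd (bit b ℕ.+ c)) (Rb-refl isPerm (InR-top n)) size-fix-top))
      (zeroˡ _)

  module _ {n f i} (pf : IsPerm n f) (ir : InR n i) where
    private
      B = Rb f n
      B' = Rb (insf n i f) (suc n)
    open Insert pf ir

    R-top : ∀ {j} → InR (suc n) j → B' j (suc n) ≡ B (ρ j) i
    R-top {j} jr = trans (R-ρ jr (InR-top n)) (cong (B (ρ j)) ρ-top)

    classes-ins : classes B' (desc (suc n)) ≡ classes B (desc n)
    classes-ins = cong₂ ℕ._+_ (cong (bit ∘ not) (any-true⁺ (B' (suc n)) (∈-desc⁺ ir)
        (trans (R-ρ (InR-top n) (InR-suc ir)) (trans (cong₂ B ρ-top (ρ-low ir)) (Rb-refl pf ir)))))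
      (classes-cong∈ (desc n) (λ p q → trans (R-ρ (InR-suc (∈-desc⁻ p)) (InR-suc (∈-desc⁻ q))) (cong₂ B (ρ-low (∈-desc⁻ p)) (ρ-low (∈-desc⁻ q)))))

    size-ins : ∀ {j} → InR (suc n) j → size B' (suc n) j ≡ bit (B (ρ j) i) ℕ.+ size B n (ρ j)
    size-ins {j} jr = trans (size-suc B' n j) (cong₂ ℕ._+_ (cong bit (R-top jr))
      (count-cong∈ (desc n) (λ k∈ → trans (R-ρ jr (InR-suc (∈-desc⁻ k∈))) (cong (B (ρ j)) (ρ-low (∈-desc⁻ k∈))))))

    -- The condition at the new element repeats the one at `i`, which is already among the
    -- conditions on [n].
    all-ρ : ∀ (p p' : ℕ → Bool) → (∀ {j} → InR (suc n) j → p' j ≡ p (ρ j)) → all p' (desc (suc n)) ≡ all p (desc n)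
    all-ρ p p' eq = trans (cong₂ _∧_ (trans (eq (InR-top n)) (cong p ρ-top))
        (all-cong∈ (desc n) (λ j∈ → trans (eq (InR-suc (∈-desc⁻ j∈))) (cong p (ρ-low (∈-desc⁻ j∈))))))
      (all-absorb p (∈-desc⁺ ir))

    -- Insertion lengthens the cycle of `i` by one, so all cycles become odd exactly when that one
    -- was even and the others odd.
    weight-ins : weight B' (suc n) ≡ mweight B n i
    weight-ins = cong₂ _*_ (cong ι (all-ρ (modd B n i) (odd B' (suc n)) (λ jr → cong isOdd (size-ins jr)))) (cong (λ c → nat (z ℕ.^ c)) classes-ins)

    -- Insertion and marking both flip the parity required of the cycle of `i`, so the two flips
    -- cancel.
    mweight-ins : mweight B' (suc n) (suc n) ≡ weight B n
    mweight-ins = cong₂ _*_ (cong ι (all-ρ (odd B n) (modd B' (suc n) (suc n)) (λ {j} jr →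
        trans (cong₂ (λ b c → isOdd (bit b ℕ.+ c)) (R-top jr) (size-ins jr)) (twice (B (ρ j) i) _))))
      (cong (λ c → nat (z ℕ.^ c)) classes-ins)
      where
      twice : ∀ b m → isOdd (bit b ℕ.+ (bit b ℕ.+ m)) ≡ isOdd m
      twice true  m = refl
      twice false m = refl

-- Conjugation by an involution

module Conjugation {n} (τ : ℕ → ℕ) (τ-inv : ∀ x → τ (τ x) ≡ x) (τ-InR : ∀ {x} → InR n x → InR n (τ x)) where
  conjugate : (ℕ → ℕ) → ℕ → ℕ
  conjugate f = τ ∘ f ∘ τ

  τ-injective : ∀ {x y} → τ x ≡ τ y → x ≡ y
  τ-injective {x} {y} eq = trans (sym (τ-inv x)) (trans (cong τ eq) (τ-inv y))

  isPerm : ∀ {f} → IsPerm n f → IsPerm n (conjugate f)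
  isPerm pf = record
    { maps = λ ir → τ-InR (maps pf (τ-InR ir))
    ; inj  = λ ir jr eq → τ-injective (inj pf (τ-InR ir) (τ-InR jr) (τ-injective eq)) }

  conj : List ℕ → List ℕ
  conj π = tab n (conjugate (app π))

  perms-conj : perms n ↭ map conj (perms n)
  perms-conj = unique-⊆⇒↭ (unique-perms n) (λ {π} π∈ → subst (_∈ map conj (perms n)) (involutive π∈)
      (∈-map⁺ conj (IsPerm⇒perms n (isPerm (perms⇒IsPerm n π∈)))))
    (ℕ.≤-reflexive (length-map conj (perms n)))
    where
    involutive : ∀ {π} → π ∈ perms n → conj (conj π) ≡ π
    involutive {π} π∈ = trans (tab-cong n (λ {j} jr → trans (cong τ (app-tab n (conjugate (app π)) (τ-InR jr)))
      (trans (τ-inv _) (cong (app π) (τ-inv j))))) (tab-perms n π∈)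

  it-conjugate : ∀ f m j → it (conjugate f) m j ≡ τ (it f m (τ j))
  it-conjugate f zero    j = sym (τ-inv j)
  it-conjugate f (suc m) j = cong (τ ∘ f) (trans (cong τ (it-conjugate f m j)) (τ-inv _))

  Rb-conjugate : ∀ f j k → Rb (conjugate f) n j k ≡ Rb f n (τ j) (τ k)
  Rb-conjugate f j k = any-cong∈ (upTo n) (λ {m} _ → trans (cong (_≡ᵇ k) (it-conjugate f m j)) (move (it f m (τ j))))
    where
    move : ∀ y → (τ y ≡ᵇ k) ≡ (y ≡ᵇ τ k)
    move y = bool-iff (λ eq → trans (cong (_≡ᵇ τ k) (trans (sym (τ-inv y)) (cong τ (≡ᵇ-true _ _ eq)))) (≡ᵇ-refl (τ k)))
                      (λ eq → trans (cong (_≡ᵇ k) (trans (cong τ (≡ᵇ-true _ _ eq)) (τ-inv k))) (≡ᵇ-refl k))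

  desc-τ : map τ (desc n) ↭ desc n
  desc-τ = unique-⊆⇒↭ (unique-map τ (λ _ _ → τ-injective) (unique-↭ (↭-sym (desc-↭ n)) (unique-range n)))
    (λ x∈ → image (∈-map⁻ τ x∈)) (ℕ.≤-reflexive (sym (length-map τ (desc n))))
    where
    image : ∀ {x} → (∃ λ a → a ∈ desc n × x ≡ τ a) → x ∈ desc n
    image (a , a∈ , refl) = ∈-desc⁺ (τ-InR (∈-desc⁻ a∈))

  module _ (z : ℕ) where
    open Weights z

    mweight-τ : ∀ {f} → IsPerm n f → ∀ i → let B = Rb f n in mweight (λ j k → B (τ j) (τ k)) n i ≡ mweight B n (τ i)
    mweight-τ {f} pf i = cong₂ _*_ (cong ι all≡)
      (cong (λ c → nat (z ℕ.^ c)) (trans (sym (classes-map B τ (desc n)))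
        (Classes.classes-↭ pf desc-τ (All.tabulate (λ x∈ → ∈-desc⁻ (∈-resp-↭ desc-τ x∈))))))
      where
      B : Relation
      B = Rb f n
      all≡ : all (modd (λ j k → B (τ j) (τ k)) n i) (desc n) ≡ all (modd B n (τ i)) (desc n)
      all≡ = trans (all-cong∈ (desc n) (λ {j} _ → cong (λ c → isOdd (bit (B (τ j) (τ i)) ℕ.+ c))
          (trans (sym (count-map (B (τ j)) τ (desc n))) (count-↭ (B (τ j)) desc-τ))))
        (trans (sym (all-map (modd B n (τ i)) τ (desc n))) (all-↭ (modd B n (τ i)) desc-τ))

    -- Conjugation permutes the permutations of [n] and carries cycles to cycles, moving the mark
    -- from `i` to `τ i`.
    Σmweight-τ : ∀ {i} → InR n i → Σl (perms n) (λ π → mweight (R n π) n i) ≡ Σl (perms n) (λ π → mweight (R n π) n (τ i))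
    Σmweight-τ {i} ir = trans (Σl-↭ _ perms-conj) (trans (Σl-map conj (perms n) _) (Σl-cong∈ (perms n) (λ {π} π∈ →
      trans (mweight-cong {R n (conj π)} {λ j k → R n π (τ j) (τ k)} n ir (λ {j} {k} jr _ →
          trans (R-tab n (isPerm (perms⇒IsPerm n π∈)) jr) (Rb-conjugate (app π) j k)))
        (mweight-τ (perms⇒IsPerm n π∈) i))))

transposition : ℕ → ℕ → ℕ → ℕ
transposition a b x = if x ≡ᵇ a then b else (if x ≡ᵇ b then a else x)

transposition-a : ∀ a b → transposition a b a ≡ b
transposition-a a b = if-≡ a

transposition-b : ∀ a b → transposition a b b ≡ a
transposition-b a b with b ℕ.≟ a
... | yes refl = if-≡ a
... | no b≢a   = trans (if-≢ b≢a) (if-≡ b)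

transposition-≢ : ∀ {a b x} → x ≢ a → x ≢ b → transposition a b x ≡ x
transposition-≢ x≢a x≢b = trans (if-≢ x≢a) (if-≢ x≢b)

transposition-involutive : ∀ a b x → transposition a b (transposition a b x) ≡ x
transposition-involutive a b x with x ℕ.≟ a | x ℕ.≟ b
... | yes refl | _        = trans (cong (transposition a b) (transposition-a a b)) (transposition-b a b)
... | no _     | yes refl = trans (cong (transposition a b) (transposition-b a b)) (transposition-a a b)
... | no x≢a   | no x≢b   = trans (cong (transposition a b) (transposition-≢ x≢a x≢b)) (transposition-≢ x≢a x≢b)

transposition-InR : ∀ {n a b x} → InR n a → InR n b → InR n x → InR n (transposition a b x)
transposition-InR {n} {a} {b} {x} ar br xr with x ℕ.≟ a | x ℕ.≟ b
... | yes refl | _        = subst (InR n) (sym (transposition-a a b)) br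
... | no _     | yes refl = subst (InR n) (sym (transposition-b a b)) ar
... | no x≢a   | no x≢b   = subst (InR n) (sym (transposition-≢ x≢a x≢b)) xr

-- The recurrence for permutations with odd cycles only

module OddCycles (z : ℕ) where
  open Weights z

  D : ℕ → ℚ
  D n = Σl (perms n) (λ π → weight (R n π) n)

  E : ℕ → ℕ → ℚ
  E n i = Σl (perms n) (λ π → mweight (R n π) n i)

  -- A fixed point n + 1 is a new odd cycle, worth z; insertion after `i` requires the cycle of `i`
  -- to have been even.
  D-suc : ∀ n → D (suc n) ≡ nat z * D n + Σl (range n) (E n)
  D-suc n = begin
    D (suc n)
      ≡⟨ Σl-perms-suc n _ ⟩
    Σl (perms n) (λ π → weight (R (suc n) (fix n π)) (suc n) + Σl (range n) (λ i → weight (R (suc n) (ins n π i)) (suc n)))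
      ≡⟨ Σl-cong∈ (perms n) (λ {π} π∈ → let pf = perms⇒IsPerm n π∈ in cong₂ _+_
           (trans (weight-cong (suc n) (λ jr _ → R-tab (suc n) (FixPoint.isPerm pf) jr)) (weight-fix pf))
           (Σl-cong∈ (range n) (λ i∈ → trans (weight-cong (suc n) (λ jr _ → R-tab (suc n) (Insert.isPerm pf (∈-range⁻ i∈)) jr)) (weight-ins pf (∈-range⁻ i∈))))) ⟩
    Σl (perms n) (λ π → nat z * weight (R n π) n + Σl (range n) (λ i → mweight (R n π) n i))
      ≡⟨ Σl-+ (perms n) _ _ ⟩
    Σl (perms n) (λ π → nat z * weight (R n π) n) + Σl (perms n) (λ π → Σl (range n) (λ i → mweight (R n π) n i))
      ≡⟨ cong₂ _+_ (Σl-*ˡ (perms n) _ _) (Σl-swap (perms n) (range n) _) ⟩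
    nat z * D n + Σl (range n) (E n) ∎
    where open ≡-Reasoning

  -- A marked n + 1 cannot be fixed, and removing it from its even cycle leaves odd cycles only.
  -- There are n places from which it can come.
  E-top : ∀ n → E (suc n) (suc n) ≡ nat n * D n
  E-top n = begin
    E (suc n) (suc n)
      ≡⟨ Σl-perms-suc n _ ⟩
    Σl (perms n) (λ π → mweight (R (suc n) (fix n π)) (suc n) (suc n) + Σl (range n) (λ i → mweight (R (suc n) (ins n π i)) (suc n) (suc n)))
      ≡⟨ Σl-cong∈ (perms n) (λ {π} π∈ → let pf = perms⇒IsPerm n π∈ in trans (cong₂ _+_
           (trans (mweight-cong (suc n) (InR-top n) (λ jr _ → R-tab (suc n) (FixPoint.isPerm pf) jr)) (mweight-fix pf))
           (Σl-range-const n (weight (R n π) n) (λ ir → trans (mweight-cong (suc n) (InR-top n) (λ jr _ → R-tab (suc n) (Insert.isPerm pf ir) jr)) (mweight-ins pf ir))))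
         (+-identityˡ _)) ⟩
    Σl (perms n) (λ π → nat n * weight (R n π) n)
      ≡⟨ Σl-*ˡ (perms n) _ _ ⟩
    nat n * D n ∎
    where open ≡-Reasoning

  -- Conjugation by the transposition of `i` and n + 1 reduces any mark to the one evaluated in
  -- `E-top`.
  E-symmetric : ∀ n {i} → InR (suc n) i → E (suc n) i ≡ E (suc n) (suc n)
  E-symmetric n {i} ir = trans (Conjugation.Σmweight-τ (transposition i (suc n)) (transposition-involutive i (suc n))
      (transposition-InR ir (InR-top n)) z ir)
    (cong (E (suc n)) (transposition-a i (suc n)))

  D-recurrence : ∀ n → D (2 ℕ.+ n) ≡ nat z * D (1 ℕ.+ n) + nat (1 ℕ.+ n) * (nat n * D n)
  D-recurrence n = trans (D-suc (suc n)) (cong (nat z * D (suc n) +_)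
    (Σl-range-const (suc n) _ (λ ir → trans (E-symmetric n ir) (E-top n))))

  D-0 : D 0 ≡ 1ℚ
  D-0 = trans (+-identityʳ _) (trans (*-identityˡ _) nat-1)

  D-1 : D 1 ≡ nat z
  D-1 = trans (D-suc 0) (trans (+-identityʳ _) (trans (cong (nat z *_) D-0) (*-identityʳ _)))

  -- The permutations are grouped by their number of cycles; the bound `cyc≤n` ensures that no group
  -- is cut off.
  d-sum : ∀ n → Σ≤ n (λ k → nat (d n k) * nat (z ℕ.^ k)) ≡ D n
  d-sum n = begin
    Σ≤ n (λ k → nat (d n k) * nat (z ℕ.^ k))
      ≡⟨ Σ≤-cong n (λ k _ → trans (cong (_* nat (z ℕ.^ k)) (nat-length-filterᵇ _ (perms n))) (sym (Σl-*ʳ (perms n) _ _))) ⟩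
    Σ≤ n (λ k → Σl (perms n) (λ π → ι (allOddCycles π ∧ (cyc π ≡ᵇ k)) * nat (z ℕ.^ k)))
      ≡⟨ sym (Σl-Σ≤ (perms n) n (λ π k → ι (allOddCycles π ∧ (cyc π ≡ᵇ k)) * nat (z ℕ.^ k))) ⟩
    Σl (perms n) (λ π → Σ≤ n (λ k → ι (allOddCycles π ∧ (cyc π ≡ᵇ k)) * nat (z ℕ.^ k)))
      ≡⟨ Σl-cong∈ (perms n) (λ {π} π∈ → begin
           Σ≤ n (λ k → ι (allOddCycles π ∧ (cyc π ≡ᵇ k)) * nat (z ℕ.^ k))
             ≡⟨ Σ≤-cong n (λ k _ → trans (cong (_* nat (z ℕ.^ k)) (ι-∧ (allOddCycles π) _)) (*-assoc _ _ _)) ⟩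
           Σ≤ n (λ k → ι (allOddCycles π) * (ι (cyc π ≡ᵇ k) * nat (z ℕ.^ k)))
             ≡⟨ Σ≤-*ˡ n _ _ ⟩
           ι (allOddCycles π) * Σ≤ n (λ k → ι (cyc π ≡ᵇ k) * nat (z ℕ.^ k))
             ≡⟨ cong (ι (allOddCycles π) *_) (Σ≤-δ n (cyc π) (λ k → nat (z ℕ.^ k)) (Stats.cyc≤n {n} π∈)) ⟩
           ι (allOddCycles π) * nat (z ℕ.^ cyc π)
             ≡⟨ cong₂ (λ b c → ι b * nat (z ℕ.^ c)) (Stats.allOddCycles≡ {n} π∈) (Stats.cyc≡ {n} π∈) ⟩
           weight (R n π) n ∎) ⟩
    D n ∎
    where open ≡-Reasoning

-- Both sides satisfy the same second-order recurrence, so the induction carries two consecutive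
-- values.
D≡n!r^ : ∀ m n → OddCycles.D (2 ℕ.* m) n ≡ nat (n !) * (r ^ m) n
D≡n!r^ m n = proj₁ (go n)
  where
  open OddCycles (2 ℕ.* m)
  Claim : ℕ → Set
  Claim n = D n ≡ nat (n !) * (r ^ m) n
  step : ∀ n → Claim n → Claim (1 ℕ.+ n) → Claim (2 ℕ.+ n)
  step n c₀ c₁ = begin
    D (2 ℕ.+ n)
      ≡⟨ D-recurrence n ⟩
    nat (2 ℕ.* m) * D (1 ℕ.+ n) + nat (1 ℕ.+ n) * (nat n * D n)
      ≡⟨ cong₂ (λ x y → nat (2 ℕ.* m) * x + nat (1 ℕ.+ n) * (nat n * y)) (trans c₁ (cong (_* a₁) (nat-* (1 ℕ.+ n) (n !)))) c₀ ⟩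
    nat (2 ℕ.* m) * (nat (1 ℕ.+ n) * nat (n !) * a₁) + nat (1 ℕ.+ n) * (nat n * (nat (n !) * a₀))
      ≡⟨ solve 6 (λ z s f x k y → z :* (s :* f :* x) :+ s :* (k :* (f :* y)) := (s :* f) :* (k :* y :+ z :* x)) refl
           (nat (2 ℕ.* m)) (nat (1 ℕ.+ n)) (nat (n !)) a₁ (nat n) a₀ ⟩
    nat (1 ℕ.+ n) * nat (n !) * (nat n * a₀ + nat (2 ℕ.* m) * a₁)
      ≡⟨ cong₂ _*_ (sym (nat-* (1 ℕ.+ n) (n !))) (sym (r^-recurrence m n)) ⟩
    nat ((1 ℕ.+ n) !) * (nat (2 ℕ.+ n) * (r ^ m) (2 ℕ.+ n))
      ≡⟨ solve 3 (λ a b c → a :* (b :* c) := (b :* a) :* c) refl (nat ((1 ℕ.+ n) !)) (nat (2 ℕ.+ n)) ((r ^ m) (2 ℕ.+ n)) ⟩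
    nat (2 ℕ.+ n) * nat ((1 ℕ.+ n) !) * (r ^ m) (2 ℕ.+ n)
      ≡⟨ cong (_* (r ^ m) (2 ℕ.+ n)) (sym (nat-* (2 ℕ.+ n) ((1 ℕ.+ n) !))) ⟩
    nat ((2 ℕ.+ n) !) * (r ^ m) (2 ℕ.+ n) ∎
    where
    open ≡-Reasoning
    a₀ a₁ : ℚ
    a₀ = (r ^ m) n
    a₁ = (r ^ m) (1 ℕ.+ n)
  go : ∀ n → Claim n × Claim (suc n)
  go zero    = trans D-0 (sym (trans (cong₂ _*_ nat-1 (r^-0 m)) (*-identityˡ 1ℚ)))
             , trans D-1 (sym (trans (cong₂ _*_ nat-1 (r^-1 m)) (*-identityˡ _)))
  go (suc n) = let (c₀ , c₁) = go n in c₁ , step n c₀ c₁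

-- The right side of (c) as a power of (1+x)/(1-x)

opaque
  unfolding _*_ nat

  recip-* : ∀ N .{{_ : ℕ.NonZero N}} → (ℤ.+ 1 ℚ./ N) * nat N ≡ 1ℚ
  recip-* (suc N) = ℚ.toℚᵘ-injective {(ℤ.+ 1 ℚ./ suc N) ℚ.* (ℤ.+ suc N ℚ./ 1)} {1ℚ}
    (ℚᵘ.≃-trans (ℚ.toℚᵘ-homo-* (ℤ.+ 1 ℚ./ suc N) (ℤ.+ suc N ℚ./ 1))
    (ℚᵘ.≃-trans (ℚᵘ.*-cong (ℚ.toℚᵘ-fromℚᵘ (ℚᵘ.mkℚᵘ (ℤ.+ 1) N)) (ℚ.toℚᵘ-fromℚᵘ (ℚᵘ.mkℚᵘ (ℤ.+ suc N) 0)))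
      (ℚᵘ.*≡* (trans (ℤ.*-identityʳ _) (trans (ℤ.*-identityˡ (ℤ.+ suc N)) (sym (trans (ℤ.*-identityˡ _) (cong (λ x → ℤ.+ suc x) (ℕ.*-identityʳ N)))))))))

inv!-* : ∀ n → inv! n * nat (n !) ≡ 1ℚ
inv!-* n = recip-* (n !) {{n ℕ.!≢0}}

sumTo₂-at : ∀ n F i j → sumTo₂ n F i j ≡ Σ≤ n (λ k → F k i j)
sumTo₂-at zero    F i j = refl
sumTo₂-at (suc n) F i j = trans (+-def _ _) (cong (_+ F (suc n) i j) (sumTo₂-at n F i j))

^-distribʳ-* : ∀ k a b → (a ℕ.* b) ℕ.^ k ≡ a ℕ.^ k ℕ.* b ℕ.^ k
^-distribʳ-* zero    a b = refl
^-distribʳ-* (suc k) a b = trans (cong (a ℕ.* b ℕ.*_) (^-distribʳ-* k a b)) (ℕ.[m*n]*[o*p]≡[m*o]*[n*p] a b (a ℕ.^ k) (b ℕ.^ k))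

-- With m = (2i+1)j the Eulerian factors give 2^k (2i+1)^k j^k = (2m)^k, so the sum over k is
-- `OddCycles.D` at z = 2m. Of 2^(k+1) a single 2 is left over.
RHSc≡r^ : ∀ n i j → RHSc n i j ≡ nat 2 * (r ^ (2 ℕ.* i ℕ.* j ℕ.+ j)) n
RHSc≡r^ n i j = begin
  RHSc n i j
    ≡⟨ *-def _ _ ⟩
  inv! n * sumTo₂ n _ i j
    ≡⟨ cong (inv! n *_) (trans (sumTo₂-at n _ i j) (Σ≤-cong n (λ k _ → trans (*-def _ _)
         (cong₂ _*_ (nat-def _) (inS-inT (Beul-series k) (Aeul-series k) i j))))) ⟩
  inv! n * Σ≤ n (λ k → nat (2 ℕ.^ suc k ℕ.* d n k) * (nat (suc (2 ℕ.* i) ℕ.^ k) * nat (j ℕ.^ k)))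
    ≡⟨ cong (inv! n *_) (trans (Σ≤-cong n (λ k _ → term k)) (Σ≤-*ˡ n (nat 2) _)) ⟩
  inv! n * (nat 2 * Σ≤ n (λ k → nat (d n k) * nat ((2 ℕ.* m) ℕ.^ k)))
    ≡⟨ cong (λ x → inv! n * (nat 2 * x)) (trans (OddCycles.d-sum (2 ℕ.* m) n) (D≡n!r^ m n)) ⟩
  inv! n * (nat 2 * (nat (n !) * (r ^ m) n))
    ≡⟨ solve 4 (λ a b c e → a :* (b :* (c :* e)) := (a :* c) :* (b :* e)) refl (inv! n) (nat 2) (nat (n !)) ((r ^ m) n) ⟩
  inv! n * nat (n !) * (nat 2 * (r ^ m) n)
    ≡⟨ trans (cong (_* (nat 2 * (r ^ m) n)) (inv!-* n)) (*-identityˡ _) ⟩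
  nat 2 * (r ^ m) n ∎
  where
  open ≡-Reasoning
  m : ℕ
  m = 2 ℕ.* i ℕ.* j ℕ.+ j
  powers : ∀ k → (2 ℕ.* m) ℕ.^ k ≡ 2 ℕ.^ k ℕ.* (suc (2 ℕ.* i) ℕ.^ k ℕ.* j ℕ.^ k)
  powers k = trans (^-distribʳ-* k 2 m) (cong (2 ℕ.^ k ℕ.*_) (trans (cong (ℕ._^ k) (ℕ.+-comm (2 ℕ.* i ℕ.* j) j)) (^-distribʳ-* k (suc (2 ℕ.* i)) j)))
  term : ∀ k → nat (2 ℕ.^ suc k ℕ.* d n k) * (nat (suc (2 ℕ.* i) ℕ.^ k) * nat (j ℕ.^ k)) ≡ nat 2 * (nat (d n k) * nat ((2 ℕ.* m) ℕ.^ k))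
  term k = begin
    nat (2 ℕ.^ suc k ℕ.* d n k) * (x * y)
      ≡⟨ cong (_* (x * y)) (trans (nat-* (2 ℕ.^ suc k) (d n k)) (cong (_* nat (d n k)) (nat-* 2 (2 ℕ.^ k)))) ⟩
    nat 2 * nat (2 ℕ.^ k) * nat (d n k) * (x * y)
      ≡⟨ solve 5 (λ a b c x y → a :* b :* c :* (x :* y) := a :* (c :* (b :* (x :* y)))) refl (nat 2) (nat (2 ℕ.^ k)) (nat (d n k)) x y ⟩
    nat 2 * (nat (d n k) * (nat (2 ℕ.^ k) * (x * y)))
      ≡⟨ cong (λ p → nat 2 * (nat (d n k) * p)) (sym (trans (cong nat (powers k)) (trans (nat-* (2 ℕ.^ k) _) (cong (nat (2 ℕ.^ k) *_) (nat-* (suc (2 ℕ.* i) ℕ.^ k) _))))) ⟩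
    nat 2 * (nat (d n k) * nat ((2 ℕ.* m) ℕ.^ k)) ∎
    where
    x y : ℚ
    x = nat (suc (2 ℕ.* i) ℕ.^ k)
    y = nat (j ℕ.^ k)

theorem4p6 : (∀ n i j → LHSa n i j ≡ RHSa n i j)
    × (∀ n → n ≥ 1 → Fser n ≋₂ RHSb n)
    × (∀ n → n ≥ 1 → Fser n ≋₂ RHSc n)
theorem4p6 = part-a , part-b , λ { (suc n) _ i j → trans (Fser≡r^ n i j) (sym (RHSc≡r^ (suc n) i j)) }
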